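{- For every $n\in\mathbb N=\{1,2,3,\dots\}$ there is a graph of order $10+24n$ which is a counterexample to each of the following three conjectures. (A) Let $G$ be a cyclically $5$-edge connected cycle permutation graph. If $G$ is a snark, then $G$ must be the Petersen graph. (B) Let $G$ be a cyclically $5$-edge connected cubic graph and $D$ be a set of pairwise disjoint circuits of $G$. Then $D$ is a subset of a CDC of $G$, unless $G$ is the Petersen graph. (C) Let $G$ be a cycle permutation graph with chordless circuits $C_1$ and $C_2$ where $C_1\cup C_2$ is a $2$-factor. If $G$ is cyclically $5$-edge connected and there is no CDC of $G$ which includes both $C_1$ and $C_2$, then $G$ must be the Petersen graph.
   Context: A circuit is a $2$-regular $2$-connected graph. A circuit double cover (CDC) of a cubic graph $G$ is a set $S$ of circuits of $G$ such that every edge of $G$ is covered by exactly two circuits of $S$. A cycle permutation graph is a cubic graph with a $2$-factor consisting of two chordless circuits. A snark is (as usual) a cyclically $4$-edge connected cubic graph of girth at least $5$ that is not $3$-edge colorable. For a graph $G$ containing two vertex-disjoint circuits, $\lambda_c(G)$ is the minimum number of edges one needs to delete in order to obtain two components each containing a circuit; $G$ is cyclically $k$-edge connected if $\lambda_c(G)\ge k$. -}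

module Defs where

open import Data.Bool using (if_then_else_)
open import Data.Fin using (Fin; _<?_)
open import Data.Fin.Patterns
open import Data.Fin.Properties using (all?)
open import Data.Fin.Subset
  using (Subset; _∈_; _∉_; _⊆_; _∪_; _∩_; _─_; inside; outside; ⊥; ⊤; ⁅_⁆; ∣_∣; Nonempty; Empty)
open import Data.Fin.Subset.Properties using (_∈?_; ∉⊥; ∈⊤; x∈p∪q⁺; x∈p∪q⁻; p─q⊆p; x∈p∧x∉q⇒x∈p─q)
open import Data.List using (List; length; filter; allFin; cartesianProduct)
open import Data.List.Relation.Unary.All using (All)
open import Data.List.Relation.Unary.AllPairs using (AllPairs)
import Data.List.Membership.Setoid as Membership
import Data.List.Relation.Binary.Subset.Setoid as ListSubset
import Data.List.Relation.Unary.Unique.Setoid as Unique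
open import Data.Nat using (ℕ; _≤_)
open import Data.Product using (_×_; _,_; ∃-syntax; Σ-syntax; proj₁; proj₂)
import Data.Sum as Sum
open import Data.Vec using (_∷_; here; there)
open import Function using (_∘_)
open import Function.Bundles using (_⇔_)
open import Level using (0ℓ)
open import Relation.Binary.Bundles using (Setoid)
open import Relation.Binary.Construct.Closure.ReflexiveTransitive using (Star)
open import Relation.Binary.PropositionalEquality as ≡ using (_≡_; _≢_; refl)
open import Relation.Nullary using (¬_; contradiction; yes; no)
open import Relation.Nullary.Decidable using (does; from-yes; ¬?; _×-dec_; _→-dec_)

private variable
  m n : ℕ

-- Finite simple graphs whose vertices are drawn from Fin n.  The vertex set V
-- need not be all of Fin n, so that the subgraphs of a graph are themselves
-- graphs over the same Fin n.  N u is the neighbourhood of u.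

record Graph (n : ℕ) : Set where
  field
    V      : Subset n
    N      : Fin n → Subset n
    N⊆V    : ∀ {u} → N u ⊆ V
    sym    : ∀ {u v} → v ∈ N u → u ∈ N v
    irrefl : ∀ {u} → u ∉ N u

open Graph public using (V; N)

Adj : Graph n → Fin n → Fin n → Set
Adj G u v = v ∈ N G u

order : Graph n → ℕ
order G = ∣ V G ∣

edges : Graph n → List (Fin n × Fin n)
edges {n} G =
  filter (λ (u , v) → (u <? v) ×-dec (v ∈? N G u))
         (cartesianProduct (allFin n) (allFin n))

size : Graph n → ℕ
size G = length (edges G)

infix 4 _⊆ᴳ_ _≈ᴳ_ _≅_

_⊆ᴳ_ : Graph n → Graph n → Set
H ⊆ᴳ G = V H ⊆ V G × (∀ u → N H u ⊆ N G u)

-- Equality of graphs over the same Fin n: same vertex set, same edge set.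

_≈ᴳ_ : Graph n → Graph n → Set
G ≈ᴳ H = V G ≡ V H × (∀ u → N G u ≡ N H u)

graphSetoid : ℕ → Setoid 0ℓ 0ℓ
graphSetoid n = record
  { Carrier       = Graph n
  ; _≈_           = _≈ᴳ_
  ; isEquivalence = record
    { refl  = refl , λ _ → refl
    ; sym   = λ (p , q) → ≡.sym p , ≡.sym ∘ q
    ; trans = λ (p , q) (p′ , q′) → ≡.trans p p′ , λ u → ≡.trans (q u) (q′ u)
    }
  }

record _≅_ (G : Graph m) (H : Graph n) : Set where
  field
    to      : Fin m → Fin n
    from    : Fin n → Fin m
    to-V    : ∀ {u} → u ∈ V G → to u ∈ V H
    from-V  : ∀ {x} → x ∈ V H → from x ∈ V G
    from-to : ∀ {u} → u ∈ V G → from (to u) ≡ u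
    to-from : ∀ {x} → x ∈ V H → to (from x) ≡ x
    adj     : ∀ {u v} → u ∈ V G → v ∈ V G → Adj G u v ⇔ Adj H (to u) (to v)

infixl 6 _∪ᴳ_ _∖ⱽ_ _∖ᴱ_

_∪ᴳ_ : Graph n → Graph n → Graph n
G ∪ᴳ H = record
  { V      = V G ∪ V H
  ; N      = λ u → N G u ∪ N H u
  ; N⊆V    = λ p → x∈p∪q⁺ (Sum.map (Graph.N⊆V G) (Graph.N⊆V H) (x∈p∪q⁻ _ _ p))
  ; sym    = λ p → x∈p∪q⁺ (Sum.map (Graph.sym G) (Graph.sym H) (x∈p∪q⁻ _ _ p))
  ; irrefl = λ p → Sum.[ Graph.irrefl G , Graph.irrefl H ] (x∈p∪q⁻ _ _ p)
  }

private
  x∈p─q⇒x∉q : ∀ (p q : Subset n) {x} → x ∈ p ─ q → x ∉ q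
  x∈p─q⇒x∉q (_ ∷ p) (outside ∷ q) here       ()
  x∈p─q⇒x∉q (_ ∷ p) (inside  ∷ q) (there x∈) (there x∈q) = x∈p─q⇒x∉q p q x∈ x∈q
  x∈p─q⇒x∉q (_ ∷ p) (outside ∷ q) (there x∈) (there x∈q) = x∈p─q⇒x∉q p q x∈ x∈q

  ∈─⁻ : ∀ (p q : Subset n) {x} → x ∈ p ─ q → x ∈ p × x ∉ q
  ∈─⁻ p q x∈ = p─q⊆p p q x∈ , x∈p─q⇒x∉q p q x∈

_∖ⱽ_ : Graph n → Subset n → Graph n
_∖ⱽ_ {n} G X = record
  { V = V G ─ X ; N = N′ ; N⊆V = N′⊆V ; sym = sym′ ; irrefl = irrefl′ }
  where
  N′ : Fin n → Subset n
  N′ u = if does (u ∈? X) then ⊥ else N G u ─ X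

  ∈N′⁻ : ∀ u {v} → v ∈ N′ u → u ∉ X × v ∈ N G u × v ∉ X
  ∈N′⁻ u v∈ with u ∈? X
  ... | yes _  = contradiction v∈ ∉⊥
  ... | no u∉X = u∉X , ∈─⁻ (N G u) X v∈

  ∈N′⁺ : ∀ u {v} → u ∉ X → v ∈ N G u → v ∉ X → v ∈ N′ u
  ∈N′⁺ u u∉X v∈ v∉X with u ∈? X
  ... | yes u∈X = contradiction u∈X u∉X
  ... | no _    = x∈p∧x∉q⇒x∈p─q v∈ v∉X

  N′⊆V : ∀ {u} → N′ u ⊆ V G ─ X
  N′⊆V {u} v∈ with ∈N′⁻ u v∈
  ... | _ , v∈N , v∉X = x∈p∧x∉q⇒x∈p─q (Graph.N⊆V G v∈N) v∉X

  sym′ : ∀ {u v} → v ∈ N′ u → u ∈ N′ v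
  sym′ {u} {v} v∈ with ∈N′⁻ u v∈
  ... | u∉X , v∈N , v∉X = ∈N′⁺ v v∉X (Graph.sym G v∈N) u∉X

  irrefl′ : ∀ {u} → u ∉ N′ u
  irrefl′ {u} u∈ = Graph.irrefl G (proj₁ (proj₂ (∈N′⁻ u u∈)))

-- Deletes the edges of F; all vertices are kept.

_∖ᴱ_ : Graph n → Graph n → Graph n
G ∖ᴱ F = record
  { V      = V G
  ; N      = λ u → N G u ─ N F u
  ; N⊆V    = λ {u} p → Graph.N⊆V G (p─q⊆p (N G u) (N F u) p)
  ; sym    = λ {u} p → let v∈G , v∉F = ∈─⁻ (N G u) (N F u) p in
               x∈p∧x∉q⇒x∈p─q (Graph.sym G v∈G) (v∉F ∘ Graph.sym F)
  ; irrefl = λ {u} p → Graph.irrefl G (p─q⊆p (N G u) (N F u) p)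
  }

Regular : ℕ → Graph n → Set
Regular k G = ∀ {u} → u ∈ V G → ∣ N G u ∣ ≡ k

Cubic : Graph n → Set
Cubic = Regular 3

Connected : Graph n → Set
Connected G = Nonempty (V G) × (∀ {u v} → u ∈ V G → v ∈ V G → Star (Adj G) u v)

TwoConnected : Graph n → Set
TwoConnected G =
  3 ≤ order G × Connected G × (∀ {v} → v ∈ V G → Connected (G ∖ⱽ ⁅ v ⁆))

Component : Graph n → Graph n → Set
Component {n} G K =
  K ⊆ᴳ G × Connected K ×
  (∀ (K′ : Graph n) → K′ ⊆ᴳ G → Connected K′ → K ⊆ᴳ K′ → K′ ⊆ᴳ K)

Circuit : Graph n → Set
Circuit C = Regular 2 C × TwoConnected C

CircuitOf : Graph n → Graph n → Set
CircuitOf G C = C ⊆ᴳ G × Circuit C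

ContainsCircuit : Graph n → Set
ContainsCircuit {n} G = Σ[ C ∈ Graph n ] CircuitOf G C

Disjoint : Graph n → Graph n → Set
Disjoint G H = Empty (V G ∩ V H)

Chordless : Graph n → Graph n → Set
Chordless G C = ∀ {u v} → u ∈ V C → v ∈ V C → Adj G u v → Adj C u v

-- A set of edges of G is given as the edge set of a subgraph F of G.

CyclicEdgeCut : Graph n → Graph n → Set
CyclicEdgeCut {n} G F =
  F ⊆ᴳ G ×
  (Σ[ K₁ ∈ Graph n ] Σ[ K₂ ∈ Graph n ]
     Component (G ∖ᴱ F) K₁ × Component (G ∖ᴱ F) K₂ × ¬ (K₁ ≈ᴳ K₂) ×
     ContainsCircuit K₁ × ContainsCircuit K₂)

-- λc G ≔ k states that λ_c(G) is defined and equal to k; a cyclic edge cut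
-- exists exactly when G contains two vertex-disjoint circuits.

λc_≔_ : Graph n → ℕ → Set
λc_≔_ {n} G k =
  (Σ[ F ∈ Graph n ] CyclicEdgeCut G F × size F ≡ k) ×
  (∀ (F : Graph n) → CyclicEdgeCut G F → k ≤ size F)

CyclicallyEdgeConnected : ℕ → Graph n → Set
CyclicallyEdgeConnected k G = ∃[ l ] (λc G ≔ l) × k ≤ l

GirthAtLeast : ℕ → Graph n → Set
GirthAtLeast {n} g G = ∀ (C : Graph n) → CircuitOf G C → g ≤ order C

EdgeColourable : ℕ → Graph n → Set
EdgeColourable {n} k G =
  Σ[ c ∈ (Fin n → Fin n → Fin k) ]
    (∀ {u v} → Adj G u v → c u v ≡ c v u) ×
    (∀ {u v w} → Adj G u v → Adj G u w → v ≢ w → c u v ≢ c u w)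

Snark : Graph n → Set
Snark G =
  Cubic G × CyclicallyEdgeConnected 4 G × GirthAtLeast 5 G × ¬ EdgeColourable 3 G

TwoFactor : Graph n → Graph n → Set
TwoFactor G F = F ⊆ᴳ G × V F ≡ V G × Regular 2 F

CyclePermutationWith : Graph n → Graph n → Graph n → Set
CyclePermutationWith G C₁ C₂ =
  Cubic G × CircuitOf G C₁ × CircuitOf G C₂ × Disjoint C₁ C₂ ×
  TwoFactor G (C₁ ∪ᴳ C₂) × Chordless G C₁ × Chordless G C₂

CyclePermutation : Graph n → Set
CyclePermutation {n} G =
  Σ[ C₁ ∈ Graph n ] Σ[ C₂ ∈ Graph n ] CyclePermutationWith G C₁ C₂

-- Sets of graphs over Fin n are duplicate-free lists, up to _≈ᴳ_.

module _ {n : ℕ} where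
  open Membership (graphSetoid n) public using () renaming (_∈_ to _∈ᴸ_)
  open ListSubset (graphSetoid n) public using () renaming (_⊆_ to _⊆ᴸ_)
  open Unique (graphSetoid n) public using () renaming (Unique to Uniqueᴸ)

CDC : Graph n → List (Graph n) → Set
CDC G S =
  Uniqueᴸ S × All (CircuitOf G) S ×
  (∀ {u v} → Adj G u v → length (filter (λ C → v ∈? N C u) S) ≡ 2)

-- The outer pentagon is 0 1 2 3 4, the inner pentagram 5 7 9 6 8.

petersen : Graph 10
petersen = record
  { V      = ⊤
  ; N      = Nᴾ
  ; N⊆V    = λ _ → ∈⊤
  ; sym    = λ {u} {v} →
      from-yes (all? λ u → all? λ v → (v ∈? Nᴾ u) →-dec (u ∈? Nᴾ v)) u v
  ; irrefl = λ {u} → from-yes (all? λ u → ¬? (u ∈? Nᴾ u)) u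
  }
  where
  Nᴾ : Fin 10 → Subset 10
  Nᴾ 0F = ⁅ 1F ⁆ ∪ ⁅ 4F ⁆ ∪ ⁅ 5F ⁆
  Nᴾ 1F = ⁅ 0F ⁆ ∪ ⁅ 2F ⁆ ∪ ⁅ 6F ⁆
  Nᴾ 2F = ⁅ 1F ⁆ ∪ ⁅ 3F ⁆ ∪ ⁅ 7F ⁆
  Nᴾ 3F = ⁅ 2F ⁆ ∪ ⁅ 4F ⁆ ∪ ⁅ 8F ⁆
  Nᴾ 4F = ⁅ 0F ⁆ ∪ ⁅ 3F ⁆ ∪ ⁅ 9F ⁆
  Nᴾ 5F = ⁅ 0F ⁆ ∪ ⁅ 7F ⁆ ∪ ⁅ 8F ⁆
  Nᴾ 6F = ⁅ 1F ⁆ ∪ ⁅ 8F ⁆ ∪ ⁅ 9F ⁆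
  Nᴾ 7F = ⁅ 2F ⁆ ∪ ⁅ 5F ⁆ ∪ ⁅ 9F ⁆
  Nᴾ 8F = ⁅ 3F ⁆ ∪ ⁅ 5F ⁆ ∪ ⁅ 6F ⁆
  Nᴾ 9F = ⁅ 4F ⁆ ∪ ⁅ 6F ⁆ ∪ ⁅ 7F ⁆

-- A counterexample satisfies every hypothesis of the conjecture and violates
-- its conclusion.

-- "A cyclically 5-edge connected cycle permutation graph that is a snark is
-- the Petersen graph."

CounterexampleA : Graph n → Set
CounterexampleA G =
  CyclicallyEdgeConnected 5 G × CyclePermutation G × Snark G × ¬ (G ≅ petersen)

-- "In a cyclically 5-edge connected cubic graph other than the Petersen graph,
-- every set D of pairwise disjoint circuits is a subset of a CDC."  Pairwise
-- disjoint circuits in the list D are in particular distinct.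

CounterexampleB : Graph n → Set
CounterexampleB {n} G =
  CyclicallyEdgeConnected 5 G × Cubic G ×
  (Σ[ D ∈ List (Graph n) ]
     All (CircuitOf G) D × AllPairs Disjoint D ×
     ¬ (Σ[ S ∈ List (Graph n) ] CDC G S × D ⊆ᴸ S)) ×
  ¬ (G ≅ petersen)

-- "A cyclically 5-edge connected cycle permutation graph, with chordless
-- circuits C₁ and C₂ forming a 2-factor, that has no CDC including both C₁ and
-- C₂ is the Petersen graph."

CounterexampleC : Graph n → Set
CounterexampleC {n} G =
  (Σ[ C₁ ∈ Graph n ] Σ[ C₂ ∈ Graph n ]
     CyclePermutationWith G C₁ C₂ ×
     CyclicallyEdgeConnected 5 G ×
     ¬ (Σ[ S ∈ List (Graph n) ] CDC G S × C₁ ∈ᴸ S × C₂ ∈ᴸ S)) ×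
  ¬ (G ≅ petersen)

{-# OPTIONS --safe #-}

-- A permutation graph is given by the cyclic orders in which its rungs, the
-- edges between the two chordless circuits C₁ and C₂, are met along C₁ and C₂.
--
-- Label the edges of C₁ and C₂ so that, for every rung, the two labels at one
-- end are distinct and form the same set as the two labels at the other end.
-- A 3-edge-colouring restricts to such a labelling, and a circuit double cover
-- containing C₁ and C₂ yields one, each edge of C₁ or C₂ being labelled with
-- the other circuit through it.  So a graph without labellings has neither.
--
-- A set of vertices with at most four boundary edges meets C₁ and C₂ in an even
-- number of boundary edges each, so it is bounded by two edges of C₁ and two of
-- C₂ unless it or its complement is a proper part of one of the two circuits.
-- Hence the graph is cyclically 5-edge connected of girth at least 5 as soon as
-- no nontrivial arc of C₁ is matched with an arc of C₂.
--
-- Starting from the Petersen graph, twelve rungs are inserted again and again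
-- into a copy of the Petersen graph minus a path with three vertices.  A finite
-- check shows that a labelling of the enlarged piece induces a labelling of the
-- original piece, and another one that no pair of matched arcs arises; the
-- enlarged piece contains the original piece again.

module Submission where

open import Defs
open import Data.Bool as Bool using (Bool; true; false; T; not; if_then_else_; _∧_; _∨_; _xor_)
open import Data.Bool.ListAction using (any; all)
open import Data.Bool.Properties using (T-∧; T-∨; ¬-not; not-injective)
open import Data.Empty using (⊥)
open import Data.Fin as Fin using (Fin; zero; suc; _<?_; #_; _↑ˡ_; _↑ʳ_)
open import Data.Fin.Patterns
open import Data.Fin.Properties as Fin using (all?)
open import Data.Fin.Subset using (Subset; inside; outside; ⁅_⁆; ∣_∣)
  renaming (_∈_ to _∈ˢ_; _∉_ to _∉ˢ_; _─_ to _─ˢ_)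
open import Data.Fin.Subset.Properties as Subset
  using (x∈p∧x∉q⇒x∈p─q; p─q⊆p; x∈⁅x⁆; x∈⁅y⁆⇒x≡y; x∈p∪q⁺; x∈p∪q⁻; p⊆p∪q; q⊆p∪q; x∈p∩q⁻; ⊆-antisym)
open import Data.List as List
  using (List; []; _∷_; _++_; [_]; _∷ʳ_; map; length; filter; initLast; _∷ʳ′_; allFin; cartesianProduct)
import Data.List.Membership.DecPropositional as DecMembership
open import Data.List.Membership.Propositional using (_∈_; _∉_; find; lose)
open import Data.List.Membership.Propositional.Properties
  using (∈-++⁺ˡ; ∈-++⁺ʳ; ∈-++⁻; ∈-∃++; ∈-map⁺; ∈-map⁻; ∈-filter⁺; ∈-filter⁻; ∈-lookup; ∈-allFin;
         ∈-cartesianProduct⁺)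
open import Data.List.Properties
  using (++-assoc; ++-identityʳ; map-++; length-map; length-++; length-tabulate; filter-++; filter-all)
open import Data.List.Relation.Binary.Permutation.Propositional
  using (_↭_; ↭-sym; ↭-trans; ↭-reflexive; ↭⇒↭ₛ)
open import Data.List.Relation.Binary.Permutation.Propositional.Properties
  using (++-comm; All-resp-↭; ∈-resp-↭; ↭-length)
import Data.List.Relation.Binary.Permutation.Setoid.Properties as Permutationₛ
open import Data.List.Relation.Binary.Sublist.Propositional
  using (_⊆_; []; _∷_; from∈; minimum; ⊆-refl) renaming (_∷ʳ_ to skip)
open import Data.List.Relation.Binary.Sublist.Propositional.Properties using (++⁺)
open import Data.List.Relation.Unary.All as All using (All; []; _∷_)
import Data.List.Relation.Unary.All.Properties as All
open import Data.List.Relation.Unary.AllPairs using ([]; _∷_)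
open import Data.List.Relation.Unary.Any as Any using (Any; here; there; any?; satisfied)
import Data.List.Relation.Unary.Any.Properties as Any
open import Data.List.Relation.Unary.Unique.Propositional using (Unique)
import Data.List.Relation.Unary.Unique.DecPropositional as DecUnique
import Data.List.Relation.Unary.Unique.Propositional.Properties as Unique
open import Data.Nat as ℕ using (ℕ; zero; suc; _+_; _*_; _≤_; _≤ᵇ_; _≡ᵇ_; _≤?_; z≤n; s≤s)
open import Data.Nat.Properties as ℕ
  using (≤-refl; ≤-trans; ≤-reflexive; ≤-antisym; ≰⇒>; n≤1+n; m≤n+m; +-suc; +-comm; +-assoc; +-identityʳ;
         +-monoˡ-≤; +-monoʳ-≤; ≤ᵇ⇒≤; ≤⇒≤ᵇ; ≡ᵇ⇒≡; module ≤-Reasoning)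
open import Data.Nat.Tactic.RingSolver using (solve-∀)
open import Data.Product using (_×_; _,_; proj₁; proj₂; swap; ∃-syntax; Σ-syntax)
open import Data.Product.Properties using () renaming (≡-dec to ×-≡-dec)
open import Data.Sum as Sum using (_⊎_; inj₁; inj₂; [_,_]′)
open import Data.Sum.Properties using (inj₁-injective; inj₂-injective; ≡-dec)
open import Data.Vec as Vec using (Vec; []; _∷_; here; there; lookup; tabulate)
open import Data.Vec.Membership.Propositional using () renaming (_∈_ to _∈ᵛ_)
open import Data.Vec.Membership.Propositional.Properties using (∈-fromList⁺; ∈-allFin⁺)
open import Data.Vec.Properties using (lookup∘tabulate; lookup-map; []=⇒lookup; lookup⇒[]=)
open import Data.Vec.Relation.Unary.All as Allᵛ using ([]; _∷_) renaming (All to Allᵛ)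
import Data.Vec.Relation.Unary.All.Properties as Allᵛ
import Data.Vec.Relation.Unary.Any as Anyᵛ
import Data.Vec.Relation.Unary.Any.Properties as Anyᵛ
open import Function using (_∘_; id)
open import Function.Bundles using (Equivalence)
open import Relation.Binary.Construct.Closure.ReflexiveTransitive
  using (Star; ε; _◅_; _◅◅_; reverse) renaming (map to Star-map)
open import Relation.Binary.Definitions using (DecidableEquality; tri<; tri≈; tri>)
  renaming (Decidable to Decidable₂)
open import Relation.Binary.PropositionalEquality
  using (_≡_; _≢_; refl; sym; trans; cong; cong₂; subst; subst₂; setoid; module ≡-Reasoning)
open import Relation.Nullary using (Dec; ¬_; yes; no; does; contradiction)
open import Relation.Nullary.Decidable
  using (True; toWitness; from-yes; dec-true; dec-false; ¬?; _×-dec_; _⊎-dec_; _→-dec_)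
open import Relation.Unary using (Decidable)

-- The label set is the main obstacle. For a double cover the labels are circuits, whose number has
-- no bound, so labellings cannot be enumerated as 3-edge-colourings can. The labels therefore stay
-- symbolic: each rung allows two ways of identifying the four labels at its ends, and the finite
-- check branches over these two ways instead of over values.
--
-- The Petersen graph minus a path has seven vertices here, the ends of `a d b c` on the first
-- circuit and of `b a c` on the second. Five edges leave it: two on each circuit, and the rung `d`,
-- whose other end stays outside. The twelve rungs are inserted without touching these connections.
-- Every labelling thus descends, insertion by insertion, to the Petersen graph, and each step only
-- has to reproduce the labels seen from outside.
--
-- Cyclic connectivity is expressed through the exact value of the minimum, so a lower bound is not
-- enough: a cyclic edge cut of size five has to be exhibited. The rungs inserted last supply one,
-- by two disjoint pentagons.

private variable
  A B : Set
  k n : ℕ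

-- Cyclic words

walk : A → List A → List (A × A)
walk x []       = []
walk x (y ∷ ys) = (x , y) ∷ walk y ys

links : List A → List (A × A)
links []       = []
links (x ∷ xs) = walk x (xs ∷ʳ x)

walk-++ : ∀ (x : A) ys z zs → walk x (ys ++ z ∷ zs) ≡ walk x (ys ∷ʳ z) ++ walk z zs
walk-++ x []       z zs = refl
walk-++ x (y ∷ ys) z zs = cong ((x , y) ∷_) (walk-++ y ys z zs)

links-++ : ∀ (x : A) xs y ys →
           links (x ∷ xs ++ y ∷ ys) ≡ walk x (xs ∷ʳ y) ++ walk y (ys ∷ʳ x)
links-++ x xs y ys =
  trans (cong (walk x) (++-assoc xs (y ∷ ys) [ x ])) (walk-++ x xs y (ys ∷ʳ x))

links-rotate : ∀ (xs ys : List A) → links (xs ++ ys) ↭ links (ys ++ xs)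
links-rotate []       ys       = ↭-reflexive (cong links (sym (++-identityʳ ys)))
links-rotate (x ∷ xs) []       = ↭-reflexive (cong links (++-identityʳ (x ∷ xs)))
links-rotate (x ∷ xs) (y ∷ ys) =
  ↭-trans (↭-reflexive (links-++ x xs y ys))
    (↭-trans (++-comm (walk x (xs ∷ʳ y)) _) (↭-reflexive (sym (links-++ y ys x xs))))

walk-map : ∀ (h : A → B) x ys → walk (h x) (map h ys) ≡ map (λ (u , v) → h u , h v) (walk x ys)
walk-map h x []       = refl
walk-map h x (y ∷ ys) = cong (_ ∷_) (walk-map h y ys)

links-map : ∀ (h : A → B) xs → links (map h xs) ≡ map (λ (u , v) → h u , h v) (links xs)
links-map h []       = refl
links-map h (x ∷ xs) =
  trans (cong (walk (h x)) (sym (map-++ h xs [ x ]))) (walk-map h x (xs ∷ʳ x))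

Unique-rotate : ∀ (xs ys : List A) → Unique (xs ++ ys) → Unique (ys ++ xs)
Unique-rotate {A} xs ys = Permutationₛ.Unique-resp-↭ (setoid A) (↭⇒↭ₛ (++-comm xs ys))

hop : Bool → Bool → ℕ
hop b c = if b xor c then 1 else 0

steps : (A → Bool) → A → List A → ℕ
steps f x []       = 0
steps f x (y ∷ ys) = hop (f x) (f y) + steps f y ys

-- This is the number of links of the closed word that `f` separates. At most two turns means that
-- the letters with value `true` occupy a cyclic interval.
turns : (A → Bool) → List A → ℕ
turns f []       = 0
turns f (x ∷ xs) = steps f x (xs ∷ʳ x)

hop-triangle : ∀ a b c → hop a c ≤ hop a b + hop b c
hop-triangle false false c     = ≤-refl
hop-triangle false true  false = z≤n
hop-triangle false true  true  = ≤-refl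
hop-triangle true  true  c     = ≤-refl
hop-triangle true  false false = ≤-refl
hop-triangle true  false true  = z≤n

steps-skip : ∀ (f : A → Bool) x y ys → steps f x ys ≤ hop (f x) (f y) + steps f y ys
steps-skip f x y []       = z≤n
steps-skip f x y (z ∷ zs) = begin
  hop (f x) (f z) + steps f z zs                     ≤⟨ +-monoˡ-≤ _ (hop-triangle (f x) (f y) (f z)) ⟩
  hop (f x) (f y) + hop (f y) (f z) + steps f z zs   ≡⟨ +-assoc (hop (f x) (f y)) _ _ ⟩
  hop (f x) (f y) + (hop (f y) (f z) + steps f z zs) ∎
  where open ≤-Reasoning

-- Dropping a letter adds no change of value, by the triangle inequality for `hop`. Bounds on the
-- turns of a long word thus pass to the subwords that a finite check can handle.
steps-⊆ : ∀ (f : A → Bool) x {xs ys} → xs ⊆ ys → steps f x xs ≤ steps f x ys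
steps-⊆ f x []                  = z≤n
steps-⊆ f x (_∷_ {x = y} refl τ) = +-monoʳ-≤ (hop (f x) (f y)) (steps-⊆ f y τ)
steps-⊆ f x {xs} (skip y τ)      =
  ≤-trans (steps-skip f x y xs) (+-monoʳ-≤ (hop (f x) (f y)) (steps-⊆ f y τ))

steps-++ : ∀ (f : A → Bool) x ys z zs →
           steps f x (ys ++ z ∷ zs) ≡ steps f x (ys ∷ʳ z) + steps f z zs
steps-++ f x []       z zs = cong (_+ steps f z zs) (sym (+-identityʳ _))
steps-++ f x (y ∷ ys) z zs =
  trans (cong (hop (f x) (f y) +_) (steps-++ f y ys z zs)) (sym (+-assoc (hop (f x) (f y)) _ _))

turns-++ : ∀ (f : A → Bool) x xs y ys →
           turns f (x ∷ xs ++ y ∷ ys) ≡ steps f x (xs ∷ʳ y) + steps f y (ys ∷ʳ x)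
turns-++ f x xs y ys =
  trans (cong (steps f x) (++-assoc xs (y ∷ ys) [ x ])) (steps-++ f x xs y (ys ∷ʳ x))

turns-rotate : ∀ (f : A → Bool) xs ys → turns f (xs ++ ys) ≡ turns f (ys ++ xs)
turns-rotate f []       ys       = cong (turns f) (sym (++-identityʳ ys))
turns-rotate f (x ∷ xs) []       = cong (turns f) (++-identityʳ (x ∷ xs))
turns-rotate f (x ∷ xs) (y ∷ ys) = begin
  turns f (x ∷ xs ++ y ∷ ys)                        ≡⟨ turns-++ f x xs y ys ⟩
  steps f x (xs ∷ʳ y) + steps f y (ys ∷ʳ x)         ≡⟨ +-comm (steps f x (xs ∷ʳ y)) _ ⟩
  steps f y (ys ∷ʳ x) + steps f x (xs ∷ʳ y)         ≡⟨ turns-++ f y ys x xs ⟨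
  turns f (y ∷ ys ++ x ∷ xs)                        ∎
  where open ≡-Reasoning

steps-map : ∀ (f : B → Bool) (h : A → B) x ys → steps f (h x) (map h ys) ≡ steps (f ∘ h) x ys
steps-map f h x []       = refl
steps-map f h x (y ∷ ys) = cong (hop (f (h x)) (f (h y)) +_) (steps-map f h y ys)

turns-map : ∀ (f : B → Bool) (h : A → B) xs → turns f (map h xs) ≡ turns (f ∘ h) xs
turns-map f h []       = refl
turns-map f h (x ∷ xs) =
  trans (cong (steps f (h x)) (sym (map-++ h xs [ x ]))) (steps-map f h x (xs ∷ʳ x))

steps-cong : ∀ {f g : A → Bool} → (∀ x → f x ≡ g x) → ∀ x ys → steps f x ys ≡ steps g x ys
steps-cong eq x []       = refl
steps-cong eq x (y ∷ ys) = cong₂ _+_ (cong₂ hop (eq x) (eq y)) (steps-cong eq y ys)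

turns-cong : ∀ {f g : A → Bool} → (∀ x → f x ≡ g x) → ∀ xs → turns f xs ≡ turns g xs
turns-cong eq []       = refl
turns-cong eq (x ∷ xs) = steps-cong eq x (xs ∷ʳ x)

hop-not : ∀ b c → hop (not b) (not c) ≡ hop b c
hop-not false false = refl
hop-not false true  = refl
hop-not true  false = refl
hop-not true  true  = refl

steps-not : ∀ (f : A → Bool) x ys → steps (not ∘ f) x ys ≡ steps f x ys
steps-not f x []       = refl
steps-not f x (y ∷ ys) = cong₂ _+_ (hop-not (f x) (f y)) (steps-not f y ys)

turns-not : ∀ (f : A → Bool) xs → turns (not ∘ f) xs ≡ turns f xs
turns-not f []       = refl
turns-not f (x ∷ xs) = steps-not f x (xs ∷ʳ x)

-- Finite sets and exhaustive checks

Unique-⊆⇒length≤ : ∀ {xs ys : List A} → Unique xs →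
                   (∀ {x} → x ∈ xs → x ∈ ys) → length xs ≤ length ys
Unique-⊆⇒length≤ []          xs⊆ys = z≤n
Unique-⊆⇒length≤ {xs = x ∷ xs} (x∉ ∷ u) xs⊆ys with ∈-∃++ (xs⊆ys (here refl))
... | as , bs , refl =
  ≤-trans (s≤s (Unique-⊆⇒length≤ u xs⊆))
    (≤-reflexive (trans (cong suc (length-++ as)) (trans (sym (+-suc _ _)) (sym (length-++ as)))))
  where
  xs⊆ : ∀ {z} → z ∈ xs → z ∈ as ++ bs
  xs⊆ z∈ with ∈-++⁻ as (xs⊆ys (there z∈))
  ... | inj₁ z∈as         = ∈-++⁺ˡ z∈as
  ... | inj₂ (here refl)  = contradiction refl (All.lookup x∉ z∈)
  ... | inj₂ (there z∈bs) = ∈-++⁺ʳ as z∈bs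

elements : Subset n → List (Fin n)
elements []            = []
elements (outside ∷ p) = map suc (elements p)
elements (inside  ∷ p) = zero ∷ map suc (elements p)

length-elements : ∀ (p : Subset n) → length (elements p) ≡ ∣ p ∣
length-elements []            = refl
length-elements (outside ∷ p) = trans (length-map suc (elements p)) (length-elements p)
length-elements (inside  ∷ p) = cong suc (trans (length-map suc (elements p)) (length-elements p))

∈-elements⁺ : ∀ {p : Subset n} {x} → x ∈ˢ p → x ∈ elements p
∈-elements⁺ {p = inside  ∷ p} here       = here refl
∈-elements⁺ {p = inside  ∷ p} (there x∈) = there (∈-map⁺ suc (∈-elements⁺ x∈))
∈-elements⁺ {p = outside ∷ p} (there x∈) = ∈-map⁺ suc (∈-elements⁺ x∈)

∈-elements⁻ : ∀ {p : Subset n} {x} → x ∈ elements p → x ∈ˢ p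
∈-elements⁻ {p = inside  ∷ p} (here refl) = here
∈-elements⁻ {p = inside  ∷ p} (there x∈)  with ∈-map⁻ suc x∈
... | _ , y∈ , refl = there (∈-elements⁻ y∈)
∈-elements⁻ {p = outside ∷ p} x∈          with ∈-map⁻ suc x∈
... | _ , y∈ , refl = there (∈-elements⁻ y∈)

elements-unique : ∀ (p : Subset n) → Unique (elements p)
elements-unique []            = []
elements-unique (outside ∷ p) = Unique.map⁺ Fin.suc-injective (elements-unique p)
elements-unique (inside  ∷ p) =
  All.tabulate (λ x∈ → λ { refl → zero∉ x∈ }) ∷ Unique.map⁺ Fin.suc-injective (elements-unique p)
  where
  zero∉ : zero ∈ map suc (elements p) → _
  zero∉ x∈ with ∈-map⁻ suc x∈
  ... | _ , _ , ()

Unique⇒length≤∣∣ : ∀ {p : Subset n} {xs} → Unique xs → (∀ {x} → x ∈ xs → x ∈ˢ p) → length xs ≤ ∣ p ∣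
Unique⇒length≤∣∣ {p = p} u xs⊆p =
  ≤-trans (Unique-⊆⇒length≤ u (∈-elements⁺ ∘ xs⊆p)) (≤-reflexive (length-elements p))

∣∣≤length : ∀ {p : Subset n} {xs} → (∀ {x} → x ∈ˢ p → x ∈ xs) → ∣ p ∣ ≤ length xs
∣∣≤length {p = p} p⊆xs =
  ≤-trans (≤-reflexive (sym (length-elements p)))
    (Unique-⊆⇒length≤ (elements-unique p) (p⊆xs ∘ ∈-elements⁻))

∣∣≡length : ∀ {p : Subset n} {xs} → Unique xs → (∀ {x} → x ∈ xs → x ∈ˢ p) →
            (∀ {x} → x ∈ˢ p → x ∈ xs) → ∣ p ∣ ≡ length xs
∣∣≡length u xs⊆p p⊆xs = ≤-antisym (∣∣≤length p⊆xs) (Unique⇒length≤∣∣ u xs⊆p)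

∣∣≤1⇒≡ : ∀ {p : Subset n} → ∣ p ∣ ≤ 1 → ∀ {x y} → x ∈ˢ p → y ∈ˢ p → x ≡ y
∣∣≤1⇒≡ {p = outside ∷ p} le (there x∈) (there y∈) = cong suc (∣∣≤1⇒≡ le x∈ y∈)
∣∣≤1⇒≡ {p = inside ∷ p} le here here = refl
∣∣≤1⇒≡ {p = inside ∷ p} (s≤s le) {y = suc y} here (there y∈) =
  contradiction (≤-trans (Unique⇒length≤∣∣ {xs = y ∷ []} ([] ∷ []) λ { (here refl) → y∈ }) le) λ ()
∣∣≤1⇒≡ {p = inside ∷ p} (s≤s le) {x = suc x} (there x∈) _ =
  contradiction (≤-trans (Unique⇒length≤∣∣ {xs = x ∷ []} ([] ∷ []) λ { (here refl) → x∈ }) le) λ ()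

≡⇒∣∣≤1 : ∀ (p : Subset n) → (∀ {x y} → x ∈ˢ p → y ∈ˢ p → x ≡ y) → ∣ p ∣ ≤ 1
≡⇒∣∣≤1 []            _  = z≤n
≡⇒∣∣≤1 (outside ∷ p) eq = ≡⇒∣∣≤1 p λ x∈ y∈ → Fin.suc-injective (eq (there x∈) (there y∈))
≡⇒∣∣≤1 (inside  ∷ p) eq =
  s≤s (∣∣≤length {xs = []} λ x∈ → contradiction (eq here (there x∈)) λ ())

-- Exhaustive checks see only vectors of Booleans; this turns the cardinality they compute back into
-- uniqueness of a letter.
∣map∣≤1⇒≡ : ∀ (h : A → Bool) {xs : Vec A n} → ∣ Vec.map h xs ∣ ≤ 1 →
            ∀ {x y} → x ∈ᵛ xs → y ∈ᵛ xs → h x ≡ true → h y ≡ true → x ≡ y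
∣map∣≤1⇒≡ h {xs} le x∈ y∈ hx hy = trans (Anyᵛ.lookup-index x∈)
  (trans (cong (Vec.lookup xs) (∣∣≤1⇒≡ le (true-at x∈ hx) (true-at y∈ hy))) (sym (Anyᵛ.lookup-index y∈)))
  where
  true-at : ∀ {z} (z∈ : z ∈ᵛ xs) → h z ≡ true → Anyᵛ.index z∈ ∈ˢ Vec.map h xs
  true-at z∈ hz = lookup⇒[]= _ _
    (trans (lookup-map (Anyᵛ.index z∈) h xs) (trans (cong h (sym (Anyᵛ.lookup-index z∈))) hz))

-- Decides P for all vectors that change at most k times when read after b.

allSteps : ∀ n → ℕ → Bool → (Vec Bool n → Bool) → Bool
allSteps zero    k       b P = P []
allSteps (suc n) zero    b P = allSteps n zero b (P ∘ (b ∷_))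
allSteps (suc n) (suc k) b P =
  allSteps n (suc k) b (P ∘ (b ∷_)) ∧ allSteps n k (not b) (P ∘ (not b ∷_))

allSteps-sound : ∀ n k b P → T (allSteps n k b P) →
                 ∀ v → steps id b (Vec.toList v) ≤ k → T (P v)
allSteps-sound zero    k       b     P t []          le       = t
allSteps-sound (suc n) zero    false P t (false ∷ v) le       = allSteps-sound n zero false _ t v le
allSteps-sound (suc n) zero    true  P t (true ∷ v)  le       = allSteps-sound n zero true _ t v le
allSteps-sound (suc n) (suc k) false P t (false ∷ v) le       =
  allSteps-sound n (suc k) false _ (proj₁ (Equivalence.to T-∧ t)) v le
allSteps-sound (suc n) (suc k) true  P t (true ∷ v)  le       =
  allSteps-sound n (suc k) true _ (proj₁ (Equivalence.to T-∧ t)) v le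
allSteps-sound (suc n) (suc k) false P t (true ∷ v)  (s≤s le) =
  allSteps-sound n k true _ (proj₂ (Equivalence.to T-∧ t)) v le
allSteps-sound (suc n) (suc k) true  P t (false ∷ v) (s≤s le) =
  allSteps-sound n k false _ (proj₂ (Equivalence.to T-∧ t)) v le

-- Deciding consequences of match constraints

Match : {L : Set} → L → L → L → L → Set
Match p q r s = p ≢ q × ((p ≡ r × q ≡ s) ⊎ (p ≡ s × q ≡ r))

-- A `compare` asserts nothing about the labels. It makes the search branch on their equality, and
-- the unequal branch gains a disequality that goals may use.
data Fact : Set where
  match   : (a b c d : ℕ) → Fact
  compare : (a b : ℕ) → Fact

-- A match makes the labels distinct at one end of a rung, hence at the other. All these
-- disequalities are recorded before the search, so that contradictory branches close early.
apart : Vec Fact n → List (ℕ × ℕ)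
apart []                   = []
apart (match a b c d ∷ fs) = (a , b) ∷ (c , d) ∷ apart fs
apart (compare _ _   ∷ fs) = apart fs

Quad : Set
Quad = ℕ × ℕ × ℕ × ℕ

-- Read as a disjunction of conjunctions of matches; the empty goal is falsity.
Goal : Set
Goal = List (List Quad)

_≔_ : ℕ → ℕ → ℕ → ℕ
(x ≔ y) v = if v ≡ᵇ x then y else v

module _ (r : ℕ → ℕ) where
  renameFact : Fact → Fact
  renameFact (match a b c d) = match (r a) (r b) (r c) (r d)
  renameFact (compare a b)   = compare (r a) (r b)

  renamePair : ℕ × ℕ → ℕ × ℕ
  renamePair (a , b) = r a , r b

  renameQuad : Quad → Quad
  renameQuad (a , b , c , d) = r a , r b , r c , r d

clash : List (ℕ × ℕ) → Bool
clash = any λ (a , b) → a ≡ᵇ b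

module _ (ns : List (ℕ × ℕ)) where
  differ : ℕ → ℕ → Bool
  differ a b = any (λ (x , y) → ((a ≡ᵇ x) ∧ (b ≡ᵇ y)) ∨ ((a ≡ᵇ y) ∧ (b ≡ᵇ x))) ns

  matches : Quad → Bool
  matches (a , b , c , d) =
    differ a b ∧ (((a ≡ᵇ c) ∧ (b ≡ᵇ d)) ∨ ((a ≡ᵇ d) ∧ (b ≡ᵇ c)))

-- entails fs ns g decides whether fs, together with the disequalities ns,
-- forces some conjunction in g.  Each match is split into its two cases, which
-- are propagated as substitutions of variables.

entails  : Vec Fact n → List (ℕ × ℕ) → Goal → Bool
identify : Vec (ℕ × ℕ) k → Vec Fact n → List (ℕ × ℕ) → Goal → Bool

entails []                   ns g = any (all (matches ns)) g
entails (match a b c d ∷ fs) ns g =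
  identify ((a , c) ∷ (b , d) ∷ []) fs ns g ∧ identify ((a , d) ∷ (b , c) ∷ []) fs ns g
entails (compare a b ∷ fs)   ns g =
  identify ((a , b) ∷ []) fs ns g ∧ entails fs ((a , b) ∷ ns) g

-- All pending equations have been substituted. If some disequality now relates a label to itself,
-- the branch is impossible and proves any goal.
identify []             fs ns g = clash ns ∨ entails fs ns g
identify ((a , b) ∷ es) fs ns g =
  identify (Vec.map (renamePair r) es) (Vec.map (renameFact r) fs) (map (renamePair r) ns)
           (map (map (renameQuad r)) g)
  where
  r : ℕ → ℕ
  r = a ≔ b

module Soundness {L : Set} (ρ : ℕ → L) where

  Holds : Fact → Set
  Holds (match a b c d) = Match (ρ a) (ρ b) (ρ c) (ρ d)
  Holds (compare a b)   = Dec (ρ a ≡ ρ b)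

  Matches : Quad → Set
  Matches (a , b , c , d) = Match (ρ a) (ρ b) (ρ c) (ρ d)

  Equal Distinct : ℕ × ℕ → Set
  Equal    (a , b) = ρ a ≡ ρ b
  Distinct (a , b) = ρ a ≢ ρ b

  ≔-respects : ∀ {x y} → ρ x ≡ ρ y → ∀ v → ρ ((x ≔ y) v) ≡ ρ v
  ≔-respects {x} eq v with v ≡ᵇ x in e
  ... | false = refl
  ... | true  = trans (sym eq) (cong ρ (sym (≡ᵇ⇒≡ v x (subst T (sym e) _))))

  module _ {r : ℕ → ℕ} (R : ∀ v → ρ (r v) ≡ ρ v) where
    renameFact-holds : ∀ {f} → Holds f → Holds (renameFact r f)
    renameFact-holds {match a b c d} h
      rewrite R a | R b | R c | R d = h
    renameFact-holds {compare a b} h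
      rewrite R a | R b = h

    renamePair-≡ : ∀ {p} → Equal p → Equal (renamePair r p)
    renamePair-≡ {a , b} h rewrite R a | R b = h

    renamePair-≢ : ∀ {p} → Distinct p → Distinct (renamePair r p)
    renamePair-≢ {a , b} h rewrite R a | R b = h

    renameQuad⁻ : ∀ {q} → Matches (renameQuad r q) → Matches q
    renameQuad⁻ {a , b , c , d} h rewrite R a | R b | R c | R d = h

  ≡ᵇ-sound : ∀ a b → T (a ≡ᵇ b) → ρ a ≡ ρ b
  ≡ᵇ-sound a b t = cong ρ (≡ᵇ⇒≡ a b t)

  clash-sound : ∀ {ns} → All Distinct ns → ¬ T (clash ns)
  clash-sound {(a , b) ∷ ns} (n ∷ N) t with Equivalence.to (T-∨ {a ≡ᵇ b}) t
  ... | inj₁ t′ = n (≡ᵇ-sound a b t′)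
  ... | inj₂ t′ = clash-sound N t′

  both : ∀ a b c d → T ((a ≡ᵇ b) ∧ (c ≡ᵇ d)) → ρ a ≡ ρ b × ρ c ≡ ρ d
  both a b c d t = let u , v = Equivalence.to T-∧ t in ≡ᵇ-sound a b u , ≡ᵇ-sound c d v

  differ-sound : ∀ {ns} → All Distinct ns → ∀ a b → T (differ ns a b) → ρ a ≢ ρ b
  differ-sound {(x , y) ∷ ns} (n ∷ N) a b t eq with Equivalence.to T-∨ t
  ... | inj₂ t′ = differ-sound N a b t′ eq
  ... | inj₁ t′ with Equivalence.to T-∨ t′
  ...   | inj₁ u = let ax , by = both a x b y u in n (trans (sym ax) (trans eq by))
  ...   | inj₂ u = let ay , bx = both a y b x u in n (trans (sym bx) (trans (sym eq) ay))

  matches-sound : ∀ {ns} → All Distinct ns → ∀ {q} → T (matches ns q) → Matches q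
  matches-sound N {a , b , c , d} t with Equivalence.to T-∧ t
  ... | t₁ , t₂ with Equivalence.to T-∨ t₂
  ...   | inj₁ u = differ-sound N a b t₁ , inj₁ (both a c b d u)
  ...   | inj₂ u = differ-sound N a b t₁ , inj₂ (both a d b c u)

  any⇒Any : ∀ {A : Set} (p : A → Bool) xs → T (any p xs) → Any (T ∘ p) xs
  any⇒Any p (x ∷ xs) t with p x in e
  ... | true  = here (subst T (sym e) _)
  ... | false = there (any⇒Any p xs t)

  all⇒All : ∀ {A : Set} (p : A → Bool) xs → T (all p xs) → All (T ∘ p) xs
  all⇒All p []       t = []
  all⇒All p (x ∷ xs) t with Equivalence.to T-∧ t
  ... | tx , txs = tx ∷ all⇒All p xs txs

  entails-sound : ∀ (fs : Vec Fact n) {ns} g → All Distinct ns → Allᵛ Holds fs →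
                  T (entails fs ns g) → Any (All Matches) g
  identify-sound : ∀ (es : Vec (ℕ × ℕ) k) (fs : Vec Fact n) {ns} g →
                   Allᵛ Equal es → All Distinct ns → Allᵛ Holds fs →
                   T (identify es fs ns g) → Any (All Matches) g

  identify-sound [] fs {ns} g [] N H t with Equivalence.to (T-∨ {clash ns}) t
  ... | inj₁ c  = contradiction c (clash-sound N)
  ... | inj₂ t′ = entails-sound fs g N H t′
  identify-sound ((a , b) ∷ es) fs g (e ∷ E) N H t =
    Any.map (λ ms → All.map (λ {q} → renameQuad⁻ R {q}) (All.map⁻ ms))
      (Any.map⁻ (identify-sound _ _ _
        (Allᵛ.map⁺ (Allᵛ.map (λ {p} → renamePair-≡ R {p}) E))
        (All.map⁺ (All.map (λ {p} → renamePair-≢ R {p}) N))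
        (Allᵛ.map⁺ (Allᵛ.map (λ {f} → renameFact-holds R {f}) H)) t))
    where
    R : ∀ v → ρ ((a ≔ b) v) ≡ ρ v
    R = ≔-respects e

  entails-sound [] {ns} g N [] t =
    Any.map (λ {qs} u → All.map (matches-sound N) (all⇒All (matches ns) qs u)) (any⇒Any _ g t)
  entails-sound (match a b c d ∷ fs) g N ((_ , inj₁ (p , q)) ∷ H) t =
    identify-sound _ fs g (p ∷ q ∷ []) N H (proj₁ (Equivalence.to T-∧ t))
  entails-sound (match a b c d ∷ fs) g N ((_ , inj₂ (p , q)) ∷ H) t =
    identify-sound _ fs g (p ∷ q ∷ []) N H (proj₂ (Equivalence.to T-∧ t))
  entails-sound (compare a b ∷ fs) g N (yes p ∷ H) t =
    identify-sound _ fs g (p ∷ []) N H (proj₁ (Equivalence.to T-∧ t))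
  entails-sound (compare a b ∷ fs) g N (no p ∷ H) t =
    entails-sound fs g (p ∷ N) H (proj₂ (Equivalence.to T-∧ t))

  apart-distinct : ∀ {fs : Vec Fact n} → Allᵛ Holds fs → All Distinct (apart fs)
  apart-distinct []                            = []
  apart-distinct {fs = match _ _ _ _ ∷ _} ((n , m) ∷ H) =
    n ∷ [ (λ (p , q) eq → n (trans p (trans eq (sym q))))
        , (λ (p , q) eq → n (trans p (trans (sym eq) (sym q)))) ]′ m
      ∷ apart-distinct H
  apart-distinct {fs = compare _ _ ∷ _} (_ ∷ H) = apart-distinct H

  solve : ∀ (fs : Vec Fact n) g → T (entails fs (apart fs) g) → Allᵛ Holds fs → Any (All Matches) g
  solve fs g t H = entails-sound fs g (apart-distinct H) H t

-- Weaves

AtMostOne : (A → Bool) → Bool → Set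
AtMostOne f c = ∀ u v → f u ≡ c → f v ≡ c → u ≡ v

-- No cyclic interval of the first word, other than the trivial ones, has the
-- same elements as a cyclic interval of the second word.

Simple : List A → List A → Set
Simple ws₁ ws₂ = ∀ f → turns f ws₁ ≤ 2 → turns f ws₂ ≤ 2 →
                 AtMostOne f true ⊎ AtMostOne f false

-- The orders in which the rungs are met along the two circuits.  The rungs a b c d
-- mark the place where the next twelve rungs are inserted: a d b c on the first
-- circuit and b a c on the second one.

record Weave (A : Set) : Set where
  field
    a b c d   : A
    R₁ R₂     : List A
    unique₁   : Unique (a ∷ d ∷ b ∷ c ∷ R₁)
    unique₂   : Unique (b ∷ a ∷ c ∷ R₂)
    complete₁ : ∀ z → z ∈ a ∷ d ∷ b ∷ c ∷ R₁
    complete₂ : ∀ z → z ∈ b ∷ a ∷ c ∷ R₂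

  word₁ word₂ : List A
  word₁ = a ∷ d ∷ b ∷ c ∷ R₁
  word₂ = b ∷ a ∷ c ∷ R₂

  d∈R₂ : d ∈ R₂
  d∈R₂ with complete₂ d | unique₁
  ... | here d≡b                 | _ ∷ (d≢b ∷ _) ∷ _     = contradiction d≡b d≢b
  ... | there (here d≡a)         | (a≢d ∷ _) ∷ _         = contradiction (sym d≡a) a≢d
  ... | there (there (here d≡c)) | _ ∷ (_ ∷ d≢c ∷ _) ∷ _ = contradiction d≡c d≢c
  ... | there (there (there d∈)) | _                     = d∈

lefts : List (A ⊎ B) → List A
lefts []            = []
lefts (inj₁ x ∷ xs) = x ∷ lefts xs
lefts (inj₂ _ ∷ xs) = lefts xs

rights : List (A ⊎ B) → List B
rights []            = []
rights (inj₁ _ ∷ xs) = rights xs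
rights (inj₂ y ∷ xs) = y ∷ rights xs

∈-lefts⁻ : ∀ {x} (xs : List (A ⊎ B)) → x ∈ lefts xs → inj₁ x ∈ xs
∈-lefts⁻ (inj₁ _ ∷ xs) (here refl) = here refl
∈-lefts⁻ (inj₁ _ ∷ xs) (there x∈)  = there (∈-lefts⁻ xs x∈)
∈-lefts⁻ (inj₂ _ ∷ xs) x∈          = there (∈-lefts⁻ xs x∈)

∈-rights⁻ : ∀ {y} (xs : List (A ⊎ B)) → y ∈ rights xs → inj₂ y ∈ xs
∈-rights⁻ (inj₂ _ ∷ xs) (here refl) = here refl
∈-rights⁻ (inj₂ _ ∷ xs) (there y∈)  = there (∈-rights⁻ xs y∈)
∈-rights⁻ (inj₁ _ ∷ xs) y∈          = there (∈-rights⁻ xs y∈)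

∈-lefts⁺ : ∀ {x} (xs : List (A ⊎ B)) → inj₁ x ∈ xs → x ∈ lefts xs
∈-lefts⁺ (inj₁ _ ∷ xs) (here refl) = here refl
∈-lefts⁺ (inj₁ _ ∷ xs) (there x∈)  = there (∈-lefts⁺ xs x∈)
∈-lefts⁺ (inj₂ _ ∷ xs) (there x∈)  = ∈-lefts⁺ xs x∈

∈-rights⁺ : ∀ {y} (xs : List (A ⊎ B)) → inj₂ y ∈ xs → y ∈ rights xs
∈-rights⁺ (inj₂ _ ∷ xs) (here refl) = here refl
∈-rights⁺ (inj₂ _ ∷ xs) (there y∈)  = there (∈-rights⁺ xs y∈)
∈-rights⁺ (inj₁ _ ∷ xs) (there y∈)  = ∈-rights⁺ xs y∈

Unique-⊎ : ∀ (xs : List (A ⊎ B)) → Unique (lefts xs) → Unique (rights xs) → Unique xs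
Unique-⊎ []            []       []       = []
Unique-⊎ (inj₁ x ∷ xs) (x∉ ∷ u) v        =
  All.tabulate (λ { z∈ refl → All.lookup x∉ (∈-lefts⁺ xs z∈) refl }) ∷ Unique-⊎ xs u v
Unique-⊎ (inj₂ y ∷ xs) u        (y∉ ∷ v) =
  All.tabulate (λ { z∈ refl → All.lookup y∉ (∈-rights⁺ xs z∈) refl }) ∷ Unique-⊎ xs u v

lefts-map-inj₂ : ∀ (ys : List B) → lefts {A} (map inj₂ ys) ≡ []
lefts-map-inj₂ []       = refl
lefts-map-inj₂ (_ ∷ ys) = lefts-map-inj₂ ys

rights-map-inj₂ : ∀ (ys : List B) → rights {A} (map inj₂ ys) ≡ ys
rights-map-inj₂ []       = refl
rights-map-inj₂ (y ∷ ys) = cong (y ∷_) (rights-map-inj₂ ys)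

infixr 4 _⇒ᵇ_

_⇒ᵇ_ : Bool → Bool → Bool
b ⇒ᵇ c = if b then c else true

⇒ᵇ-elim : ∀ b {c} → T (b ⇒ᵇ c) → T b → T c
⇒ᵇ-elim true t _ = t

-- The vector lists the values on the first word from a to c.

trivial-window : Vec Bool 16 → Bool
trivial-window v@(a ∷ n7 ∷ d ∷ n6 ∷ n8 ∷ n2 ∷ n0 ∷ n1 ∷ n10 ∷ n11 ∷ n9 ∷ n3 ∷ n5 ∷ b ∷ n4 ∷ c ∷ []) =
  (turns id (b ∷ n0 ∷ a ∷ n1 ∷ n2 ∷ n3 ∷ n4 ∷ n5 ∷ n6 ∷ n7 ∷ n8 ∷ n9 ∷ n10 ∷ c ∷ n11 ∷ d ∷ []) ≤ᵇ 2) ⇒ᵇ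
  (∣ a ∷ d ∷ b ∷ c ∷ [] ∣ ≤ᵇ 1) ⇒ᵇ (∣ v ∣ ≤ᵇ 1)

-- Only vectors with at most two changes are visited: 121 for each first value, in place of all
-- 32768.
few-turns⇒trivial-window : ∀ b v → steps id b (Vec.toList v) ≤ 2 → T (trivial-window (b ∷ v))
few-turns⇒trivial-window false = allSteps-sound 15 2 false (trivial-window ∘ (false ∷_)) _
few-turns⇒trivial-window true  = allSteps-sound 15 2 true  (trivial-window ∘ (true ∷_)) _

AtMostOne-not : ∀ {f : A → Bool} {c} → AtMostOne f c → AtMostOne (not ∘ f) (not c)
AtMostOne-not p u v fu fv = p u v (not-injective fu) (not-injective fv)

turns-alternating : ∀ (f : A → Bool) {x y z w} → f x ≡ false → f y ≡ true → f z ≡ false →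
                    f w ≡ true → turns f (x ∷ y ∷ z ∷ w ∷ []) ≡ 4
turns-alternating f fx fy fz fw rewrite fx | fy | fz | fw = refl

4≰2 : ¬ 4 ≤ 2
4≰2 (s≤s (s≤s ()))

-- The edges of a circuit that enter and leave its end of the rung z carry the
-- labels left z and right z.

record Labelling {A : Set} (L : Set) (ws₁ ws₂ : List A) : Set where
  field
    left₁ right₁ left₂ right₂ : A → L
    glue₁   : All (λ (u , v) → right₁ u ≡ left₁ v) (links ws₁)
    glue₂   : All (λ (u , v) → right₂ u ≡ left₂ v) (links ws₂)
    matched : ∀ z → Match (left₁ z) (right₁ z) (left₂ z) (right₂ z)

Labelling-rotate : ∀ {L : Set} (ws₁ ws₁′ ws₂ ws₂′ : List A) →
                   Labelling L (ws₁ ++ ws₁′) (ws₂ ++ ws₂′) → Labelling L (ws₁′ ++ ws₁) (ws₂′ ++ ws₂)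
Labelling-rotate ws₁ ws₁′ ws₂ ws₂′ ℓ = record
  { Labelling ℓ
  ; glue₁ = All-resp-↭ (links-rotate ws₁ ws₁′) glue₁
  ; glue₂ = All-resp-↭ (links-rotate ws₂ ws₂′) glue₂
  }
  where open Labelling ℓ

-- Transfers gluing along the stretch outside the block, where labels are unchanged. The starting
-- letters may differ: on the second word `c` takes over the outgoing label of the last inserted
-- rung.
glue-map : ∀ {L : Set} {r l : A → L} {r′ l′ : B → L} (h : A → B) {x x′} ys {z} → r x ≡ r′ x′ →
           (∀ {v} → v ∈ ys ∷ʳ z → l v ≡ l′ (h v)) → (∀ {u} → u ∈ ys → r u ≡ r′ (h u)) →
           All (λ (u , v) → r′ u ≡ l′ v) (walk x′ (map h ys ∷ʳ h z)) →
           All (λ (u , v) → r u ≡ l v) (walk x (ys ∷ʳ z))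
glue-map h []       rx lv ru (g ∷ []) = trans rx (trans g (sym (lv (here refl)))) ∷ []
glue-map h (y ∷ ys) rx lv ru (g ∷ gs) =
  trans rx (trans g (sym (lv (here refl)))) ∷
  glue-map h ys (ru (here refl)) (lv ∘ there) (ru ∘ there) gs

-- Changing finitely many labels

module Override {A L : Set} (_≟_ : DecidableEquality A) where

  opaque
    override : List (A × L) → (A → L) → A → L
    override []              f z = f z
    override ((k , x) ∷ kxs) f z = if does (z ≟ k) then x else override kxs f z

    override-[] : ∀ {f} z → override [] f z ≡ f z
    override-[] z = refl

    override-≡ : ∀ {k x} kxs {f} → override ((k , x) ∷ kxs) f k ≡ x
    override-≡ {k} kxs with k ≟ k
    ... | yes _  = refl
    ... | no k≢k = contradiction refl k≢k

    override-≢ : ∀ {k x} kxs {f z} → z ≢ k → override ((k , x) ∷ kxs) f z ≡ override kxs f z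
    override-≢ {k} kxs {z = z} z≢k with z ≟ k
    ... | yes z≡k = contradiction z≡k z≢k
    ... | no _    = refl

nth : {L : Set} → L → List L → ℕ → L
nth x []       _       = x
nth x (y ∷ ys) zero    = y
nth x (y ∷ ys) (suc n) = nth x ys n

Match-≡ : ∀ {L : Set} {p q r s p′ q′ r′ s′ : L} → p ≡ p′ → q ≡ q′ → r ≡ r′ → s ≡ s′ →
          Match p′ q′ r′ s′ → Match p q r s
Match-≡ refl refl refl refl m = m

-- The labels on the block from a to c and from b to the last inserted label:
-- 0 to 16 along the first word, 17 to 32 along the second word, and 33 and 34
-- around d on the second word.

long-facts : Vec Fact 18
long-facts =
  match 3 4 25 26 ∷
  match 1 2 26 27 ∷
  match 4 5 27 28 ∷
  match 6 7 18 19 ∷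
  match 7 8 20 21 ∷
  match 0 1 19 20 ∷
  match 5 6 21 22 ∷
  match 12 13 24 25 ∷
  match 11 12 22 23 ∷
  match 14 15 23 24 ∷
  match 13 14 17 18 ∷
  match 10 11 28 29 ∷
  match 8 9 29 30 ∷
  match 15 16 30 31 ∷
  match 9 10 31 32 ∷
  match 2 3 33 34 ∷
  compare 0 17 ∷ compare 0 32 ∷ []

-- The unknowns are the inner labels of the original piece: `x₁`, `x₂`, `x₃` between `a d b c` on
-- the first circuit, `y₁`, `y₂` between `b a c` on the second. The numerals are the labels kept
-- from the outside. The four matches belong to `a`, `d`, `b`, `c`.
short-facts : ℕ × ℕ × ℕ × ℕ × ℕ → List Quad
short-facts (x₁ , x₂ , x₃ , y₁ , y₂) =
  (0 , x₁ , y₁ , y₂) ∷ (x₁ , x₂ , 33 , 34) ∷ (x₂ , x₃ , 17 , y₁) ∷ (x₃ , 16 , y₂ , 32) ∷ []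

-- These eight shapes exhaust the possibilities. The rung `d` makes `x₁`, `x₂` equal to 33, 34 in
-- some order; the rung `a` makes `y₁`, `y₂` equal to 0, `x₁` in some order; the rung `b` makes `x₃`
-- equal to `y₁` or 17. The constraint at `c` and the remaining halves of the others are left to the
-- check.
candidates : List (ℕ × ℕ × ℕ × ℕ × ℕ)
candidates =
  (33 , 34 , 0 , 0 , 33) ∷
  (33 , 34 , 17 , 0 , 33) ∷
  (33 , 34 , 33 , 33 , 0) ∷
  (33 , 34 , 17 , 33 , 0) ∷
  (34 , 33 , 0 , 0 , 34) ∷
  (34 , 33 , 17 , 0 , 34) ∷
  (34 , 33 , 34 , 34 , 0) ∷
  (34 , 33 , 17 , 34 , 0) ∷ []

long-facts-entail : T (entails long-facts (apart long-facts) (map short-facts candidates))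
long-facts-entail = _

-- Insertion of twelve rungs

module Grow {A : Set} (w : Weave A) where
  open Weave w

  Label : Set
  Label = Fin 12 ⊎ A

  old : A → Label
  old = inj₂

  new : Fin 12 → Label
  new = inj₁

  insertion₁ : List Label
  insertion₁ = new 7F ∷ old d ∷ new 6F ∷ new 8F ∷ new 2F ∷ new 0F ∷ new 1F ∷ new (# 10) ∷
               new (# 11) ∷ new 9F ∷ new 3F ∷ new 5F ∷ old b ∷ new 4F ∷ []

  long₂-prefix : List Label
  long₂-prefix =
    old b ∷ new 0F ∷ old a ∷ new 1F ∷ new 2F ∷ new 3F ∷ new 4F ∷ new 5F ∷ new 6F ∷ new 7F ∷
    new 8F ∷ new 9F ∷ new (# 10) ∷ old c ∷ new (# 11) ∷ []

  long₁ long₂ : List Label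
  long₁ = old a ∷ insertion₁ ++ old c ∷ map old R₁
  long₂ = long₂-prefix ++ map old R₂

  new≢old : ∀ {k z} → new k ≢ old z
  new≢old ()

  new∈insertion₁ : ∀ k → new k ∈ insertion₁
  new∈insertion₁ k = ∈-lefts⁻ insertion₁
    (from-yes (all? λ k → DecMembership._∈?_ Fin._≟_ k (lefts insertion₁)) k)

  -- Erasing the inserted letters leaves the old word, so the hypothesis that the old words are
  -- simple applies to the restriction of `f`.
  turns-word₁ : ∀ f → turns (f ∘ old) word₁ ≤ turns f long₁
  turns-word₁ f = ≤-trans (≤-reflexive (sym (turns-map f old word₁)))
    (steps-⊆ f (old a)
      (skip _ (refl ∷ skip _ (skip _ (skip _ (skip _ (skip _ (skip _ (skip _ (skip _ (skip _
        (skip _ (refl ∷ skip _ (⊆-refl {x = old c ∷ map old R₁ ++ [ old a ]}))))))))))))))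

  turns-word₂ : ∀ f → turns (f ∘ old) word₂ ≤ turns f long₂
  turns-word₂ f = ≤-trans (≤-reflexive (sym (turns-map f old word₂)))
    (steps-⊆ f (old b)
      (skip _ (refl ∷ skip _ (skip _ (skip _ (skip _ (skip _ (skip _ (skip _ (skip _ (skip _
        (skip _ (refl ∷ skip _ (⊆-refl {x = map old R₂ ++ [ old b ]})))))))))))))) 

  mark : Fin 4 → A
  mark = lookup (a ∷ d ∷ b ∷ c ∷ [])

  mark-injective : ∀ i j → mark i ≡ mark j → i ≡ j
  mark-injective with unique₁
  ... | (a≢d ∷ a≢b ∷ a≢c ∷ _) ∷ (d≢b ∷ d≢c ∷ _) ∷ (b≢c ∷ _) ∷ _ = λ
    { 0F 0F _ → refl ; 1F 1F _ → refl ; 2F 2F _ → refl ; 3F 3F _ → refl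
    ; 0F 1F e → contradiction e a≢d ; 1F 0F e → contradiction (sym e) a≢d
    ; 0F 2F e → contradiction e a≢b ; 2F 0F e → contradiction (sym e) a≢b
    ; 0F 3F e → contradiction e a≢c ; 3F 0F e → contradiction (sym e) a≢c
    ; 1F 2F e → contradiction e d≢b ; 2F 1F e → contradiction (sym e) d≢b
    ; 1F 3F e → contradiction e d≢c ; 3F 1F e → contradiction (sym e) d≢c
    ; 2F 3F e → contradiction e b≢c ; 3F 2F e → contradiction (sym e) b≢c }

  module _ (f : Label → Bool) (one : AtMostOne (f ∘ old) true)
           (t₁ : turns f long₁ ≤ 2) (t₂ : turns f long₂ ≤ 2) where

    marks : Vec Bool 4
    marks = tabulate (f ∘ old ∘ mark)

    window : Vec Bool 16
    window = Vec.map f (Vec.fromList (old a ∷ insertion₁ ++ [ old c ]))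

    marks≤1 : ∣ marks ∣ ≤ 1
    marks≤1 = ≡⇒∣∣≤1 marks λ {i} {j} i∈ j∈ → mark-injective i j (one _ _ (true-at i∈) (true-at j∈))
      where
      true-at : ∀ {i} → i ∈ˢ marks → f (old (mark i)) ≡ true
      true-at {i} i∈ = trans (sym (lookup∘tabulate (f ∘ old ∘ mark) i)) ([]=⇒lookup i∈)

    window₁-steps : steps id (f (old a)) (Vec.toList (Vec.tail window)) ≤ 2
    window₁-steps = ≤-trans
      (steps-⊆ f (old a) (++⁺ (⊆-refl {x = insertion₁}) (refl ∷ minimum (map old R₁ ++ [ old a ])))) t₁

    -- Of `R₂` only the letter `d` is kept. This makes the word independent of the weave, so that
    -- one finite check serves all insertions.
    window₂-turns : turns f (long₂-prefix ∷ʳ old d) ≤ 2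
    window₂-turns = ≤-trans
      (steps-⊆ f (old b)
        (refl ∷ refl ∷ refl ∷ refl ∷ refl ∷ refl ∷ refl ∷ refl ∷ refl ∷ refl ∷ refl ∷ refl ∷ refl ∷ refl ∷
          ++⁺ (from∈ (∈-map⁺ old d∈R₂)) (⊆-refl {x = [ old b ]}))) t₂

    window≤1 : ∣ window ∣ ≤ 1
    window≤1 = ≤ᵇ⇒≤ ∣ window ∣ 1
      (⇒ᵇ-elim (∣ marks ∣ ≤ᵇ 1)
        (⇒ᵇ-elim (turns f (long₂-prefix ∷ʳ old d) ≤ᵇ 2)
          (few-turns⇒trivial-window (f (old a)) (Vec.tail window) window₁-steps)
          (≤⇒≤ᵇ window₂-turns))
        (≤⇒≤ᵇ marks≤1))

    same-in-window : ∀ {u v} → u ∈ old a ∷ insertion₁ ++ [ old c ] → v ∈ old a ∷ insertion₁ ++ [ old c ] →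
                     f u ≡ true → f v ≡ true → u ≡ v
    same-in-window u∈ v∈ = ∣map∣≤1⇒≡ f window≤1 (∈-fromList⁺ u∈) (∈-fromList⁺ v∈)

    new∈ : ∀ k → new k ∈ old a ∷ insertion₁ ++ [ old c ]
    new∈ k = there (∈-++⁺ˡ (new∈insertion₁ k))

    -- An inserted label and a label of R₁ are separated on the first word by
    -- a and c.
    new-old : ∀ k z → f (new k) ≡ true → f (old z) ≡ true → ⊥
    new-old k z fk fz = go (complete₁ z)
      where
      separate : ∀ {y} → old y ∈ old a ∷ insertion₁ ++ [ old c ] → f (old y) ≡ true → ⊥
      separate y∈ fy = new≢old (same-in-window (new∈ k) y∈ fk fy)

      a∈ : old a ∈ old a ∷ insertion₁ ++ [ old c ]
      a∈ = here refl

      c∈ : old c ∈ old a ∷ insertion₁ ++ [ old c ]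
      c∈ = there (∈-++⁺ʳ insertion₁ (here refl))

      go : z ∈ word₁ → ⊥
      go (here refl)                         = separate a∈ fz
      go (there (here refl))                 = separate (there (there (here refl))) fz
      go (there (there (here refl)))         = separate (there (∈-rights⁻ (insertion₁ ++ [ old c ]) (there (here refl)))) fz
      go (there (there (there (here refl)))) = separate c∈ fz
      go (there (there (there (there z∈))))  = 4≰2
        (≤-trans (≤-reflexive (sym (turns-alternating f (¬-not (separate a∈)) fk (¬-not (separate c∈)) fz)))
          (≤-trans (steps-⊆ f (old a)
            (++⁺ (from∈ (new∈insertion₁ k))
              (refl ∷ ++⁺ (from∈ (∈-map⁺ old z∈)) (⊆-refl {x = [ old a ]})))) t₁))

    grow-AtMostOne : AtMostOne f true
    grow-AtMostOne (inj₁ k) (inj₁ l) fk fl = same-in-window (new∈ k) (new∈ l) fk fl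
    grow-AtMostOne (inj₁ k) (inj₂ z) fk fz = contradiction fz (new-old k z fk)
    grow-AtMostOne (inj₂ z) (inj₁ k) fz fk = contradiction fz (new-old k z fk)
    grow-AtMostOne (inj₂ y) (inj₂ z) fy fz = cong inj₂ (one y z fy fz)

  long-simple : Simple word₁ word₂ → Simple long₁ long₂
  long-simple S f t₁ t₂ with S (f ∘ old) (≤-trans (turns-word₁ f) t₁) (≤-trans (turns-word₂ f) t₂)
  ... | inj₁ one = inj₁ (grow-AtMostOne f one t₁ t₂)
  -- The complement has the same turns, so the case of at most one `false` among the old rungs
  -- reduces to the other case.
  ... | inj₂ one = inj₂ λ u v fu fv → grow-AtMostOne (not ∘ f) (AtMostOne-not {f = f ∘ old} one)
                     (≤-trans (≤-reflexive (turns-not f long₁)) t₁)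
                     (≤-trans (≤-reflexive (turns-not f long₂)) t₂)
                     u v (cong not fu) (cong not fv)

  module Shrink {L : Set} (_≟ᴬ_ : DecidableEquality A) (_≟ᴸ_ : DecidableEquality L)
                (ℓ : Labelling L long₁ long₂) where
    open Labelling ℓ
    open Override {A} {L} _≟ᴬ_

    ρ : ℕ → L
    -- The order is that of the numbering in `long-facts`. The list has 35 entries, so the numbers 0
    -- to 34 all name actual labels and never reach the default.
    ρ = nth (left₁ (old a))
      (map left₁ (old a ∷ insertion₁ ++ [ old c ]) ++ right₁ (old c) ∷
       map left₂ long₂-prefix ++ right₂ (new (# 11)) ∷ left₂ (old d) ∷ right₂ (old d) ∷ [])

    open Soundness ρ

    long-facts-hold : Allᵛ Holds long-facts
    long-facts-hold with glue₁ | glue₂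
    ... | ga ∷ g7 ∷ gd ∷ g6 ∷ g8 ∷ g2 ∷ g0 ∷ g1 ∷ g10 ∷ g11 ∷ g9 ∷ g3 ∷ g5 ∷ gb ∷ g4 ∷ _
        | hb ∷ h0 ∷ ha ∷ h1 ∷ h2 ∷ h3 ∷ h4 ∷ h5 ∷ h6 ∷ h7 ∷ h8 ∷ h9 ∷ h10 ∷ hc ∷ _ =
      -- An outgoing label inside the block appears in `ρ` only as the incoming label of the next
      -- rung; gluing identifies the two.
      Match-≡ refl (sym g6) refl (sym h6) (matched (new 6F)) ∷
      Match-≡ refl (sym g7) refl (sym h7) (matched (new 7F)) ∷
      Match-≡ refl (sym g8) refl (sym h8) (matched (new 8F)) ∷
      Match-≡ refl (sym g0) refl (sym h0) (matched (new 0F)) ∷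
      Match-≡ refl (sym g1) refl (sym h1) (matched (new 1F)) ∷
      Match-≡ refl (sym ga) refl (sym ha) (matched (old a)) ∷
      Match-≡ refl (sym g2) refl (sym h2) (matched (new 2F)) ∷
      Match-≡ refl (sym g5) refl (sym h5) (matched (new 5F)) ∷
      Match-≡ refl (sym g3) refl (sym h3) (matched (new 3F)) ∷
      Match-≡ refl (sym g4) refl (sym h4) (matched (new 4F)) ∷
      Match-≡ refl (sym gb) refl (sym hb) (matched (old b)) ∷
      Match-≡ refl (sym g9) refl (sym h9) (matched (new 9F)) ∷
      Match-≡ refl (sym g10) refl (sym h10) (matched (new (# 10))) ∷
      Match-≡ refl refl refl (sym hc) (matched (old c)) ∷
      Match-≡ refl (sym g11) refl refl (matched (new (# 11))) ∷
      Match-≡ refl (sym gd) refl refl (matched (old d)) ∷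
      (_ ≟ᴸ _) ∷ (_ ≟ᴸ _) ∷ []

    short-facts-hold : ∃[ w ] All Matches (short-facts w)
    short-facts-hold = satisfied (Any.map⁻ {f = short-facts} {xs = candidates}
      (solve long-facts (map short-facts candidates) long-facts-entail long-facts-hold))

    -- The original piece can be labelled so that its five outgoing connections look the same from
    -- outside as those of the enlarged piece. Replacing one by the other leaves every constraint
    -- outside intact.
    shrink : Labelling L word₁ word₂
    shrink with short-facts-hold | unique₁ | unique₂
    ... | (x₁ , x₂ , x₃ , y₁ , y₂) , ma ∷ md ∷ mb ∷ mc ∷ []
        | (a≢d ∷ a≢b ∷ a≢c ∷ a∉) ∷ (d≢b ∷ d≢c ∷ d∉) ∷ (b≢c ∷ b∉) ∷ c∉ ∷ _
        | (_ ∷ _ ∷ b∉₂) ∷ (_ ∷ a∉₂) ∷ c∉₂ ∷ _ = record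
      { left₁   = l₁
      ; right₁  = r₁
      ; left₂   = l₂
      ; right₂  = r₂
      ; glue₁   =
          trans r₁a (sym l₁d) ∷ trans r₁d (sym l₁b) ∷ trans r₁b (sym l₁c) ∷
          glue-map old R₁ (r₁-old (a≢c ∘ sym) (d≢c ∘ sym) (b≢c ∘ sym)) l₁-R₁
            (λ u∈ → r₁-old (R₁≢ a∉ u∈) (R₁≢ d∉ u∈) (R₁≢ b∉ u∈)) (drop15 glue₁)
      ; glue₂   =
          trans r₂b (sym l₂a) ∷ trans r₂a (sym l₂c) ∷
          glue-map old R₂ r₂c l₂-R₂
            (λ u∈ → r₂-old (R₁≢ b∉₂ u∈) (R₁≢ a∉₂ u∈) (R₁≢ c∉₂ u∈)) (drop14 glue₂)
      ; matched = λ z → go z (z ≟ᴬ a) (z ≟ᴬ b) (z ≟ᴬ c) (z ≟ᴬ d)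
      }
      where
      -- Each of the five inner edges receives its new label at both ends, and `ρ 32` hands `c` the
      -- label leaving the last inserted rung. The labels in front of `a` on the first circuit, in
      -- front of `b` on the second, behind `c` on the first and around `d` on the second are kept.
      l₁ r₁ l₂ r₂ : A → L
      l₁ = override ((d , ρ x₁) ∷ (b , ρ x₂) ∷ (c , ρ x₃) ∷ []) (left₁ ∘ old)
      r₁ = override ((a , ρ x₁) ∷ (d , ρ x₂) ∷ (b , ρ x₃) ∷ []) (right₁ ∘ old)
      l₂ = override ((a , ρ y₁) ∷ (c , ρ y₂) ∷ []) (left₂ ∘ old)
      r₂ = override ((b , ρ y₁) ∷ (a , ρ y₂) ∷ (c , ρ 32) ∷ []) (right₂ ∘ old)

      R₁≢ : ∀ {x R u} → All (x ≢_) R → u ∈ R → u ≢ x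
      R₁≢ x∉ u∈ = All.lookup x∉ u∈ ∘ sym

      l₁-old : ∀ {z} → z ≢ d → z ≢ b → z ≢ c → l₁ z ≡ left₁ (old z)
      l₁-old zd zb zc = trans (override-≢ _ zd) (trans (override-≢ _ zb) (trans (override-≢ [] zc) (override-[] _)))
      r₁-old : ∀ {z} → z ≢ a → z ≢ d → z ≢ b → r₁ z ≡ right₁ (old z)
      r₁-old za zd zb = trans (override-≢ _ za) (trans (override-≢ _ zd) (trans (override-≢ [] zb) (override-[] _)))
      l₂-old : ∀ {z} → z ≢ a → z ≢ c → l₂ z ≡ left₂ (old z)
      l₂-old za zc = trans (override-≢ _ za) (trans (override-≢ [] zc) (override-[] _))
      r₂-old : ∀ {z} → z ≢ b → z ≢ a → z ≢ c → r₂ z ≡ right₂ (old z)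
      r₂-old zb za zc = trans (override-≢ _ zb) (trans (override-≢ _ za) (trans (override-≢ [] zc) (override-[] _)))

      l₁d : l₁ d ≡ ρ x₁
      l₁d = override-≡ _
      l₁b : l₁ b ≡ ρ x₂
      l₁b = trans (override-≢ _ (d≢b ∘ sym)) (override-≡ _)
      l₁c : l₁ c ≡ ρ x₃
      l₁c = trans (override-≢ _ (d≢c ∘ sym)) (trans (override-≢ _ (b≢c ∘ sym)) (override-≡ []))
      r₁a : r₁ a ≡ ρ x₁
      r₁a = override-≡ _
      r₁d : r₁ d ≡ ρ x₂
      r₁d = trans (override-≢ _ (a≢d ∘ sym)) (override-≡ _)
      r₁b : r₁ b ≡ ρ x₃
      r₁b = trans (override-≢ _ (a≢b ∘ sym)) (trans (override-≢ _ (d≢b ∘ sym)) (override-≡ []))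
      l₂a : l₂ a ≡ ρ y₁
      l₂a = override-≡ _
      l₂c : l₂ c ≡ ρ y₂
      l₂c = trans (override-≢ _ (a≢c ∘ sym)) (override-≡ [])
      r₂b : r₂ b ≡ ρ y₁
      r₂b = override-≡ _
      r₂a : r₂ a ≡ ρ y₂
      r₂a = trans (override-≢ _ a≢b) (override-≡ _)
      r₂c : r₂ c ≡ right₂ (new (# 11))
      r₂c = trans (override-≢ _ (b≢c ∘ sym)) (trans (override-≢ _ (a≢c ∘ sym)) (override-≡ []))

      l₁-R₁ : ∀ {v} → v ∈ R₁ ∷ʳ a → l₁ v ≡ left₁ (old v)
      l₁-R₁ v∈ with ∈-++⁻ R₁ v∈
      ... | inj₁ v∈R₁        = l₁-old (R₁≢ d∉ v∈R₁) (R₁≢ b∉ v∈R₁) (R₁≢ c∉ v∈R₁)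
      ... | inj₂ (here refl) = l₁-old a≢d a≢b a≢c

      l₂-R₂ : ∀ {v} → v ∈ R₂ ∷ʳ b → l₂ v ≡ left₂ (old v)
      l₂-R₂ v∈ with ∈-++⁻ R₂ v∈
      ... | inj₁ v∈R₂        = l₂-old (R₁≢ a∉₂ v∈R₂) (R₁≢ c∉₂ v∈R₂)
      ... | inj₂ (here refl) = l₂-old (a≢b ∘ sym) b≢c

      drop15 : ∀ {P : Label × Label → Set} → All P (links long₁) → All P (walk (old c) (map old R₁ ∷ʳ old a))
      drop15 (_ ∷ _ ∷ _ ∷ _ ∷ _ ∷ _ ∷ _ ∷ _ ∷ _ ∷ _ ∷ _ ∷ _ ∷ _ ∷ _ ∷ _ ∷ ps) = ps
      drop14 : ∀ {P : Label × Label → Set} → All P (links long₂) → All P (walk (new (# 11)) (map old R₂ ∷ʳ old b))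
      drop14 (_ ∷ _ ∷ _ ∷ _ ∷ _ ∷ _ ∷ _ ∷ _ ∷ _ ∷ _ ∷ _ ∷ _ ∷ _ ∷ _ ∷ ps) = ps

      go : ∀ z → Dec (z ≡ a) → Dec (z ≡ b) → Dec (z ≡ c) → Dec (z ≡ d) →
           Match (l₁ z) (r₁ z) (l₂ z) (r₂ z)
      go z (yes refl) _ _ _ = Match-≡ (l₁-old a≢d a≢b a≢c) r₁a l₂a r₂a ma
      go z _ (yes refl) _ _ = Match-≡ l₁b r₁b (l₂-old (a≢b ∘ sym) b≢c) r₂b mb
      go z _ _ (yes refl) _ =
        Match-≡ l₁c (r₁-old (a≢c ∘ sym) (d≢c ∘ sym) (b≢c ∘ sym)) l₂c r₂c mc
      go z _ _ _ (yes refl) =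
        Match-≡ l₁d r₁d (l₂-old (a≢d ∘ sym) d≢c) (r₂-old d≢b (a≢d ∘ sym) d≢c) md
      go z (no z≢a) (no z≢b) (no z≢c) (no z≢d) =
        Match-≡ (l₁-old z≢d z≢b z≢c) (r₁-old z≢a z≢d z≢b) (l₂-old z≢a z≢c)
          (r₂-old z≢b z≢a z≢c) (matched (old z))

-- The family of weaves

-- The label type varies because two kinds occur: the three colours of an edge colouring, and the
-- indices of the circuits of a double cover.
Unlabelled : List A → List A → Set₁
Unlabelled ws₁ ws₂ = ∀ {L : Set} → DecidableEquality L → ¬ Labelling L ws₁ ws₂

listed : ∀ {n} (ks : List (Fin n)) →
         {True (all? λ k → DecMembership._∈?_ Fin._≟_ k ks)} → ∀ k → k ∈ ks
listed ks {t} = toWitness t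

module _ {A : Set} (w : Weave A) where
  open Weave w
  open Grow w

  tail₁ head₂ tail₂ : List Label
  tail₁ = insertion₁ ++ old c ∷ map old R₁
  head₂ = old b ∷ new 0F ∷ old a ∷ new 1F ∷ new 2F ∷ new 3F ∷ new 4F ∷ new 5F ∷ []
  tail₂ = new 6F ∷ new 7F ∷ new 8F ∷ new 9F ∷ new (# 10) ∷ old c ∷ new (# 11) ∷ map old R₂

  long₁-unique : Unique long₁
  long₁-unique = Unique-⊎ long₁
    (subst (λ ks → Unique (lefts (old a ∷ insertion₁) ++ ks)) (sym (lefts-map-inj₂ R₁))
      (from-yes (DecUnique.unique? Fin._≟_ (lefts insertion₁ ++ []))))
    (subst (λ zs → Unique (a ∷ d ∷ b ∷ c ∷ zs)) (sym (rights-map-inj₂ R₁)) unique₁)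

  long₂-unique : Unique long₂
  long₂-unique = Unique-⊎ long₂
    (subst (λ ks → Unique (lefts long₂-prefix ++ ks)) (sym (lefts-map-inj₂ R₂))
      (from-yes (DecUnique.unique? Fin._≟_ (lefts long₂-prefix ++ []))))
    (subst (λ zs → Unique (b ∷ a ∷ c ∷ zs)) (sym (rights-map-inj₂ R₂)) unique₂)

  long₁-complete : ∀ z → z ∈ long₁
  long₁-complete (inj₁ k) = there (∈-++⁺ˡ (new∈insertion₁ k))
  long₁-complete (inj₂ z) = ∈-rights⁻ long₁
    (subst (λ zs → z ∈ a ∷ d ∷ b ∷ c ∷ zs) (sym (rights-map-inj₂ R₁)) (complete₁ z))

  long₂-complete : ∀ z → z ∈ long₂
  long₂-complete (inj₁ k) = ∈-++⁺ˡ (∈-lefts⁻ long₂-prefix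
    (listed (lefts long₂-prefix) k))
  long₂-complete (inj₂ z) = ∈-rights⁻ long₂
    (subst (λ zs → z ∈ b ∷ a ∷ c ∷ zs) (sym (rights-map-inj₂ R₂)) (complete₂ z))

  -- The inserted rungs repeat the pattern: `7F d 6F 8F` are consecutive on the first word and
  -- `6F 7F 8F` on the second, in the roles of `a d b c` and `b a c`. Both words are rotated to
  -- start there, and `d` is the same rung at every stage.
  grow : Weave Label
  grow = record
    { a = new 7F ; b = new 6F ; c = new 8F ; d = old d
    ; R₁ = new 2F ∷ new 0F ∷ new 1F ∷ new (# 10) ∷ new (# 11) ∷ new 9F ∷ new 3F ∷ new 5F ∷
           old b ∷ new 4F ∷ old c ∷ map old R₁ ∷ʳ old a
    ; R₂ = new 9F ∷ new (# 10) ∷ old c ∷ new (# 11) ∷ map old R₂ ++ head₂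
    ; unique₁   = Unique-rotate [ old a ] tail₁ long₁-unique
    ; unique₂   = Unique-rotate head₂ tail₂ long₂-unique
    ; complete₁ = λ z → ∈-resp-↭ (++-comm [ old a ] tail₁) (long₁-complete z)
    ; complete₂ = λ z → ∈-resp-↭ (++-comm head₂ tail₂) (long₂-complete z)
    }

  grow-simple : Simple word₁ word₂ → Simple (Weave.word₁ grow) (Weave.word₂ grow)
  grow-simple S f t₁ t₂ = long-simple S f
    (≤-trans (≤-reflexive (turns-rotate f [ old a ] tail₁)) t₁)
    (≤-trans (≤-reflexive (turns-rotate f head₂ tail₂)) t₂)

  grow-unlabelled : DecidableEquality A → Unlabelled word₁ word₂ →
                    Unlabelled (Weave.word₁ grow) (Weave.word₂ grow)
  grow-unlabelled _≟ᴬ_ U _≟ᴸ_ ℓ =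
    U _≟ᴸ_ (Shrink.shrink _≟ᴬ_ _≟ᴸ_ (Labelling-rotate tail₁ [ old a ] tail₂ head₂ ℓ))

-- The Petersen graph.

seed : Weave (Fin 5)
seed = record
  { a = 0F ; b = 2F ; c = 3F ; d = 1F
  ; R₁ = 4F ∷ []
  ; R₂ = 1F ∷ 4F ∷ []
  ; unique₁   = from-yes (DecUnique.unique? Fin._≟_ (0F ∷ 1F ∷ 2F ∷ 3F ∷ 4F ∷ []))
  ; unique₂   = from-yes (DecUnique.unique? Fin._≟_ (2F ∷ 0F ∷ 3F ∷ 1F ∷ 4F ∷ []))
  ; complete₁ = listed (0F ∷ 1F ∷ 2F ∷ 3F ∷ 4F ∷ [])
  ; complete₂ = listed (2F ∷ 0F ∷ 3F ∷ 1F ∷ 4F ∷ [])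
  }

-- Labels 0 to 4 are the incoming labels along the first word, 5 to 9 those along the second word 2,
-- 0, 3, 1, 4. An outgoing label is the incoming label of the next rung.
seed-facts : Vec Fact 5
seed-facts =
  match 0 1 6 7 ∷ match 1 2 8 9 ∷ match 2 3 5 6 ∷ match 3 4 7 8 ∷ match 4 0 9 5 ∷ []

-- With the empty goal, entailment means that every branch closes by a clash.
seed-facts-contradict : T (entails seed-facts (apart seed-facts) [])
seed-facts-contradict = _

seed-unlabelled : Unlabelled (Weave.word₁ seed) (Weave.word₂ seed)
seed-unlabelled {L} _ ℓ with glue₁ | glue₂
  where open Labelling ℓ
... | g0 ∷ g1 ∷ g2 ∷ g3 ∷ g4 ∷ [] | h2 ∷ h0 ∷ h3 ∷ h1 ∷ h4 ∷ [] =
  contradiction (Soundness.solve ρ seed-facts [] seed-facts-contradict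
    (Match-≡ refl (sym g0) refl (sym h0) (matched 0F) ∷
     Match-≡ refl (sym g1) refl (sym h1) (matched 1F) ∷
     Match-≡ refl (sym g2) refl (sym h2) (matched 2F) ∷
     Match-≡ refl (sym g3) refl (sym h3) (matched 3F) ∷
     Match-≡ refl (sym g4) refl (sym h4) (matched 4F) ∷ [])) λ ()
  where
  open Labelling ℓ
  ρ : ℕ → L
  ρ = nth (left₁ 0F) (map left₁ (Weave.word₁ seed) ++ map left₂ (Weave.word₂ seed))

trivial-seed : Vec Bool 5 → Bool
trivial-seed v@(a ∷ d ∷ b ∷ c ∷ e ∷ []) =
  (turns id (b ∷ a ∷ c ∷ d ∷ e ∷ []) ≤ᵇ 2) ⇒ᵇ (∣ v ∣ ≤ᵇ 1) ∨ (∣ Vec.map not v ∣ ≤ᵇ 1)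

few-turns⇒trivial-seed : ∀ b v → steps id b (Vec.toList v) ≤ 2 → T (trivial-seed (b ∷ v))
few-turns⇒trivial-seed false = allSteps-sound 4 2 false (trivial-seed ∘ (false ∷_)) _
few-turns⇒trivial-seed true  = allSteps-sound 4 2 true  (trivial-seed ∘ (true ∷_)) _

seed-simple : Simple (Weave.word₁ seed) (Weave.word₂ seed)
seed-simple f t₁ t₂ with Equivalence.to T-∨ (⇒ᵇ-elim (turns f (Weave.word₂ seed) ≤ᵇ 2)
  (few-turns⇒trivial-seed (f 0F) (Vec.map f (1F ∷ 2F ∷ 3F ∷ 4F ∷ []))
    (≤-trans (steps-⊆ f 0F {1F ∷ 2F ∷ 3F ∷ 4F ∷ []} (refl ∷ refl ∷ refl ∷ refl ∷ minimum [ 0F ])) t₁))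
  (≤⇒≤ᵇ t₂))
... | inj₁ le = inj₁ λ u v → ∣map∣≤1⇒≡ f {Vec.allFin 5} (≤ᵇ⇒≤ _ 1 le) (∈-allFin⁺ u) (∈-allFin⁺ v)
... | inj₂ le = inj₂ λ u v fu fv → ∣map∣≤1⇒≡ (not ∘ f) {Vec.allFin 5} (≤ᵇ⇒≤ _ 1 le)
                  (∈-allFin⁺ u) (∈-allFin⁺ v) (cong not fu) (cong not fv)

Label : ℕ → Set
Label zero    = Fin 5
Label (suc n) = Fin 12 ⊎ Label n

_≟ˡ_ : ∀ {n} → DecidableEquality (Label n)
_≟ˡ_ {zero}  = Fin._≟_
_≟ˡ_ {suc n} = ≡-dec Fin._≟_ _≟ˡ_

weave : ∀ n → Weave (Label n)
weave zero    = seed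
weave (suc n) = grow (weave n)

weave-simple : ∀ n → Simple (Weave.word₁ (weave n)) (Weave.word₂ (weave n))
weave-simple zero    = seed-simple
weave-simple (suc n) = grow-simple (weave n) (weave-simple n)

weave-unlabelled : ∀ n → Unlabelled (Weave.word₁ (weave n)) (Weave.word₂ (weave n))
weave-unlabelled zero    = seed-unlabelled
weave-unlabelled (suc n) = grow-unlabelled (weave n) (_≟ˡ_ {n}) (weave-unlabelled n)

-- Graphs and circuits

opaque
  ⟦_⟧ : {P : Fin n → Set} → Decidable P → Subset n
  ⟦ P? ⟧ = tabulate (does ∘ P?)

  ∈⟦⟧⁺ : ∀ {P : Fin n → Set} (P? : Decidable P) {x} → P x → x ∈ˢ ⟦ P? ⟧
  ∈⟦⟧⁺ P? {x} px =
    lookup⇒[]= x _ (trans (lookup∘tabulate (does ∘ P?) x) (dec-true (P? x) px))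

  ∈⟦⟧⁻ : ∀ {P : Fin n → Set} (P? : Decidable P) {x} → x ∈ˢ ⟦ P? ⟧ → P x
  ∈⟦⟧⁻ P? {x} x∈ with P? x | trans (sym (lookup∘tabulate (does ∘ P?) x)) ([]=⇒lookup x∈)
  ... | yes px | _  = px
  ... | no _   | ()

does⇒ : ∀ {P : Set} (P? : Dec P) → does P? ≡ true → P
does⇒ (yes p) _ = p

does⇒¬ : ∀ {P : Set} (P? : Dec P) → does P? ≡ false → ¬ P
does⇒¬ (no ¬p) _ = ¬p

x∈p─q⇒x∉q : ∀ {p q : Subset n} {x} → x ∈ˢ p ─ˢ q → x ∉ˢ q
x∈p─q⇒x∉q {p = _ ∷ p} {outside ∷ q} here       ()
x∈p─q⇒x∉q {p = _ ∷ p} {inside  ∷ q} (there x∈) (there x∈q) = x∈p─q⇒x∉q {p = p} x∈ x∈q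
x∈p─q⇒x∉q {p = _ ∷ p} {outside ∷ q} (there x∈) (there x∈q) = x∈p─q⇒x∉q {p = p} x∈ x∈q

-- Decidable predicates stand in for the subsets that encode a graph; later arguments reason about
-- the predicates alone, through `V⁺`, `V⁻`, `N⁺` and `N⁻`.
record Presentation (n : ℕ) : Set₁ where
  field
    Vertex   : Fin n → Set
    Edge     : Fin n → Fin n → Set
    vertex?  : Decidable Vertex
    edge?    : Decidable₂ Edge
    edge-vertex : ∀ {u v} → Edge u v → Vertex v
    edge-sym    : ∀ {u v} → Edge u v → Edge v u
    edge-irrefl : ∀ {u} → ¬ Edge u u

  graph : Graph n
  graph = record
    { V      = ⟦ vertex? ⟧
    ; N      = λ u → ⟦ edge? u ⟧
    ; N⊆V    = λ {u} v∈ → ∈⟦⟧⁺ vertex? (edge-vertex (∈⟦⟧⁻ (edge? u) v∈))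
    ; sym    = λ {u} {v} v∈ → ∈⟦⟧⁺ (edge? v) (edge-sym (∈⟦⟧⁻ (edge? u) v∈))
    ; irrefl = λ {u} u∈ → edge-irrefl (∈⟦⟧⁻ (edge? u) u∈)
    }

  V⁺ : ∀ {u} → Vertex u → u ∈ˢ V graph
  V⁺ = ∈⟦⟧⁺ vertex?
  V⁻ : ∀ {u} → u ∈ˢ V graph → Vertex u
  V⁻ = ∈⟦⟧⁻ vertex?
  N⁺ : ∀ {u v} → Edge u v → Adj graph u v
  N⁺ {u} = ∈⟦⟧⁺ (edge? u)
  N⁻ : ∀ {u v} → Adj graph u v → Edge u v
  N⁻ {u} = ∈⟦⟧⁻ (edge? u)

∖ⱽ-adj : ∀ (G : Graph n) X {u v} → u ∉ˢ X → Adj G u v → v ∉ˢ X → Adj (G ∖ⱽ X) u v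
∖ⱽ-adj G X {u} u∉ uv v∉ with u Subset.∈? X
... | yes u∈ = contradiction u∈ u∉
... | no _   = x∈p∧x∉q⇒x∈p─q uv v∉

Star-reverse : ∀ (G : Graph n) {u v} → Star (Adj G) u v → Star (Adj G) v u
Star-reverse G = reverse (Graph.sym G)

connected-from : ∀ (G : Graph n) r → r ∈ˢ V G → (∀ {v} → v ∈ˢ V G → Star (Adj G) r v) → Connected G
connected-from G r r∈ reach = (r , r∈) , λ u∈ v∈ → Star-reverse G (reach u∈) ◅◅ reach v∈

walk-reach : ∀ {R : A → A → Set} x ys → (∀ {u v} → (u , v) ∈ walk x ys → R u v) →
             ∀ {z} → z ∈ x ∷ ys → Star R x z
walk-reach x ys       step (here refl) = ε
walk-reach x (y ∷ ys) step (there z∈)  = step (here refl) ◅ walk-reach y ys (step ∘ there) z∈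

Star-closed : ∀ {R : A → A → Set} (P : A → Set) → (∀ {u v} → R u v → P u → P v) →
              ∀ {u v} → Star R u v → P u → P v
Star-closed P step ε        pu = pu
Star-closed P step (r ◅ rs) pu = Star-closed P step rs (step r pu)

∪ᴳ-connected : ∀ (G H : Graph n) {w} → Connected G → Connected H → w ∈ˢ V G → w ∈ˢ V H →
               Connected (G ∪ᴳ H)
∪ᴳ-connected G H {w} (_ , cG) (_ , cH) wG wH = connected-from (G ∪ᴳ H) w (x∈p∪q⁺ (inj₁ wG)) λ v∈ →
  [ (λ vG → Star-map (λ {u} e → x∈p∪q⁺ {p = N G u} (inj₁ e)) (cG wG vG))
  , (λ vH → Star-map (λ {u} e → x∈p∪q⁺ {p = N G u} (inj₂ e)) (cH wH vH)) ]′ (x∈p∪q⁻ _ _ v∈)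

walk-source : ∀ (x : A) ys z {p} → p ∈ walk x (ys ∷ʳ z) → proj₁ p ∈ x ∷ ys
walk-source x []       z (here refl) = here refl
walk-source x (y ∷ ys) z (here refl) = here refl
walk-source x (y ∷ ys) z (there p∈)  = there (walk-source y ys z p∈)

walk-target : ∀ (x : A) ys {p} → p ∈ walk x ys → proj₂ p ∈ ys
walk-target x (y ∷ ys) (here refl) = here refl
walk-target x (y ∷ ys) (there p∈)  = there (walk-target y ys p∈)

walk-prefix : ∀ (x : A) ys zs {p} → p ∈ walk x ys → p ∈ walk x (ys ++ zs)
walk-prefix x (y ∷ ys) zs (here refl) = here refl
walk-prefix x (y ∷ ys) zs (there p∈)  = there (walk-prefix y ys zs p∈)

links-source : ∀ (ws : List A) {p} → p ∈ links ws → proj₁ p ∈ ws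
links-source (x ∷ xs) = walk-source x xs x

links-target : ∀ (ws : List A) {p} → p ∈ links ws → proj₂ p ∈ ws
links-target (x ∷ xs) p∈ with ∈-++⁻ xs (walk-target x (xs ∷ʳ x) p∈)
... | inj₁ v∈          = there v∈
... | inj₂ (here refl) = here refl

sources-walk : ∀ (x : A) ys z → map proj₁ (walk x (ys ∷ʳ z)) ≡ x ∷ ys
sources-walk x []       z = refl
sources-walk x (y ∷ ys) z = cong (x ∷_) (sources-walk y ys z)

sources-links : ∀ (ws : List A) → map proj₁ (links ws) ≡ ws
sources-links []       = refl
sources-links (x ∷ xs) = sources-walk x xs x

-- The first components of the links, in order, are the word itself.
links-unique : ∀ {ws : List A} → Unique ws → Unique (links ws)
links-unique {ws = ws} u = Unique.map⁻ (subst Unique (sym (sources-links ws)) u)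

record Neighbours {A : Set} (ws : List A) (u : A) : Set where
  field
    pred succ : A
    pred-link : (pred , u) ∈ links ws
    succ-link : (u , succ) ∈ links ws
    pred≢succ : pred ≢ succ
    succ≢u    : succ ≢ u
    only-pred : ∀ {v} → (v , u) ∈ links ws → v ≡ pred
    only-succ : ∀ {v} → (u , v) ∈ links ws → v ≡ succ

neighbours-head : ∀ (u : A) s qs p → Unique (u ∷ s ∷ qs ∷ʳ p) → Neighbours (u ∷ s ∷ qs ∷ʳ p) u
neighbours-head u s qs p ((u≢s ∷ u∉) ∷ (s∉ ∷ _)) = record
  { pred      = p
  ; succ      = s
  ; pred-link = there (subst ((p , u) ∈_) (sym split) (∈-++⁺ʳ (walk s (qs ∷ʳ p)) (here refl)))
  ; succ-link = here refl
  ; pred≢succ = λ { refl → All.lookup s∉ (∈-++⁺ʳ qs (here refl)) refl }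
  ; succ≢u    = u≢s ∘ sym
  ; only-pred = λ { (here refl) → contradiction refl u≢s
                  ; (there vu∈) → last (∈-++⁻ (walk s (qs ∷ʳ p)) (subst (_ ∈_) split vu∈)) }
  ; only-succ = λ { (here refl) → refl
                  ; (there uv∈) → contradiction (walk-source s (qs ∷ʳ p) u uv∈) not-source }
  }
  where
  split : walk s ((qs ∷ʳ p) ∷ʳ u) ≡ walk s (qs ∷ʳ p) ++ (p , u) ∷ []
  split = trans (cong (walk s) (++-assoc qs [ p ] [ u ])) (walk-++ s qs p [ u ])

  not-source : u ∉ s ∷ qs ∷ʳ p
  not-source (here refl) = u≢s refl
  not-source (there u∈)  = All.lookup u∉ u∈ refl

  last : ∀ {v} → (v , u) ∈ walk s (qs ∷ʳ p) ⊎ (v , u) ∈ (p , u) ∷ [] → v ≡ p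
  last (inj₁ vu∈)         = contradiction refl (All.lookup u∉ (walk-target s (qs ∷ʳ p) vu∈))
  last (inj₂ (here refl)) = refl

-- After a rotation `u` comes first, its successor second and its predecessor last; three letters
-- keep the latter two apart.
neighbours : ∀ {ws : List A} {u} → Unique ws → 3 ≤ length ws → u ∈ ws → Neighbours ws u
neighbours {ws = ws} {u} uniq 3≤ u∈ with ∈-∃++ u∈
... | as , bs , refl = go (bs ++ as) (Unique-rotate as (u ∷ bs) uniq)
        (subst (3 ≤_) (↭-length (++-comm as (u ∷ bs))) 3≤) (links-rotate as (u ∷ bs))
  where
  go : ∀ xs → Unique (u ∷ xs) → 3 ≤ length (u ∷ xs) → links ws ↭ links (u ∷ xs) → Neighbours ws u
  go (s ∷ xs) uq (s≤s (s≤s le)) perm with initLast xs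
  ... | qs ∷ʳ′ p = record
    { Neighbours nb
    ; pred-link = ∈-resp-↭ (↭-sym perm) pred-link
    ; succ-link = ∈-resp-↭ (↭-sym perm) succ-link
    ; only-pred = only-pred ∘ ∈-resp-↭ perm
    ; only-succ = only-succ ∘ ∈-resp-↭ perm
    }
    where
    nb : Neighbours (u ∷ s ∷ qs ∷ʳ p) u
    nb = neighbours-head u s qs p uq
    open Neighbours nb
  go (s ∷ .[]) uq (s≤s (s≤s ())) perm | List.[]

Link : List A → A → A → Set
Link ws u v = (u , v) ∈ links ws ⊎ (v , u) ∈ links ws

Link-∈ : ∀ {ws : List A} {u v} → Link ws u v → v ∈ ws
Link-∈ {ws = ws} (inj₁ uv) = links-target ws uv
Link-∈ {ws = ws} (inj₂ vu) = links-source ws vu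

Link-sym : ∀ {ws : List A} {u v} → Link ws u v → Link ws v u
Link-sym = Sum.swap

module _ {A : Set} {ws : List A} (uniq : Unique ws) (3≤ : 3 ≤ length ws) where

  Link-irrefl : ∀ {u} → ¬ Link ws u u
  Link-irrefl l = Neighbours.succ≢u nb (sym (Neighbours.only-succ nb ([ id , id ]′ l)))
    where nb = neighbours uniq 3≤ (Link-∈ l)

  Link-neighbours : ∀ {u v} (u∈ : u ∈ ws) → Link ws u v →
                    let open Neighbours (neighbours uniq 3≤ u∈) in v ≡ succ ⊎ v ≡ pred
  Link-neighbours u∈ = Sum.map (Neighbours.only-succ nb) (Neighbours.only-pred nb)
    where nb = neighbours uniq 3≤ u∈

  -- A link in both directions would make the predecessor and the successor of `u` coincide. This
  -- ensures that listing directed links counts each edge once.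
  links-antisym : ∀ {u v} → (u , v) ∈ links ws → (v , u) ∉ links ws
  links-antisym uv vu = pred≢succ (trans (sym (only-pred vu)) (only-succ uv))
    where open Neighbours (neighbours uniq 3≤ (links-source ws uv))

_∈?ᴸ_ : ∀ (x : Fin n) xs → Dec (x ∈ xs)
_∈?ᴸ_ = DecMembership._∈?_ Fin._≟_

Link? : ∀ (ws : List (Fin n)) → Decidable₂ (Link ws)
Link? ws u v = ((u , v) ∈? links ws) ⊎-dec ((v , u) ∈? links ws)
  where open DecMembership (×-≡-dec Fin._≟_ Fin._≟_)

∈-pair : ∀ {x y z : A} → x ≡ y ⊎ x ≡ z → x ∈ y ∷ z ∷ []
∈-pair (inj₁ x≡y) = here x≡y
∈-pair (inj₂ x≡z) = there (here x≡z)

module Cycle {n : ℕ} {ws : List (Fin n)} (uniq : Unique ws) (3≤ : 3 ≤ length ws) where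

  presentation : Presentation n
  presentation = record
    { Vertex      = _∈ ws
    ; Edge        = Link ws
    ; vertex?     = _∈?ᴸ ws
    ; edge?       = Link? ws
    ; edge-vertex = Link-∈
    ; edge-sym    = Link-sym {ws = ws}
    ; edge-irrefl = Link-irrefl uniq 3≤
    }
  open Presentation presentation public renaming (graph to cycle)

  cycle-order : order cycle ≡ length ws
  cycle-order = ∣∣≡length uniq V⁺ V⁻

  cycle-regular : Regular 2 cycle
  cycle-regular {u} u∈ = ∣∣≡length {xs = succ ∷ pred ∷ []}
    (((pred≢succ ∘ sym) ∷ []) ∷ [] ∷ [])
    (λ { (here refl) → N⁺ (inj₁ succ-link) ; (there (here refl)) → N⁺ (inj₂ pred-link) })
    (λ v∈ → ∈-pair (Link-neighbours uniq 3≤ (V⁻ u∈) (N⁻ v∈)))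
    where open Neighbours (neighbours uniq 3≤ (V⁻ u∈))

  cycle-connected : Connected cycle
  cycle-connected = go ws refl 3≤
    where
    go : ∀ xs → xs ≡ ws → 3 ≤ length xs → Connected cycle
    go (x ∷ xs) refl _ = connected-from cycle x (V⁺ (here refl)) λ v∈ →
      walk-reach x (xs ∷ʳ x) (N⁺ ∘ inj₁) (∈-++⁺ˡ (V⁻ v∈))

  -- With `v` rotated to the front, the remaining letters form a path.
  cycle-minus-connected : ∀ {v} → v ∈ˢ V cycle → Connected (cycle ∖ⱽ ⁅ v ⁆)
  cycle-minus-connected {v} v∈ with ∈-∃++ (V⁻ v∈)
  ... | as , bs , ws≡ = go (bs ++ as)
          (Unique-rotate as (v ∷ bs) (subst Unique ws≡ uniq))
          (subst (3 ≤_) (trans (cong length ws≡) (↭-length (++-comm as (v ∷ bs)))) 3≤)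
          (λ p∈ → subst (λ ws → _ ∈ links ws) (sym ws≡) (∈-resp-↭ (↭-sym (links-rotate as (v ∷ bs))) p∈))
          (λ u∈ → ∈-resp-↭ (++-comm as (v ∷ bs)) (subst (_ ∈_) ws≡ u∈))
    where
    go : ∀ xs → Unique (v ∷ xs) → 3 ≤ length (v ∷ xs) →
         (∀ {p} → p ∈ links (v ∷ xs) → p ∈ links ws) → (∀ {u} → u ∈ ws → u ∈ v ∷ xs) →
         Connected (cycle ∖ⱽ ⁅ v ⁆)
    go [] _ (s≤s ()) _ _
    go (s ∷ xs) (v∉ ∷ _) _ ⊆ws ws⊆ = connected-from (cycle ∖ⱽ ⁅ v ⁆) s
      (x∈p∧x∉q⇒x∈p─q (V⁺ (links-target ws (⊆ws (here refl)))) (≢v (here refl)))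
      λ u∈ → walk-reach s xs
        (λ {u} {w} uw → ∖ⱽ-adj cycle ⁅ v ⁆ (≢v (source uw))
          (N⁺ (inj₁ (⊆ws (there (walk-prefix s xs [ v ] uw))))) (≢v (there (walk-target s xs uw))))
        (rest u∈)
      where
      ≢v : ∀ {u} → u ∈ s ∷ xs → u ∉ˢ ⁅ v ⁆
      ≢v u∈ u∈v = All.lookup v∉ u∈ (sym (x∈⁅y⁆⇒x≡y v u∈v))

      source : ∀ {u w} → (u , w) ∈ walk s xs → u ∈ s ∷ xs
      source uw = walk-source s xs v (walk-prefix s xs [ v ] uw)

      rest : ∀ {u} → u ∈ˢ V (cycle ∖ⱽ ⁅ v ⁆) → u ∈ s ∷ xs
      rest u∈ with ws⊆ (V⁻ (p─q⊆p (V cycle) ⁅ v ⁆ u∈))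
      ... | here refl = contradiction (x∈⁅x⁆ v) (x∈p─q⇒x∉q {p = V cycle} u∈)
      ... | there u∈′ = u∈′

  cycle-circuit : Circuit cycle
  cycle-circuit =
    cycle-regular , subst (3 ≤_) (sym cycle-order) 3≤ , cycle-connected , cycle-minus-connected

Unique-map : ∀ {B : Set} (h : A → B) {xs} → (∀ {x y} → x ∈ xs → y ∈ xs → h x ≡ h y → x ≡ y) →
             Unique xs → Unique (map h xs)
Unique-map h inj []       = []
Unique-map h {x ∷ xs} inj (x∉ ∷ u) =
  All.tabulate (λ hy∈ hx≡ → let y , y∈ , eq = ∈-map⁻ h hy∈ in
    All.lookup x∉ y∈ (inj (here refl) (there y∈) (trans hx≡ eq))) ∷
  Unique-map h (λ x∈ y∈ → inj (there x∈) (there y∈)) u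

normalise : Fin n × Fin n → Fin n × Fin n
normalise (u , v) with u <? v
... | yes _ = u , v
... | no _  = v , u

normalise-injective : ∀ (p q : Fin n × Fin n) → normalise p ≡ normalise q → p ≡ q ⊎ p ≡ swap q
normalise-injective (u , v) (x , y) eq with u <? v | x <? y
... | yes _ | yes _ = inj₁ eq
... | yes _ | no _  = inj₂ eq
... | no _  | yes _ = inj₂ (cong swap eq)
... | no _  | no _  = inj₁ (cong swap eq)

module _ {n : ℕ} (G : Graph n) where

  ∈-edges⁺ : ∀ {u v} → u Fin.< v → Adj G u v → (u , v) ∈ edges G
  ∈-edges⁺ {u} {v} u<v uv = ∈-filter⁺ (λ (u , v) → (u <? v) ×-dec (v Subset.∈? N G u))
    (∈-cartesianProduct⁺ (∈-allFin u) (∈-allFin v)) (u<v , uv)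

  ∈-edges⁻ : ∀ {u v} → (u , v) ∈ edges G → u Fin.< v × Adj G u v
  ∈-edges⁻ uv∈ = proj₂ (∈-filter⁻ (λ (u , v) → (u <? v) ×-dec (v Subset.∈? N G u))
    {xs = cartesianProduct (allFin n) (allFin n)} uv∈)

  edges-unique : Unique (edges G)
  edges-unique = Unique.filter⁺ _ (Unique.cartesianProduct⁺ (Unique.allFin⁺ n) (Unique.allFin⁺ n))

  normalise-∈ : ∀ {u v} → Adj G u v → normalise (u , v) ∈ edges G
  normalise-∈ {u} {v} uv with u <? v
  ... | yes u<v = ∈-edges⁺ u<v uv
  ... | no u≮v with Fin.<-cmp u v
  ...   | tri< u<v _ _  = contradiction u<v u≮v
  ...   | tri≈ _ refl _ = contradiction uv (Graph.irrefl G)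
  ...   | tri> _ _ v<u  = ∈-edges⁺ v<u (Graph.sym G uv)

  -- The size counts pairs in increasing order, whereas links follow the circuits. Normalising the
  -- direction is injective on a list that contains no pair together with its reverse.
  length≤size : ∀ {es} → Unique es → (∀ {p} → p ∈ es → swap p ∉ es) →
                (∀ {u v} → (u , v) ∈ es → Adj G u v) → length es ≤ size G
  length≤size {es} uniq antisym adj = ≤-trans (≤-reflexive (sym (length-map normalise es)))
    (Unique-⊆⇒length≤ (Unique-map normalise injective uniq) λ p∈ →
      let (u , v) , uv∈ , eq = ∈-map⁻ normalise p∈ in
      subst (_∈ edges G) (sym eq) (normalise-∈ (adj uv∈)))
    where
    injective : ∀ {p q} → p ∈ es → q ∈ es → normalise p ≡ normalise q → p ≡ q
    injective {p} {q} p∈ q∈ eq with normalise-injective p q eq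
    ... | inj₁ p≡q  = p≡q
    ... | inj₂ refl = contradiction p∈ (antisym q∈)

-- Permutation graphs

crossing? : (f : A → Bool) → Decidable (λ ((u , v) : A × A) → f u ≢ f v)
crossing? f (u , v) = ¬? (f u Bool.≟ f v)

crossings : (A → Bool) → List (A × A) → List (A × A)
crossings f = filter (crossing? f)

length-crossings-walk : ∀ (f : A → Bool) x ys → length (crossings f (walk x ys)) ≡ steps f x ys
length-crossings-walk f x []       = refl
length-crossings-walk f x (y ∷ ys) with f x | f y | length-crossings-walk f y ys
... | false | false | eq = eq
... | false | true  | eq = cong suc eq
... | true  | false | eq = cong suc eq
... | true  | true  | eq = eq

length-crossings : ∀ (f : A → Bool) ws → length (crossings f (links ws)) ≡ turns f ws
length-crossings f []       = refl
length-crossings f (x ∷ xs) = length-crossings-walk f x (xs ∷ʳ x)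

Constant : (A → Bool) → Bool → List A → Set
Constant f b = All λ u → f u ≡ b

steps-≡0 : ∀ (f : A → Bool) x ys → steps f x ys ≡ 0 → Constant f (f x) ys
steps-≡0 f x []       eq = []
steps-≡0 f x (y ∷ ys) eq with f x in fx | f y in fy | eq
... | false | false | eq′ = fy ∷ subst (λ b → Constant f b ys) fy (steps-≡0 f y ys eq′)
... | true  | true  | eq′ = fy ∷ subst (λ b → Constant f b ys) fy (steps-≡0 f y ys eq′)

-- Only the part of the parity argument that is used later: equal end values exclude a single
-- change, unequal ones exclude none.
steps-parity : ∀ (f : A → Bool) x ys z →
               (f x ≡ f z → steps f x (ys ∷ʳ z) ≡ 0 ⊎ 2 ≤ steps f x (ys ∷ʳ z)) ×
               (f x ≢ f z → 1 ≤ steps f x (ys ∷ʳ z))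
steps-parity f x [] z with f x | f z
... | false | false = (λ _ → inj₁ refl) , λ n → contradiction refl n
... | false | true  = (λ ()) , λ _ → s≤s z≤n
... | true  | false = (λ ()) , λ _ → s≤s z≤n
... | true  | true  = (λ _ → inj₁ refl) , λ n → contradiction refl n
steps-parity f x (y ∷ ys) z with f x | f y | f z | steps-parity f y ys z
... | false | false | _     | ih      = ih
... | true  | true  | _     | ih      = ih
... | false | true  | false | _ , ih₂ = (λ _ → inj₂ (s≤s (ih₂ λ ()))) , λ n → contradiction refl n
... | false | true  | true  | _       = (λ ()) , λ _ → s≤s z≤n
... | true  | false | true  | _ , ih₂ = (λ _ → inj₂ (s≤s (ih₂ λ ()))) , λ n → contradiction refl n
... | true  | false | false | _       = (λ ()) , λ _ → s≤s z≤n

constant-or-turns : ∀ (f : A → Bool) x xs → Constant f (f x) (x ∷ xs) ⊎ 2 ≤ turns f (x ∷ xs)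
constant-or-turns f x xs with proj₁ (steps-parity f x xs x) refl
... | inj₁ eq = inj₁ (refl ∷ All.++⁻ˡ xs (steps-≡0 f x (xs ∷ʳ x) eq))
... | inj₂ le = inj₂ le

at-most-one-false : ∀ (f : A → Bool) {xs} → Unique xs →
                    (∀ u v → u ∈ xs → v ∈ xs → f u ≡ false → f v ≡ false → u ≡ v) →
                    length xs ≤ suc (length (filter (λ u → f u Bool.≟ true) xs))
at-most-one-false f []                one = z≤n
at-most-one-false f {x ∷ xs} (x∉ ∷ u) one with f x in fx
... | true  = s≤s (at-most-one-false f u λ y z y∈ z∈ → one y z (there y∈) (there z∈))
... | false = s≤s (≤-reflexive (sym (cong length (filter-all (λ u → f u Bool.≟ true) all-true))))
  where
  all-true : Constant f true xs
  all-true = All.tabulate λ {y} y∈ → ¬-not λ fy →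
    All.lookup x∉ y∈ (one x y (here refl) (there y∈) fx fy)

both-two : ∀ {a b k} → 2 ≤ a → 2 ≤ b → a + (b + k) ≤ 4 → a ≤ 2 × b ≤ 2 × k ≡ 0
both-two {suc (suc zero)} {suc (suc zero)} {zero} _ _ _ = ≤-refl , ≤-refl , refl
both-two {suc (suc zero)} {suc (suc zero)} {suc k} _ _ (s≤s (s≤s (s≤s (s≤s ()))))
both-two {suc (suc zero)} {suc (suc (suc b))} _ _ (s≤s (s≤s (s≤s (s≤s ()))))
both-two {suc (suc (suc zero))} {suc (suc b)} _ _ (s≤s (s≤s (s≤s (s≤s ()))))
both-two {suc (suc (suc (suc a)))} {suc (suc b)} _ (s≤s (s≤s _)) (s≤s (s≤s (s≤s (s≤s le)))) =
  contradiction (≤-trans (m≤n+m _ a) le) λ ()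
both-two {suc zero} (s≤s ()) _ _
both-two {_} {suc zero} _ (s≤s ()) _

not≢ : ∀ b → b ≢ not b
not≢ false ()
not≢ true  ()

record ExactlyTwo {k : ℕ} (P : Fin k → Set) : Set where
  field
    i j  : Fin k
    i≢j  : i ≢ j
    Pi   : P i
    Pj   : P j
    only : ∀ l → P l → l ≡ i ⊎ l ≡ j

module _ {A : Set} {P : A → Set} (P? : Decidable P) where

  none : ∀ xs → length (filter P? xs) ≡ 0 → ∀ i → ¬ P (List.lookup xs i)
  none (x ∷ xs) eq i       pi with P? x
  none (x ∷ xs) () i       pi | yes _
  none (x ∷ xs) eq zero    pi | no ¬px = ¬px pi
  none (x ∷ xs) eq (suc i) pi | no _   = none xs eq i pi

  exactly-one : ∀ xs → length (filter P? xs) ≡ 1 →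
                ∃[ i ] P (List.lookup xs i) × (∀ j → P (List.lookup xs j) → j ≡ i)
  exactly-one (x ∷ xs) eq with P? x
  ... | yes px = zero , px , λ where
    zero    _  → refl
    (suc j) pj → contradiction pj (none xs (ℕ.suc-injective eq) j)
  ... | no ¬px with exactly-one xs eq
  ...   | i , pi , only = suc i , pi , λ where
    zero    pj → contradiction pj ¬px
    (suc j) pj → cong suc (only j pj)

  exactly-two : ∀ xs → length (filter P? xs) ≡ 2 → ExactlyTwo (P ∘ List.lookup xs)
  exactly-two (x ∷ xs) eq with P? x
  ... | yes px with exactly-one xs (ℕ.suc-injective eq)
  ...   | i , pi , only = record
    { i = zero ; j = suc i ; i≢j = λ () ; Pi = px ; Pj = pi
    ; only = λ { zero _ → inj₁ refl ; (suc l) pl → inj₂ (cong suc (only l pl)) } }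
  exactly-two (x ∷ xs) eq | no ¬px with exactly-two xs eq
  ... | two = record
    { i = suc i ; j = suc j ; i≢j = i≢j ∘ Fin.suc-injective ; Pi = Pi ; Pj = Pj
    ; only = λ { zero px → contradiction px ¬px ; (suc l) pl → Sum.map (cong suc) (cong suc) (only l pl) } }
    where open ExactlyTwo two

module _ {k : ℕ} {P : Fin k → Set} (two : ExactlyTwo P) where
  open ExactlyTwo two

  ExactlyTwo-third : ∀ {m l l′} → P m → P l → P l′ → m ≢ l → m ≢ l′ → l ≡ l′
  ExactlyTwo-third {m} {l} {l′} pm pl pl′ m≢l m≢l′ with only m pm | only l pl | only l′ pl′
  ... | inj₁ refl | inj₁ refl | _         = contradiction refl m≢l
  ... | inj₁ refl | _         | inj₁ refl = contradiction refl m≢l′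
  ... | inj₂ refl | inj₂ refl | _         = contradiction refl m≢l
  ... | inj₂ refl | _         | inj₂ refl = contradiction refl m≢l′
  ... | _         | inj₁ refl | inj₁ refl = refl
  ... | _         | inj₂ refl | inj₂ refl = refl

  ExactlyTwo-pairs : ∀ {a b a′ b′} → P a → P b → a ≢ b → P a′ → P b′ → a′ ≢ b′ →
                     (a ≡ a′ × b ≡ b′) ⊎ (a ≡ b′ × b ≡ a′)
  ExactlyTwo-pairs {a} {b} {a′} {b′} pa pb a≢b pa′ pb′ a′≢b′ with a Fin.≟ a′
  ... | yes refl = inj₁ (refl , ExactlyTwo-third pa pb pb′ a≢b a′≢b′)
  ... | no a≢a′  = inj₂ (ExactlyTwo-third pa′ pa pb′ (a≢a′ ∘ sym) a′≢b′ , ExactlyTwo-third pa pb pa′ a≢b a≢a′)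

-- Each of the two pairs consists of the colours other than `r`.
two-remaining-colours : ∀ (a b a′ b′ r : Fin 3) → a ≢ b → a ≢ r → b ≢ r → a′ ≢ b′ → a′ ≢ r → b′ ≢ r →
                        (a ≡ a′ × b ≡ b′) ⊎ (a ≡ b′ × b ≡ a′)
two-remaining-colours = toWitness {a? = all? λ a → all? λ b → all? λ a′ → all? λ b′ → all? λ r →
  ¬? (a Fin.≟ b) →-dec ¬? (a Fin.≟ r) →-dec ¬? (b Fin.≟ r) →-dec
  ¬? (a′ Fin.≟ b′) →-dec ¬? (a′ Fin.≟ r) →-dec ¬? (b′ Fin.≟ r) →-dec
  (((a Fin.≟ a′) ×-dec (b Fin.≟ b′)) ⊎-dec ((a Fin.≟ b′) ×-dec (b Fin.≟ a′)))} _

-- The complement of ring contains ring′, so the boundary of ring is a cyclic edge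
-- cut with five edges.

record Skeleton (n : ℕ) : Set where
  field
    twin            : Fin n → Fin n
    z₀ z₁ z₂ z₃ y y′ x₂ : Fin n
    xs₁ xs₂         : List (Fin n)

  ws₁ ws₂ : List (Fin n)
  ws₁ = z₀ ∷ z₁ ∷ z₂ ∷ z₃ ∷ xs₁
  ws₂ = twin z₀ ∷ y ∷ twin z₁ ∷ x₂ ∷ xs₂

  ring ring′ : List (Fin n)
  ring  = z₀ ∷ z₁ ∷ twin z₁ ∷ y ∷ twin z₀ ∷ []
  ring′ = z₂ ∷ z₃ ∷ twin z₃ ∷ y′ ∷ twin z₂ ∷ []

record Prism (n : ℕ) : Set₁ where
  field
    skeleton        : Skeleton n

  open Skeleton skeleton public

  field
    unique₁         : Unique ws₁
    unique₂         : Unique ws₂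
    disjoint        : ∀ {u} → u ∈ ws₁ → u ∉ ws₂
    cover           : ∀ u → u ∈ ws₁ ⊎ u ∈ ws₂
    twin-involutive : ∀ u → twin (twin u) ≡ u
    twin₁           : ∀ {u} → u ∈ ws₁ → twin u ∈ ws₂
    twin₂           : ∀ {u} → u ∈ ws₂ → twin u ∈ ws₁
    long₁           : 6 ≤ length ws₁
    long₂           : 5 ≤ length ws₂
    rings-unique    : Unique (ring ++ ring′)
    link-y′         : (twin z₂ , y′) ∈ links ws₂
    y′-link         : (y′ , twin z₃) ∈ links ws₂
    simple          : ∀ f → (∀ u → f (twin u) ≡ f u) → turns f ws₁ ≤ 2 → turns f ws₂ ≤ 2 →
                      ∃[ c ] (∀ u v → u ∈ ws₁ → v ∈ ws₁ → f u ≡ c → f v ≡ c → u ≡ v)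
    unlabelled      : ∀ {L : Set} → DecidableEquality L → (left right : Fin n → L) →
                      (∀ {u v} → (u , v) ∈ links ws₁ → right u ≡ left v) →
                      (∀ {u v} → (u , v) ∈ links ws₂ → right u ≡ left v) →
                      ¬ (∀ u → Match (left u) (right u) (left (twin u)) (right (twin u)))

-- The permutation graph and its 2-factor

module PrismGraph {n : ℕ} (prism : Prism n) where
  open Prism prism

  3≤₁ : 3 ≤ length ws₁
  3≤₁ = s≤s (s≤s (s≤s z≤n))

  3≤₂ : 3 ≤ length ws₂
  3≤₂ = s≤s (s≤s (s≤s z≤n))

  twin-∉₁ : ∀ {u} → u ∈ ws₁ → twin u ∉ ws₁
  twin-∉₁ u∈ t∈ = disjoint t∈ (twin₁ u∈)

  twin≢ : ∀ {u} → twin u ≢ u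
  twin≢ {u} eq with cover u
  ... | inj₁ u∈ = twin-∉₁ u∈ (subst (_∈ ws₁) (sym eq) u∈)
  ... | inj₂ u∈ = disjoint (subst (_∈ ws₁) eq (twin₂ u∈)) u∈

  Rung : Fin n → Fin n → Set
  Rung u v = twin u ≡ v

  Edge : Fin n → Fin n → Set
  Edge u v = Link ws₁ u v ⊎ Link ws₂ u v ⊎ Rung u v

  edge-sym : ∀ {u v} → Edge u v → Edge v u
  edge-sym (inj₁ l)                = inj₁ (Link-sym {ws = ws₁} l)
  edge-sym (inj₂ (inj₁ l))         = inj₂ (inj₁ (Link-sym {ws = ws₂} l))
  edge-sym (inj₂ (inj₂ refl))      = inj₂ (inj₂ (twin-involutive _))

  edge-irrefl : ∀ {u} → ¬ Edge u u
  edge-irrefl (inj₁ l)        = Link-irrefl unique₁ 3≤₁ l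
  edge-irrefl (inj₂ (inj₁ l)) = Link-irrefl unique₂ 3≤₂ l
  edge-irrefl (inj₂ (inj₂ r)) = twin≢ r

  edge? : ∀ u v → Dec (Edge u v)
  edge? u v = Link? ws₁ u v ⊎-dec Link? ws₂ u v ⊎-dec (twin u Fin.≟ v)

  G-presentation : Presentation n
  G-presentation = record
    { Vertex      = λ u → u ∈ ws₁ ⊎ u ∈ ws₂
    ; Edge        = Edge
    ; vertex?     = λ u → (u ∈?ᴸ ws₁) ⊎-dec (u ∈?ᴸ ws₂)
    ; edge?       = edge?
    ; edge-vertex = λ {u} {v} _ → cover v
    ; edge-sym    = edge-sym
    ; edge-irrefl = edge-irrefl
    }

  module G = Presentation G-presentation
  G : Graph n
  G = G.graph

  module C₁ = Cycle unique₁ 3≤₁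
  module C₂ = Cycle unique₂ 3≤₂
  C₁ C₂ : Graph n
  C₁ = C₁.cycle
  C₂ = C₂.cycle

  ∈G : ∀ u → u ∈ˢ V G
  ∈G u = G.V⁺ (cover u)

  Link⇒∈ : ∀ {ws : List (Fin n)} {u v} → Link ws u v → u ∈ ws
  Link⇒∈ {ws} = Link-∈ ∘ Link-sym {ws = ws}

  chordless₁ : ∀ {u v} → u ∈ ws₁ → v ∈ ws₁ → Edge u v → Link ws₁ u v
  chordless₁ u∈ v∈ (inj₁ l)           = l
  chordless₁ u∈ v∈ (inj₂ (inj₁ l))    = contradiction (Link-∈ l) (disjoint v∈)
  chordless₁ u∈ v∈ (inj₂ (inj₂ refl)) = contradiction v∈ (twin-∉₁ u∈)

  chordless₂ : ∀ {u v} → u ∈ ws₂ → v ∈ ws₂ → Edge u v → Link ws₂ u v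
  chordless₂ u∈ v∈ (inj₁ l)           = contradiction v∈ (disjoint (Link-∈ l))
  chordless₂ u∈ v∈ (inj₂ (inj₁ l))    = l
  chordless₂ u∈ v∈ (inj₂ (inj₂ refl)) = contradiction v∈ (disjoint (twin₂ u∈))

  RingEdge : Fin n → Fin n → Set
  RingEdge u v = Link ws₁ u v ⊎ Link ws₂ u v

  RingEdge⇒Edge : ∀ {u v} → RingEdge u v → Edge u v
  RingEdge⇒Edge = Sum.map₂ inj₁

  record Local (u : Fin n) : Set where
    field
      pred succ : Fin n
      pred-ring : RingEdge u pred
      succ-ring : RingEdge u succ
      before    : ∀ {v} → (v , u) ∈ links ws₁ ⊎ (v , u) ∈ links ws₂ → v ≡ pred
      after     : ∀ {v} → (u , v) ∈ links ws₁ ⊎ (u , v) ∈ links ws₂ → v ≡ succ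
      pred≢succ : pred ≢ succ
      pred≢twin : pred ≢ twin u
      succ≢twin : succ ≢ twin u
      only      : ∀ {v} → Edge u v → v ∈ pred ∷ succ ∷ twin u ∷ []

    pred-edge : Edge u pred
    pred-edge = RingEdge⇒Edge pred-ring

    succ-edge : Edge u succ
    succ-edge = RingEdge⇒Edge succ-ring

  local : ∀ u → Local u
  local u with cover u
  ... | inj₁ u∈ = record
    { pred = pred ; succ = succ
    ; pred-ring = inj₁ (inj₂ pred-link)
    ; succ-ring = inj₁ (inj₁ succ-link)
    ; before = [ only-pred , (λ vu → contradiction (links-target ws₂ vu) (disjoint u∈)) ]′
    ; after  = [ only-succ , (λ uv → contradiction (links-source ws₂ uv) (disjoint u∈)) ]′
    ; pred≢succ = pred≢succ
    ; pred≢twin = λ eq → disjoint (links-source ws₁ pred-link) (subst (_∈ ws₂) (sym eq) (twin₁ u∈))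
    ; succ≢twin = λ eq → disjoint (links-target ws₁ succ-link) (subst (_∈ ws₂) (sym eq) (twin₁ u∈))
    ; only = λ { (inj₁ l) → ∈-++⁺ˡ {xs = pred ∷ succ ∷ []} (∈-pair (Sum.swap (Link-neighbours unique₁ 3≤₁ u∈ l)))
               ; (inj₂ (inj₁ l)) → contradiction (Link⇒∈ {ws₂} l) (disjoint u∈)
               ; (inj₂ (inj₂ r)) → there (there (here (sym r))) } }
    where open Neighbours (neighbours unique₁ 3≤₁ u∈)
  ... | inj₂ u∈ = record
    { pred = pred ; succ = succ
    ; pred-ring = inj₂ (inj₂ pred-link)
    ; succ-ring = inj₂ (inj₁ succ-link)
    ; before = [ (λ vu → contradiction u∈ (disjoint (links-target ws₁ vu))) , only-pred ]′
    ; after  = [ (λ uv → contradiction u∈ (disjoint (links-source ws₁ uv))) , only-succ ]′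
    ; pred≢succ = pred≢succ
    ; pred≢twin = λ eq → disjoint (twin₂ u∈) (subst (_∈ ws₂) eq (links-source ws₂ pred-link))
    ; succ≢twin = λ eq → disjoint (twin₂ u∈) (subst (_∈ ws₂) eq (links-target ws₂ succ-link))
    ; only = λ { (inj₁ l) → contradiction u∈ (disjoint (Link⇒∈ {ws₁} l))
               ; (inj₂ (inj₁ l)) → ∈-++⁺ˡ {xs = pred ∷ succ ∷ []} (∈-pair (Sum.swap (Link-neighbours unique₂ 3≤₂ u∈ l)))
               ; (inj₂ (inj₂ r)) → there (there (here (sym r))) } }
    where open Neighbours (neighbours unique₂ 3≤₂ u∈)

  cubic : Cubic G
  cubic {u} _ = ∣∣≡length {xs = pred ∷ succ ∷ twin u ∷ []}
    ((pred≢succ ∷ pred≢twin ∷ []) ∷ (succ≢twin ∷ []) ∷ [] ∷ [])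
    (λ { (here refl) → G.N⁺ pred-edge ; (there (here refl)) → G.N⁺ succ-edge
       ; (there (there (here refl))) → G.N⁺ (inj₂ (inj₂ refl)) })
    (only ∘ G.N⁻)
    where open Local (local u)

  C₁⊆G : C₁ ⊆ᴳ G
  C₁⊆G = (G.V⁺ ∘ inj₁ ∘ C₁.V⁻) , λ u → G.N⁺ ∘ inj₁ ∘ C₁.N⁻

  C₂⊆G : C₂ ⊆ᴳ G
  C₂⊆G = (G.V⁺ ∘ inj₂ ∘ C₂.V⁻) , λ u → G.N⁺ ∘ inj₂ ∘ inj₁ ∘ C₂.N⁻

  C₁C₂-disjoint : Disjoint C₁ C₂
  C₁C₂-disjoint (u , u∈) = let u∈₁ , u∈₂ = x∈p∩q⁻ (V C₁) (V C₂) u∈ in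
    disjoint (C₁.V⁻ u∈₁) (C₂.V⁻ u∈₂)

  C₁∪C₂-regular : Regular 2 (C₁ ∪ᴳ C₂)
  C₁∪C₂-regular {u} _ with cover u
  ... | inj₁ u∈ = trans (cong ∣_∣ (⊆-antisym
          (λ v∈ → [ id , (λ v∈₂ → contradiction (Link⇒∈ {ws₂} (C₂.N⁻ v∈₂)) (disjoint u∈)) ]′ (x∈p∪q⁻ (N C₁ u) (N C₂ u) v∈))
          (p⊆p∪q (N C₂ u)))) (C₁.cycle-regular (C₁.V⁺ u∈))
  ... | inj₂ u∈ = trans (cong ∣_∣ (⊆-antisym
          (λ v∈ → [ (λ v∈₁ → contradiction u∈ (disjoint (Link⇒∈ {ws₁} (C₁.N⁻ v∈₁)))) , id ]′ (x∈p∪q⁻ (N C₁ u) (N C₂ u) v∈))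
          (q⊆p∪q (N C₁ u) (N C₂ u)))) (C₂.cycle-regular (C₂.V⁺ u∈))

  two-factor : TwoFactor G (C₁ ∪ᴳ C₂)
  two-factor =
    ( [ proj₁ C₁⊆G , proj₁ C₂⊆G ]′ ∘ x∈p∪q⁻ (V C₁) (V C₂)
    , λ u → [ proj₂ C₁⊆G u , proj₂ C₂⊆G u ]′ ∘ x∈p∪q⁻ (N C₁ u) (N C₂ u)) ,
    ⊆-antisym ([ proj₁ C₁⊆G , proj₁ C₂⊆G ]′ ∘ x∈p∪q⁻ (V C₁) (V C₂))
      (x∈p∪q⁺ ∘ Sum.map C₁.V⁺ C₂.V⁺ ∘ G.V⁻) ,
    C₁∪C₂-regular

  cycle-permutation-with : CyclePermutationWith G C₁ C₂
  cycle-permutation-with =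
    cubic , (C₁⊆G , C₁.cycle-circuit) , (C₂⊆G , C₂.cycle-circuit) , C₁C₂-disjoint , two-factor ,
    (λ u∈ v∈ uv → C₁.N⁺ (chordless₁ (C₁.V⁻ u∈) (C₁.V⁻ v∈) (G.N⁻ uv))) ,
    (λ u∈ v∈ uv → C₂.N⁺ (chordless₂ (C₂.V⁻ u∈) (C₂.V⁻ v∈) (G.N⁻ uv)))

  -- Edge boundaries of vertex sets

  rungs allEdges : List (Fin n × Fin n)
  rungs    = map (λ u → u , twin u) ws₁
  allEdges = links ws₁ ++ links ws₂ ++ rungs

  ∈-rungs⁻ : ∀ {p} → p ∈ rungs → proj₁ p ∈ ws₁ × proj₂ p ∈ ws₂
  ∈-rungs⁻ p∈ with ∈-map⁻ (λ u → u , twin u) p∈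
  ... | u , u∈ , refl = u∈ , twin₁ u∈

  allEdges-unique : Unique allEdges
  allEdges-unique = Unique.++⁺ (links-unique unique₁)
    (Unique.++⁺ (links-unique unique₂) (Unique.map⁺ (cong proj₁) unique₁)
      λ (p∈ , q∈) → disjoint (proj₁ (∈-rungs⁻ q∈)) (links-source ws₂ p∈))
    λ (p∈ , q∈) → [ (λ q∈ → disjoint (links-source ws₁ p∈) (links-source ws₂ q∈))
                  , (λ q∈ → disjoint (links-target ws₁ p∈) (proj₂ (∈-rungs⁻ q∈))) ]′ (∈-++⁻ (links ws₂) q∈)

  ∈-allEdges⁻ : ∀ {p} → p ∈ allEdges → p ∈ links ws₁ ⊎ p ∈ links ws₂ ⊎ p ∈ rungs
  ∈-allEdges⁻ = Sum.map id (∈-++⁻ (links ws₂)) ∘ ∈-++⁻ (links ws₁)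

  allEdges-antisym : ∀ {p} → p ∈ allEdges → swap p ∉ allEdges
  allEdges-antisym p∈ q∈ with ∈-allEdges⁻ p∈ | ∈-allEdges⁻ q∈
  ... | inj₁ p∈        | inj₁ q∈        = links-antisym unique₁ 3≤₁ p∈ q∈
  ... | inj₁ p∈        | inj₂ (inj₁ q∈) = disjoint (links-source ws₁ p∈) (links-target ws₂ q∈)
  ... | inj₁ p∈        | inj₂ (inj₂ q∈) = disjoint (links-source ws₁ p∈) (proj₂ (∈-rungs⁻ q∈))
  ... | inj₂ (inj₁ p∈) | inj₁ q∈        = disjoint (links-source ws₁ q∈) (links-target ws₂ p∈)
  ... | inj₂ (inj₁ p∈) | inj₂ (inj₁ q∈) = links-antisym unique₂ 3≤₂ p∈ q∈
  ... | inj₂ (inj₁ p∈) | inj₂ (inj₂ q∈) = disjoint (proj₁ (∈-rungs⁻ q∈)) (links-target ws₂ p∈)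
  ... | inj₂ (inj₂ p∈) | inj₁ q∈        = disjoint (links-source ws₁ q∈) (proj₂ (∈-rungs⁻ p∈))
  ... | inj₂ (inj₂ p∈) | inj₂ (inj₁ q∈) = disjoint (proj₁ (∈-rungs⁻ p∈)) (links-target ws₂ q∈)
  ... | inj₂ (inj₂ p∈) | inj₂ (inj₂ q∈) = disjoint (proj₁ (∈-rungs⁻ p∈)) (proj₂ (∈-rungs⁻ q∈))

  allEdges-edge : ∀ {u v} → (u , v) ∈ allEdges → Edge u v
  allEdges-edge p∈ with ∈-allEdges⁻ p∈
  ... | inj₁ p∈        = inj₁ (inj₁ p∈)
  ... | inj₂ (inj₁ p∈) = inj₂ (inj₁ (inj₁ p∈))
  ... | inj₂ (inj₂ p∈) with ∈-map⁻ (λ u → u , twin u) p∈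
  ...   | u , _ , refl = inj₂ (inj₂ refl)

  boundary : (Fin n → Bool) → ℕ
  boundary f = turns f ws₁ + (turns f ws₂ + length (crossings f rungs))

  boundary-length : ∀ f → length (crossings f allEdges) ≡ boundary f
  boundary-length f = begin
    length (crossings f allEdges)
      ≡⟨ cong length (filter-++ (crossing? f) (links ws₁) _) ⟩
    length (crossings f (links ws₁) ++ crossings f (links ws₂ ++ rungs))
      ≡⟨ length-++ (crossings f (links ws₁)) ⟩
    length (crossings f (links ws₁)) + length (crossings f (links ws₂ ++ rungs))
      ≡⟨ cong₂ _+_ (length-crossings f ws₁) (trans (cong length (filter-++ (crossing? f) (links ws₂) rungs))
           (trans (length-++ (crossings f (links ws₂))) (cong (_+ length (crossings f rungs)) (length-crossings f ws₂)))) ⟩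
    boundary f ∎
    where open ≡-Reasoning

  boundary≤size : ∀ f (F : Graph n) → (∀ {u v} → Edge u v → f u ≢ f v → Adj F u v) →
                  boundary f ≤ size F
  boundary≤size f F cut = ≤-trans (≤-reflexive (sym (boundary-length f)))
    (length≤size F (Unique.filter⁺ (crossing? f) allEdges-unique)
      (λ p∈ q∈ → allEdges-antisym (proj₁ (∈-filter⁻ (crossing? f) p∈)) (proj₁ (∈-filter⁻ (crossing? f) q∈)))
      (λ p∈ → let p∈ , fp = ∈-filter⁻ (crossing? f) {xs = allEdges} p∈ in cut (allEdges-edge p∈) fp))

  -- The three shapes of a side without circuits. In the first two, the vertex `w` on the opposite
  -- side keeps the set from being an entire circuit of the 2-factor.
  data Small (f : Fin n → Bool) (c : Bool) : Set where
    inside₁ : ∀ {w} → w ∈ ws₁ → f w ≢ c → (∀ u → f u ≡ c → u ∈ ws₁) → Small f c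
    inside₂ : ∀ {w} → w ∈ ws₂ → f w ≢ c → (∀ u → f u ≡ c → u ∈ ws₂) → Small f c
    one-rung : (∀ u → f (twin u) ≡ f u) →
               (∀ u v → u ∈ ws₁ → v ∈ ws₁ → f u ≡ c → f v ≡ c → u ≡ v) → Small f c

  all-cut : ∀ f → (∀ {u} → u ∈ ws₁ → f u ≢ f (twin u)) → length (crossings f rungs) ≡ length ws₁
  all-cut f cut = trans (cong length (filter-all (crossing? f) (All.map⁺ (All.tabulate cut))))
    (length-map (λ u → u , twin u) ws₁)

  -- If `f` is constant on one circuit, then either some vertex of the other circuit agrees with
  -- that constant, and the opposite value lives inside that other circuit, or every rung is cut,
  -- which gives at least six edges. Otherwise each circuit is cut at least twice; the bound four
  -- then leaves exactly two cuts on each and no cut rung, so the words being simple applies.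
  small : ∀ f → boundary f ≤ 4 → ∃[ c ] Small f c
  small f le with constant-or-turns f z₀ (z₁ ∷ z₂ ∷ z₃ ∷ xs₁)
                | constant-or-turns f (twin z₀) (y ∷ twin z₁ ∷ x₂ ∷ xs₂)
  ... | inj₁ const | _ with any? (λ u → f (twin u) Bool.≟ f z₀) ws₁
  ...   | yes some = let u , u∈ , fu = find some in
          not (f z₀) , inside₂ (twin₁ u∈) (λ e → not≢ (f z₀) (trans (sym fu) e))
            λ v fv → [ (λ v∈ → contradiction (trans (sym (All.lookup const v∈)) fv) (not≢ (f z₀))) , id ]′ (cover v)
  ...   | no none = contradiction (≤-trans long₁ (≤-trans (≤-reflexive (sym (all-cut f λ u∈ e →
          none (lose u∈ (trans (sym e) (All.lookup const u∈))))))
          (≤-trans (≤-trans (m≤n+m _ (turns f ws₂)) (m≤n+m _ (turns f ws₁))) le))) λ { (s≤s (s≤s (s≤s (s≤s ())))) }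
  small f le | inj₂ _ | inj₁ const with any? (λ u → f u Bool.≟ f (twin z₀)) ws₁
  ...   | yes some = let u , u∈ , fu = find some in
          not (f (twin z₀)) , inside₁ u∈ (λ e → not≢ (f (twin z₀)) (trans (sym fu) e))
            λ v fv → [ id , (λ v∈ → contradiction (trans (sym (All.lookup const v∈)) fv) (not≢ (f (twin z₀)))) ]′ (cover v)
  ...   | no none = contradiction (≤-trans long₁ (≤-trans (≤-reflexive (sym (all-cut f λ u∈ e →
          none (lose u∈ (trans e (All.lookup const (twin₁ u∈)))))))
          (≤-trans (≤-trans (m≤n+m _ (turns f ws₂)) (m≤n+m _ (turns f ws₁))) le))) λ { (s≤s (s≤s (s≤s (s≤s ())))) }
  small f le | inj₂ t₁ | inj₂ t₂ =
    let t₁≤ , t₂≤ , none = both-two t₁ t₂ le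
        c , one = simple f (twin-invariant none) t₁≤ t₂≤
    in c , one-rung (twin-invariant none) one
    where
    uncut : length (crossings f rungs) ≡ 0 → ∀ {u} → u ∈ ws₁ → f (twin u) ≡ f u
    uncut none {u} u∈ with f u Bool.≟ f (twin u)
    ... | yes e = sym e
    ... | no fu≢ with crossings f rungs
                    | ∈-filter⁺ (crossing? f) (∈-map⁺ (λ u → u , twin u) u∈) fu≢
                    | none
    ...   | [] | () | _

    twin-invariant : length (crossings f rungs) ≡ 0 → ∀ u → f (twin u) ≡ f u
    twin-invariant none u with cover u
    ... | inj₁ u∈ = uncut none u∈
    ... | inj₂ u∈ = trans (sym (uncut none (twin₂ u∈))) (cong f (twin-involutive u))

  -- Chordlessness leaves a vertex of `C` only its two neighbours along `ws`, and degree two forces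
  -- both into `C`. The vertex set of `C` is therefore closed under successors.
  circuit-in-ring : ∀ {ws} (uniq : Unique ws) (3≤ : 3 ≤ length ws) →
                    (∀ {u v} → u ∈ ws → v ∈ ws → Edge u v → Link ws u v) →
                    ∀ {C} → CircuitOf G C → (∀ {u} → u ∈ˢ V C → u ∈ ws) → ∀ {w} → w ∈ ws → w ∈ˢ V C
  circuit-in-ring {ws} uniq 3≤ chordless {C} (C⊆G , reg , _ , ((u , u∈) , _) , _) C⊆ w∈
    with ∈-∃++ (C⊆ u∈)
  ... | as , bs , refl = Star-closed (_∈ˢ V C) closed
          (walk-reach u ((bs ++ as) ∷ʳ u) (∈-resp-↭ (↭-sym (links-rotate as (u ∷ bs))))
            (∈-++⁺ˡ (∈-resp-↭ (++-comm as (u ∷ bs)) w∈))) u∈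
    where
    closed : ∀ {u v} → (u , v) ∈ links ws → u ∈ˢ V C → v ∈ˢ V C
    closed {u} {v} uv u∈ with v Subset.∈? N C u
    ... | yes v∈ = Graph.N⊆V C v∈
    ... | no v∉  = contradiction
      (≤-trans (≤-reflexive (sym (reg u∈))) (∣∣≤length {p = N C u} {xs = pred ∷ []} only))
      λ { (s≤s ()) }
      where
      open Neighbours (neighbours uniq 3≤ (C⊆ u∈))
      only : ∀ {w} → w ∈ˢ N C u → w ∈ pred ∷ []
      only w∈ with chordless (C⊆ u∈) (C⊆ (Graph.N⊆V C w∈)) (G.N⁻ (proj₂ C⊆G u w∈))
      ... | inj₁ uw = contradiction (subst (_∈ˢ N C u) (trans (only-succ uw) (sym (only-succ uv))) w∈) v∉
      ... | inj₂ wu = here (only-pred wu)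

  -- A circuit inside one of the chordless circuits would be all of it and contain `w`; a single
  -- rung has only two vertices.
  no-circuit : ∀ {f c} → Small f c → ∀ {C} → CircuitOf G C → ¬ (∀ {u} → u ∈ˢ V C → f u ≡ c)
  no-circuit (inside₁ w∈ fw f⊆) {C} circ in-c =
    fw (in-c (circuit-in-ring {ws₁} unique₁ 3≤₁ chordless₁ {C} circ (f⊆ _ ∘ in-c) w∈))
  no-circuit (inside₂ w∈ fw f⊆) {C} circ in-c =
    fw (in-c (circuit-in-ring {ws₂} unique₂ 3≤₂ chordless₂ {C} circ (f⊆ _ ∘ in-c) w∈))
  no-circuit {f} {c} (one-rung inv one) {C} (_ , _ , 3≤ , ((u , u∈) , _) , _) in-c =
    contradiction (≤-trans 3≤ (∣∣≤length {p = V C} (pair (cover u)))) λ { (s≤s (s≤s ())) }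
    where
    on₁ : ∀ {r v} → r ∈ ws₁ → f r ≡ c → v ∈ˢ V C → v ∈ r ∷ twin r ∷ []
    on₁ {r} {v} r∈ fr v∈ with cover v
    ... | inj₁ v∈₁ = here (one v r v∈₁ r∈ (in-c v∈) fr)
    ... | inj₂ v∈₂ = there (here (trans (sym (twin-involutive v))
                       (cong twin (one (twin v) r (twin₂ v∈₂) r∈ (trans (inv v) (in-c v∈)) fr))))

    pair : (u∈? : u ∈ ws₁ ⊎ u ∈ ws₂) → ∀ {v} → v ∈ˢ V C →
           v ∈ [ (λ _ → u) , (λ _ → twin u) ]′ u∈? ∷ twin ([ (λ _ → u) , (λ _ → twin u) ]′ u∈?) ∷ []
    pair (inj₁ u∈₁) = on₁ u∈₁ (in-c u∈)
    pair (inj₂ u∈₂) = on₁ (twin₂ u∈₂) (trans (inv u) (in-c u∈))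

  -- The opposite side contains a whole circuit of the 2-factor, or all but one of the at least six
  -- vertices of `ws₁`.
  small-complement : ∀ {f} → Small f false → ∀ {p : Subset n} → (∀ {u} → f u ≡ true → u ∈ˢ p) → 5 ≤ ∣ p ∣
  small-complement (inside₁ _ _ f⊆) ⊆p = ≤-trans long₂ (Unique⇒length≤∣∣ unique₂ λ u∈ →
    ⊆p (¬-not λ fu → disjoint (f⊆ _ fu) u∈))
  small-complement (inside₂ _ _ f⊆) ⊆p = ≤-trans (≤-trans (n≤1+n 5) long₁) (Unique⇒length≤∣∣ unique₁ λ u∈ →
    ⊆p (¬-not λ fu → disjoint u∈ (f⊆ _ fu)))
  small-complement {f} (one-rung _ one) {p} ⊆p = ℕ.s≤s⁻¹ (≤-trans long₁
    (≤-trans (at-most-one-false f unique₁ one) (s≤s (Unique⇒length≤∣∣ {p = p}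
      (Unique.filter⁺ (λ u → f u Bool.≟ true) unique₁)
      λ u∈ → ⊆p (proj₂ (∈-filter⁻ (λ u → f u Bool.≟ true) {xs = ws₁} u∈))))))

  -- The two sides of a cut

  module _ (f : Fin n → Bool) where

    cut-presentation : Presentation n
    cut-presentation = record
      { Vertex      = λ u → u ∈ ws₁ ⊎ u ∈ ws₂
      ; Edge        = λ u v → Edge u v × f u ≢ f v
      ; vertex?     = λ u → (u ∈?ᴸ ws₁) ⊎-dec (u ∈?ᴸ ws₂)
      ; edge?       = λ u v → edge? u v ×-dec ¬? (f u Bool.≟ f v)
      ; edge-vertex = λ {u} {v} _ → cover v
      ; edge-sym    = λ (e , n) → edge-sym e , n ∘ sym
      ; edge-irrefl = λ (e , _) → edge-irrefl e
      }

    induced-presentation : Bool → Presentation n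
    induced-presentation b = record
      { Vertex      = λ u → f u ≡ b
      ; Edge        = λ u v → Edge u v × f u ≡ b × f v ≡ b
      ; vertex?     = λ u → f u Bool.≟ b
      ; edge?       = λ u v → edge? u v ×-dec (f u Bool.≟ b) ×-dec (f v Bool.≟ b)
      ; edge-vertex = λ (_ , _ , fv) → fv
      ; edge-sym    = λ (e , fu , fv) → edge-sym e , fv , fu
      ; edge-irrefl = λ (e , _) → edge-irrefl e
      }

    cut : Graph n
    cut = Presentation.graph cut-presentation

    induced : Bool → Graph n
    induced b = Presentation.graph (induced-presentation b)

    module Cut = Presentation cut-presentation
    module Induced (b : Bool) = Presentation (induced-presentation b)

    cut⊆G : cut ⊆ᴳ G
    cut⊆G = (λ _ → ∈G _) , λ u uv → G.N⁺ (proj₁ (Cut.N⁻ uv))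

    ∖cut⁻ : ∀ {u v} → Adj (G ∖ᴱ cut) u v → Edge u v × f u ≡ f v
    ∖cut⁻ {u} {v} uv with f u Bool.≟ f v
    ... | yes eq = G.N⁻ (p─q⊆p (N G u) (N cut u) uv) , eq
    ... | no ne  = contradiction (Cut.N⁺ (G.N⁻ (p─q⊆p (N G u) (N cut u) uv) , ne))
                     (x∈p─q⇒x∉q {p = N G u} uv)

    -- Without the cut edges, adjacency preserves `f`; a connected subgraph meeting this side cannot
    -- leave it.
    induced-component : ∀ b → Connected (induced b) → Component (G ∖ᴱ cut) (induced b)
    induced-component b conn@((r , r∈) , _) =
      ( (λ _ → ∈G _)
      , λ u uv → let e , fu , fv = Induced.N⁻ b uv in
          x∈p∧x∉q⇒x∈p─q (G.N⁺ e) (λ c → proj₂ (Cut.N⁻ c) (trans fu (sym fv)))) ,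
      conn ,
      λ K′ (VK′⊆ , NK′⊆) (_ , conn′) (V⊆ , _) →
        let in-b : ∀ {u} → u ∈ˢ V K′ → f u ≡ b
            in-b u∈ = Star-closed (λ u → f u ≡ b)
              (λ uv fu → trans (sym (proj₂ (∖cut⁻ (NK′⊆ _ uv)))) fu)
              (conn′ (V⊆ r∈) u∈) (Induced.V⁻ b r∈)
        in (Induced.V⁺ b ∘ in-b) ,
           λ u uv → Induced.N⁺ b (proj₁ (∖cut⁻ (NK′⊆ u uv)) ,
             in-b (Graph.N⊆V K′ (Graph.sym K′ uv)) , in-b (Graph.N⊆V K′ uv))

  -- Girth

  module _ {C : Graph n} (circ : CircuitOf G C) (f : Fin n → Bool)
           (f⇒ : ∀ {u} → f u ≡ true → u ∈ˢ V C) (f⇒¬ : ∀ {u} → f u ≡ false → u ∉ˢ V C) where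

    -- Two of the three edges at `w` belong to `C`, so only one can lead out of it.
    exit-unique : ∀ {w v v′} → w ∈ˢ V C → v ∉ˢ V C → v′ ∉ˢ V C → Edge w v → Edge w v′ → v ≡ v′
    exit-unique {w} {v} {v′} w∈ v∉ v′∉ e e′ with v Fin.≟ v′
    ... | yes eq = eq
    ... | no ne  = contradiction
      (≤-trans (≤-reflexive (cong (λ k → suc (suc k)) (sym (trans (length-elements (N C w)) (proj₁ (proj₂ circ) w∈)))))
        (≤-trans (Unique⇒length≤∣∣ {xs = v ∷ v′ ∷ elements (N C w)}
          ((ne ∷ All.tabulate (λ { u∈ refl → v∉ (Graph.N⊆V C (∈-elements⁻ u∈)) }))
            ∷ All.tabulate (λ { u∈ refl → v′∉ (Graph.N⊆V C (∈-elements⁻ u∈)) })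
            ∷ elements-unique (N C w))
          (λ { (here refl) → G.N⁺ e ; (there (here refl)) → G.N⁺ e′
             ; (there (there u∈)) → proj₂ (proj₁ circ) w (∈-elements⁻ u∈) }))
          (≤-reflexive (cubic (∈G w)))))
      λ { (s≤s (s≤s (s≤s ()))) }

    inner : Fin n × Fin n → Fin n
    inner (u , v) = if f u then u else v

    -- Sending a boundary edge to its end in `C` is injective, by `exit-unique`.
    cut-size≤order : size (cut f) ≤ order C
    cut-size≤order = ≤-trans (≤-reflexive (sym (length-map inner (edges (cut f)))))
      (Unique⇒length≤∣∣ (Unique-map inner (λ {p} {q} → injective p q) (edges-unique (cut f))) λ w∈ →
        let p , p∈ , eq = ∈-map⁻ inner w∈ in subst (_∈ˢ V C) (sym eq) (inner∈ p p∈))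
      where
      flip : ∀ {a b c} → f a ≡ c → f a ≢ f b → f b ≡ not c
      flip {a} {b} refl ne = ¬-not (ne ∘ sym)

      inner∈ : ∀ p → p ∈ edges (cut f) → inner p ∈ˢ V C
      inner∈ (u , v) p∈ = go (f u) refl
        where
        go : ∀ b → f u ≡ b → (if b then u else v) ∈ˢ V C
        go true  fu = f⇒ fu
        go false fu = f⇒ (flip fu (proj₂ (Cut.N⁻ f (proj₂ (∈-edges⁻ (cut f) p∈)))))

      injective : ∀ p q → p ∈ edges (cut f) → q ∈ edges (cut f) → inner p ≡ inner q → p ≡ q
      injective (u , v) (u′ , v′) p∈ q∈ = go (f u) (f u′) refl refl
        where
        u<v : u Fin.< v
        u<v = proj₁ (∈-edges⁻ (cut f) p∈)
        u′<v′ : u′ Fin.< v′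
        u′<v′ = proj₁ (∈-edges⁻ (cut f) q∈)
        uv : Edge u v × f u ≢ f v
        uv = Cut.N⁻ f (proj₂ (∈-edges⁻ (cut f) p∈))
        uv′ : Edge u′ v′ × f u′ ≢ f v′
        uv′ = Cut.N⁻ f (proj₂ (∈-edges⁻ (cut f) q∈))

        go : ∀ b b′ → f u ≡ b → f u′ ≡ b′ → (if b then u else v) ≡ (if b′ then u′ else v′) →
             (u , v) ≡ (u′ , v′)
        go true true fu fu′ refl = cong (u ,_)
          (exit-unique (f⇒ fu) (f⇒¬ (flip fu (proj₂ uv))) (f⇒¬ (flip fu′ (proj₂ uv′))) (proj₁ uv) (proj₁ uv′))
        go false false fu fu′ refl = cong (_, v)
          (exit-unique (f⇒ (flip fu (proj₂ uv))) (f⇒¬ fu) (f⇒¬ fu′) (edge-sym (proj₁ uv)) (edge-sym (proj₁ uv′)))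
        -- The common inner end is the smaller end of one edge and the larger end of the other. The
        -- outer ends coincide as well, which contradicts the order.
        go true false fu fu′ refl = contradiction
          (subst (Fin._< u) (sym (exit-unique (f⇒ fu) (f⇒¬ (flip fu (proj₂ uv))) (f⇒¬ fu′)
            (proj₁ uv) (edge-sym (proj₁ uv′)))) u′<v′)
          (Fin.<-asym u<v)
        go false true fu fu′ refl = contradiction
          (subst (v Fin.<_) (sym (exit-unique (f⇒ fu′) (f⇒¬ fu) (f⇒¬ (flip fu′ (proj₂ uv′)))
            (edge-sym (proj₁ uv)) (proj₁ uv′))) u′<v′)
          (Fin.<-asym u<v)

  -- A circuit with at most four vertices has at most four boundary edges. One side of this cut is
  -- then small: not the circuit itself, and if it is the rest, the circuit has at least five
  -- vertices after all.
  girth : GirthAtLeast 5 G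
  girth C circ with 5 ≤? order C
  ... | yes 5≤ = 5≤
  ... | no 5≰  = by-small (small f (≤-trans
          (boundary≤size f (cut f) (λ e ne → Cut.N⁺ f (e , ne)))
          (≤-trans (cut-size≤order {C} circ f f⇒ f⇒¬) (ℕ.s≤s⁻¹ (≰⇒> 5≰)))))
    where
    f : Fin n → Bool
    f u = does (u Subset.∈? V C)

    f⇒ : ∀ {u} → f u ≡ true → u ∈ˢ V C
    f⇒ {u} = does⇒ (u Subset.∈? V C)

    f⇒¬ : ∀ {u} → f u ≡ false → u ∉ˢ V C
    f⇒¬ {u} = does⇒¬ (u Subset.∈? V C)

    by-small : ∃[ c ] Small f c → 5 ≤ order C
    by-small (true  , s) = contradiction (λ {u} → dec-true (u Subset.∈? V C)) (no-circuit s {C} circ)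
    by-small (false , s) = small-complement s f⇒

  -- Components and cyclic edge cuts

  module _ (F : Graph n) {K : Graph n} (comp : Component (G ∖ᴱ F) K) where

    edge-presentation : ∀ {u v} → Edge u v → Presentation n
    edge-presentation {u} {v} e = record
      { Vertex      = λ w → w ≡ u ⊎ w ≡ v
      ; Edge        = λ w x → (w ≡ u × x ≡ v) ⊎ (w ≡ v × x ≡ u)
      ; vertex?     = λ w → (w Fin.≟ u) ⊎-dec (w Fin.≟ v)
      ; edge?       = λ w x → ((w Fin.≟ u) ×-dec (x Fin.≟ v)) ⊎-dec ((w Fin.≟ v) ×-dec (x Fin.≟ u))
      ; edge-vertex = [ inj₂ ∘ proj₂ , inj₁ ∘ proj₂ ]′
      ; edge-sym    = Sum.swap ∘ Sum.map swap swap
      ; edge-irrefl = [ (λ { (refl , refl) → edge-irrefl e }) , (λ { (refl , refl) → edge-irrefl e }) ]′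
      }

    -- If the edge survived the deletion of `F`, adding it to `K` would give a larger connected
    -- subgraph.
    component-exit : ∀ {u v} → u ∈ˢ V K → v ∉ˢ V K → Edge u v → Adj F u v
    component-exit {u} {v} u∈ v∉ e with v Subset.∈? N F u
    ... | yes v∈ = v∈
    ... | no uv∉ = contradiction
      (proj₁ (proj₂ (proj₂ comp) (K ∪ᴳ E) K∪E⊆
        (∪ᴳ-connected K E (proj₁ (proj₂ comp)) E-connected u∈ (E.V⁺ (inj₁ refl)))
        (p⊆p∪q (V E) , λ w → p⊆p∪q (N E w)))
        (q⊆p∪q (V K) (V E) (E.V⁺ (inj₂ refl)))) v∉
      where
      module E = Presentation (edge-presentation e)
      E : Graph n
      E = E.graph

      E-connected : Connected E
      E-connected = connected-from E u (E.V⁺ (inj₁ refl)) λ w∈ →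
        [ (λ { refl → ε }) , (λ { refl → E.N⁺ (inj₁ (refl , refl)) ◅ ε }) ]′ (E.V⁻ w∈)

      uv∈ : Adj (G ∖ᴱ F) u v
      uv∈ = x∈p∧x∉q⇒x∈p─q (G.N⁺ e) uv∉

      K∪E⊆ : K ∪ᴳ E ⊆ᴳ G ∖ᴱ F
      K∪E⊆ = (λ _ → ∈G _) , λ w x∈ → [ proj₂ (proj₁ comp) w
        , (λ x∈E → [ (λ { (refl , refl) → uv∈ }) , (λ { (refl , refl) → Graph.sym (G ∖ᴱ F) uv∈ }) ]′ (E.N⁻ x∈E)) ]′
        (x∈p∪q⁻ (N K w) (N E w) x∈)

  -- The union is connected through `w`, so by maximality it lies in each of the two components.
  component-unique : ∀ (F : Graph n) {K K′ : Graph n} → Component (G ∖ᴱ F) K → Component (G ∖ᴱ F) K′ →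
                     ∀ {w} → w ∈ˢ V K → w ∈ˢ V K′ → K ≈ᴳ K′
  component-unique F {K} {K′} (K⊆ , conn , max) (K′⊆ , conn′ , max′) w∈ w∈′ =
    ⊆-antisym (proj₁ ∪⊆K′ ∘ p⊆p∪q (V K′)) (proj₁ ∪⊆K ∘ q⊆p∪q (V K) (V K′)) ,
    λ u → ⊆-antisym (proj₂ ∪⊆K′ u ∘ p⊆p∪q (N K′ u)) (proj₂ ∪⊆K u ∘ q⊆p∪q (N K u) (N K′ u))
    where
    ∪⊆ : K ∪ᴳ K′ ⊆ᴳ G ∖ᴱ F
    ∪⊆ = (λ _ → ∈G _) , λ u → [ proj₂ K⊆ u , proj₂ K′⊆ u ]′ ∘ x∈p∪q⁻ (N K u) (N K′ u)

    ∪-connected : Connected (K ∪ᴳ K′)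
    ∪-connected = ∪ᴳ-connected K K′ conn conn′ w∈ w∈′

    ∪⊆K : K ∪ᴳ K′ ⊆ᴳ K
    ∪⊆K = max (K ∪ᴳ K′) ∪⊆ ∪-connected (p⊆p∪q (V K′) , λ u → p⊆p∪q (N K′ u))

    ∪⊆K′ : K ∪ᴳ K′ ⊆ᴳ K′
    ∪⊆K′ = max′ (K ∪ᴳ K′) ∪⊆ ∪-connected (q⊆p∪q (V K) (V K′) , λ u → q⊆p∪q (N K u) (N K′ u))

  -- All edges between the vertex set of `K₁` and the rest lie in `F`. With four edges or fewer one
  -- side would be small, but `K₁` contains a circuit, and the circuit of `K₂` avoids `K₁`.
  cyclic-cut≥5 : ∀ (F : Graph n) → CyclicEdgeCut G F → 5 ≤ size F
  cyclic-cut≥5 F (_ , K₁ , K₂ , comp₁ , comp₂ , K₁≉K₂ , (D₁ , D₁⊆ , circ₁) , (D₂ , D₂⊆ , circ₂))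
    with 5 ≤? size F
  ... | yes 5≤ = 5≤
  ... | no 5≰  = contradiction
          (small f (≤-trans (boundary≤size f F exits) (ℕ.s≤s⁻¹ (≰⇒> 5≰)))) λ
    { (true  , s) → no-circuit s {D₁} (⊆G {K₁} {D₁} comp₁ D₁⊆ , circ₁) (λ {u} u∈ → dec-true (u Subset.∈? V K₁) (proj₁ D₁⊆ u∈))
    ; (false , s) → no-circuit s {D₂} (⊆G {K₂} {D₂} comp₂ D₂⊆ , circ₂) (λ {u} u∈ → dec-false (u Subset.∈? V K₁)
        λ u∈₁ → K₁≉K₂ (component-unique F {K₁} {K₂} comp₁ comp₂ u∈₁ (proj₁ D₂⊆ u∈))) }
    where
    f : Fin n → Bool
    f u = does (u Subset.∈? V K₁)

    exits : ∀ {u v} → Edge u v → f u ≢ f v → Adj F u v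
    exits {u} {v} e ne with u Subset.∈? V K₁ | v Subset.∈? V K₁
    ... | yes _  | yes _  = contradiction refl ne
    ... | yes u∈ | no v∉  = component-exit F {K₁} comp₁ u∈ v∉ e
    ... | no u∉  | yes v∈ = Graph.sym F (component-exit F {K₁} comp₁ v∈ u∉ (edge-sym e))
    ... | no _   | no _   = contradiction refl ne

    ⊆G : ∀ {K D : Graph n} → Component (G ∖ᴱ F) K → D ⊆ᴳ K → D ⊆ᴳ G
    ⊆G (K⊆ , _) (_ , ND⊆) = (λ _ → ∈G _) , λ u uv → p─q⊆p (N G u) (N F u) (proj₂ K⊆ u (ND⊆ u uv))

  -- A cyclic edge cut with five edges

  rings-split : Unique ring × Unique ring′ × (∀ {u} → u ∈ ring → u ∉ ring′)
  rings-split with rings-unique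
  ... | a ∷ b ∷ c ∷ d ∷ e ∷ uniq′ =
    ( (a₁ ∷ a₂ ∷ a₃ ∷ a₄ ∷ []) ∷ (b₁ ∷ b₂ ∷ b₃ ∷ []) ∷ (c₁ ∷ c₂ ∷ []) ∷ (d₁ ∷ []) ∷ [] ∷ [] ) ,
    uniq′ , rings-apart
    where
    a₁ = All.head a
    a₂ = All.head (All.tail a)
    a₃ = All.head (All.tail (All.tail a))
    a₄ = All.head (All.tail (All.tail (All.tail a)))
    b₁ = All.head b
    b₂ = All.head (All.tail b)
    b₃ = All.head (All.tail (All.tail b))
    c₁ = All.head c
    c₂ = All.head (All.tail c)
    d₁ = All.head d
    rings-apart : ∀ {u} → u ∈ ring → u ∉ ring′
    rings-apart (here refl) v∈                                 = All.lookup (All.tail (All.tail (All.tail (All.tail a)))) v∈ refl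
    rings-apart (there (here refl)) v∈                         = All.lookup (All.tail (All.tail (All.tail b))) v∈ refl
    rings-apart (there (there (here refl))) v∈                 = All.lookup (All.tail (All.tail c)) v∈ refl
    rings-apart (there (there (there (here refl)))) v∈         = All.lookup (All.tail d) v∈ refl
    rings-apart (there (there (there (there (here refl))))) v∈ = All.lookup e v∈ refl

  ring-unique : Unique ring
  ring-unique = proj₁ rings-split

  ring′-unique : Unique ring′
  ring′-unique = proj₁ (proj₂ rings-split)

  rings-disjoint : ∀ {u} → u ∈ ring → u ∉ ring′
  rings-disjoint = proj₂ (proj₂ rings-split)

  module Z = Cycle ring-unique (s≤s (s≤s (s≤s z≤n)))
  module Z′ = Cycle ring′-unique (s≤s (s≤s (s≤s z≤n)))

  ring-links : ∀ {u v} → (u , v) ∈ links ring → Edge u v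
  ring-links (here refl)                                 = inj₁ (inj₁ (here refl))
  ring-links (there (here refl))                         = inj₂ (inj₂ refl)
  ring-links (there (there (here refl)))                 = inj₂ (inj₁ (inj₂ (there (here refl))))
  ring-links (there (there (there (here refl))))         = inj₂ (inj₁ (inj₂ (here refl)))
  ring-links (there (there (there (there (here refl))))) = inj₂ (inj₂ (twin-involutive z₀))

  ring′-links : ∀ {u v} → (u , v) ∈ links ring′ → Edge u v
  ring′-links (here refl)                                 = inj₁ (inj₁ (there (there (here refl))))
  ring′-links (there (here refl))                         = inj₂ (inj₂ refl)
  ring′-links (there (there (here refl)))                 = inj₂ (inj₁ (inj₂ y′-link))
  ring′-links (there (there (there (here refl))))         = inj₂ (inj₁ (inj₂ link-y′))
  ring′-links (there (there (there (there (here refl))))) = inj₂ (inj₂ (twin-involutive z₂))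

  ring-edge : ∀ {u v} → Link ring u v → Edge u v
  ring-edge = [ ring-links , edge-sym ∘ ring-links ]′

  ring′-edge : ∀ {u v} → Link ring′ u v → Edge u v
  ring′-edge = [ ring′-links , edge-sym ∘ ring′-links ]′

  in-ring : Fin n → Bool
  in-ring u = does (u ∈?ᴸ ring)

  in-ring⁺ : ∀ {u} → u ∈ ring → in-ring u ≡ true
  in-ring⁺ {u} = dec-true (u ∈?ᴸ ring)

  in-ring⁻ : ∀ {u} → in-ring u ≡ true → u ∈ ring
  in-ring⁻ {u} = does⇒ (u ∈?ᴸ ring)

  off-ring⁺ : ∀ {u} → u ∉ ring → in-ring u ≡ false
  off-ring⁺ {u} = dec-false (u ∈?ᴸ ring)

  off-ring⁻ : ∀ {u} → in-ring u ≡ false → u ∉ ring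
  off-ring⁻ {u} = does⇒¬ (u ∈?ᴸ ring)

  F : Graph n
  F = cut in-ring

  -- At most one edge leaves each vertex of the pentagon.
  F-size≤5 : size F ≤ 5
  F-size≤5 = ≤-trans
    (cut-size≤order {Z.cycle} (((λ _ → ∈G _) , λ u uv → G.N⁺ (ring-edge (Z.N⁻ uv))) , Z.cycle-circuit)
      in-ring (Z.V⁺ ∘ in-ring⁻) (λ fu u∈ → off-ring⁻ fu (Z.V⁻ u∈)))
    (≤-reflexive Z.cycle-order)

  module K₁ = Induced in-ring true
  module K₂ = Induced in-ring false

  K₁-connected : Connected K₁.graph
  K₁-connected = connected-from K₁.graph z₀ (K₁.V⁺ (in-ring⁺ (here refl))) λ v∈ →
    Star-map (λ {u} {v} uv → K₁.N⁺ (ring-edge (Z.N⁻ uv) ,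
        in-ring⁺ (Z.V⁻ (Graph.N⊆V Z.cycle (Graph.sym Z.cycle uv))) , in-ring⁺ (Z.V⁻ (Graph.N⊆V Z.cycle uv))))
      (proj₂ Z.cycle-connected (Z.V⁺ (here refl)) (Z.V⁺ (in-ring⁻ (K₁.V⁻ v∈))))

  P₁ P₂ : List (Fin n)
  P₁ = z₂ ∷ z₃ ∷ xs₁
  P₂ = x₂ ∷ xs₂

  P₁∉ring : ∀ {u} → u ∈ P₁ → u ∉ ring
  P₁∉ring {u} u∈ u∈ring with unique₁
  ... | (_ ∷ z₀∉) ∷ z₁∉ ∷ _ = go u∈ring
    where
    go : u ∉ ring
    go (here refl)                                 = All.lookup z₀∉ u∈ refl
    go (there (here refl))                         = All.lookup z₁∉ u∈ refl
    go (there (there (here refl)))                 = disjoint (there (there u∈)) (there (there (here refl)))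
    go (there (there (there (here refl))))         = disjoint (there (there u∈)) (there (here refl))
    go (there (there (there (there (here refl))))) = disjoint (there (there u∈)) (here refl)

  P₂∉ring : ∀ {u} → u ∈ P₂ → u ∉ ring
  P₂∉ring {u} u∈ u∈ring with unique₂
  ... | (_ ∷ _ ∷ a∉) ∷ (_ ∷ y∉) ∷ b∉ ∷ _ = go u∈ring
    where
    go : u ∉ ring
    go (here refl)                                 = disjoint (here refl) (there (there (there u∈)))
    go (there (here refl))                         = disjoint (there (here refl)) (there (there (there u∈)))
    go (there (there (here refl)))                 = All.lookup b∉ u∈ refl
    go (there (there (there (here refl))))         = All.lookup y∉ u∈ refl
    go (there (there (there (there (here refl))))) = All.lookup a∉ u∈ refl

  off-ring : ∀ {u} → u ∉ ring → u ∈ P₁ ⊎ u ∈ P₂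
  off-ring {u} u∉ with cover u
  ... | inj₁ (here refl)                 = contradiction (here refl) u∉
  ... | inj₁ (there (here refl))         = contradiction (there (here refl)) u∉
  ... | inj₁ (there (there u∈))          = inj₁ u∈
  ... | inj₂ (here refl)                 = contradiction (there (there (there (there (here refl))))) u∉
  ... | inj₂ (there (here refl))         = contradiction (there (there (there (here refl)))) u∉
  ... | inj₂ (there (there (here refl))) = contradiction (there (there (here refl))) u∉
  ... | inj₂ (there (there (there u∈)))  = inj₂ u∈

  K₂-edge : ∀ {u v} → Edge u v → u ∉ ring → v ∉ ring → Adj K₂.graph u v
  K₂-edge e u∉ v∉ = K₂.N⁺ (e , off-ring⁺ u∉ , off-ring⁺ v∉)

  P₁-reach : ∀ {v} → v ∈ P₁ → Star (Adj K₂.graph) z₂ v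
  P₁-reach = walk-reach z₂ (z₃ ∷ xs₁) λ uv →
    let uv′ = walk-prefix z₂ (z₃ ∷ xs₁) [ z₀ ] uv in
    K₂-edge (inj₁ (inj₁ (there (there uv′))))
      (P₁∉ring (walk-source z₂ (z₃ ∷ xs₁) z₀ uv′)) (P₁∉ring (there (walk-target z₂ (z₃ ∷ xs₁) uv)))

  P₂-reach : ∀ {v} → v ∈ P₂ → Star (Adj K₂.graph) x₂ v
  P₂-reach = walk-reach x₂ xs₂ λ uv →
    let uv′ = walk-prefix x₂ xs₂ [ twin z₀ ] uv in
    K₂-edge (inj₂ (inj₁ (inj₁ (there (there (there uv′))))))
      (P₂∉ring (walk-source x₂ xs₂ (twin z₀) uv′)) (P₂∉ring (there (walk-target x₂ xs₂ uv)))

  twin-z₂∉ring : twin z₂ ∉ ring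
  twin-z₂∉ring t∈ = rings-disjoint t∈ (there (there (there (there (here refl)))))

  twin-z₂∈P₂ : twin z₂ ∈ P₂
  twin-z₂∈P₂ with off-ring twin-z₂∉ring
  ... | inj₁ t∈ = contradiction (there (there t∈)) (twin-∉₁ {z₂} (there (there (here refl))))
  ... | inj₂ t∈ = t∈

  -- Removing the pentagon leaves one arc of each circuit; the rung at `z₂` joins the two arcs.
  K₂-connected : Connected K₂.graph
  K₂-connected = connected-from K₂.graph z₂ (K₂.V⁺ (off-ring⁺ (P₁∉ring (here refl)))) λ v∈ →
    [ P₁-reach
    , (λ v∈₂ → K₂-edge (inj₂ (inj₂ refl)) (P₁∉ring (here refl)) twin-z₂∉ring
        ◅ Star-reverse K₂.graph (P₂-reach twin-z₂∈P₂) ◅◅ P₂-reach v∈₂) ]′ (off-ring (off-ring⁻ (K₂.V⁻ v∈)))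

  F-cyclic : CyclicEdgeCut G F
  F-cyclic =
    cut⊆G in-ring , K₁.graph , K₂.graph ,
    induced-component in-ring true K₁-connected , induced-component in-ring false K₂-connected ,
    (λ (V≡ , _) → off-ring⁻ (K₂.V⁻ (subst (z₀ ∈ˢ_) V≡ (K₁.V⁺ (in-ring⁺ (here refl))))) (here refl)) ,
    (Z.cycle ,
      ( (K₁.V⁺ ∘ in-ring⁺ ∘ Z.V⁻)
      , λ u uv → K₁.N⁺ (ring-edge (Z.N⁻ uv) ,
          in-ring⁺ (Link⇒∈ {ring} (Z.N⁻ uv)) , in-ring⁺ (Link-∈ (Z.N⁻ uv)))) ,
      Z.cycle-circuit) ,
    (Z′.cycle ,
      ( (λ u∈ → K₂.V⁺ (off-ring⁺ λ u∈ring → rings-disjoint u∈ring (Z′.V⁻ u∈)))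
      , λ u uv → K₂-edge (ring′-edge (Z′.N⁻ uv))
          (λ u∈ → rings-disjoint u∈ (Link⇒∈ {ring′} (Z′.N⁻ uv)))
          (λ v∈ → rings-disjoint v∈ (Link-∈ (Z′.N⁻ uv)))) ,
      Z′.cycle-circuit)

  -- The boundary of the pentagon is only counted from above; the general lower bound, applied to
  -- this cut, gives equality.
  λc≡5 : λc G ≔ 5
  λc≡5 = (F , F-cyclic , ≤-antisym F-size≤5 (cyclic-cut≥5 F F-cyclic)) , cyclic-cut≥5

  cyclically-5-connected : CyclicallyEdgeConnected 5 G
  cyclically-5-connected = 5 , λc≡5 , ≤-refl

  cyclically-4-connected : CyclicallyEdgeConnected 4 G
  cyclically-4-connected = 5 , λc≡5 , n≤1+n 4

  -- Order and edge colourings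

  order-G : order G ≡ n
  order-G = trans (∣∣≡length {p = V G} (Unique.allFin⁺ n) (λ {u} _ → ∈G u) (λ {u} _ → ∈-allFin u))
    (length-tabulate id)

  not-Petersen : 11 ≤ n → ¬ (G ≅ petersen)
  not-Petersen 11≤n iso = contradiction (≤-trans 11≤n (Fin.injective⇒≤ {f = to} injective)) λ
    { (s≤s (s≤s (s≤s (s≤s (s≤s (s≤s (s≤s (s≤s (s≤s (s≤s ())))))))))) }
    where
    open _≅_ iso
    injective : ∀ {u v} → to u ≡ to v → u ≡ v
    injective {u} {v} eq = trans (sym (from-to (∈G u))) (trans (cong from eq) (from-to (∈G v)))

  -- The colours of the circuit edges form a labelling: at both ends of a rung they are the two
  -- colours that the rung does not have.
  uncolourable : ¬ EdgeColourable 3 G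
  uncolourable (colour , colour-sym , proper) = unlabelled Fin._≟_ left right glue₁ glue₂ matched
    where
    left right : Fin n → Fin 3
    left  u = colour u (Local.pred (local u))
    right u = colour u (Local.succ (local u))

    glue : ∀ {u v} → (u , v) ∈ links ws₁ ⊎ (u , v) ∈ links ws₂ → Edge u v → right u ≡ left v
    glue {u} {v} l e = trans (cong (colour u) (sym (Local.after (local u) l)))
      (trans (colour-sym (G.N⁺ e)) (cong (colour v) (Local.before (local v) l)))

    glue₁ : ∀ {u v} → (u , v) ∈ links ws₁ → right u ≡ left v
    glue₁ l = glue (inj₁ l) (inj₁ (inj₁ l))

    glue₂ : ∀ {u v} → (u , v) ∈ links ws₂ → right u ≡ left v
    glue₂ l = glue (inj₂ l) (inj₂ (inj₁ (inj₁ l)))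

    twin-adj : ∀ u → Adj G u (twin u)
    twin-adj u = G.N⁺ (inj₂ (inj₂ refl))

    distinct : ∀ u → left u ≢ right u × left u ≢ colour u (twin u) × right u ≢ colour u (twin u)
    distinct u = proper (G.N⁺ pred-edge) (G.N⁺ succ-edge) pred≢succ ,
                 proper (G.N⁺ pred-edge) (twin-adj u) pred≢twin ,
                 proper (G.N⁺ succ-edge) (twin-adj u) succ≢twin
      where open Local (local u)

    same-rung : ∀ u → colour (twin u) (twin (twin u)) ≡ colour u (twin u)
    same-rung u = trans (cong (colour (twin u)) (twin-involutive u)) (sym (colour-sym (twin-adj u)))

    matched : ∀ u → Match (left u) (right u) (left (twin u)) (right (twin u))
    matched u =
      let a≢b , a≢r , b≢r    = distinct u
          a′≢b′ , a′≢r , b′≢r = distinct (twin u)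
      in a≢b , two-remaining-colours _ _ _ _ _ a≢b a≢r b≢r a′≢b′
           (λ e → a′≢r (trans e (sym (same-rung u)))) (λ e → b′≢r (trans e (sym (same-rung u))))

  -- Circuit double covers

  module _ {S : List (Graph n)} (cdc : CDC G S) (C₁∈S : C₁ ∈ᴸ S) (C₂∈S : C₂ ∈ᴸ S) where

    -- Positions in `S` serve as labels, since their equality is decidable.
    Index : Set
    Index = Fin (length S)

    D : Index → Graph n
    D = List.lookup S

    i₁ i₂ : Index
    i₁ = Any.index C₁∈S
    i₂ = Any.index C₂∈S

    D-circuit : ∀ k → CircuitOf G (D k)
    D-circuit k = All.lookup (proj₁ (proj₂ cdc)) (∈-lookup k)

    Covers : Index → Fin n → Fin n → Set
    Covers k u v = v ∈ˢ N (D k) u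

    Covers-sym : ∀ {k u v} → Covers k u v → Covers k v u
    Covers-sym {k} = Graph.sym (D k)

    covered-twice : ∀ {u v} → Edge u v → ExactlyTwo λ k → Covers k u v
    covered-twice {u} {v} e = exactly-two (λ C → v Subset.∈? N C u) S (proj₂ (proj₂ cdc) (G.N⁺ e))

    i₁-covers⁻ : ∀ {u v} → Covers i₁ u v → Link ws₁ u v
    i₁-covers⁻ {u} {v} v∈ = C₁.N⁻ (subst (v ∈ˢ_) (sym (proj₂ (Any.lookup-index C₁∈S) u)) v∈)

    i₁-covers⁺ : ∀ {u v} → Link ws₁ u v → Covers i₁ u v
    i₁-covers⁺ {u} {v} l = subst (v ∈ˢ_) (proj₂ (Any.lookup-index C₁∈S) u) (C₁.N⁺ l)

    i₂-covers⁻ : ∀ {u v} → Covers i₂ u v → Link ws₂ u v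
    i₂-covers⁻ {u} {v} v∈ = C₂.N⁻ (subst (v ∈ˢ_) (sym (proj₂ (Any.lookup-index C₂∈S) u)) v∈)

    i₂-covers⁺ : ∀ {u v} → Link ws₂ u v → Covers i₂ u v
    i₂-covers⁺ {u} {v} l = subst (v ∈ˢ_) (proj₂ (Any.lookup-index C₂∈S) u) (C₂.N⁺ l)

    Other : Fin n → Fin n → Index → Set
    Other u v k = k ≢ i₁ × k ≢ i₂ × Covers k u v

    other-than : ∀ {u v} → Edge u v → ∀ m → Covers m u v → ∃[ k ] k ≢ m × Covers k u v
    other-than e m m∈ with covered-twice e
    ... | record { i = i ; j = j ; i≢j = i≢j ; Pi = Pi ; Pj = Pj ; only = only } with only m m∈
    ...   | inj₁ refl = j , i≢j ∘ sym , Pj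
    ...   | inj₂ refl = i , i≢j , Pi

    other : ∀ {u v} → RingEdge u v → ∃[ k ] Other u v k
    other (inj₁ l) with other-than (inj₁ l) i₁ (i₁-covers⁺ l)
    ... | k , k≢ , k∈ = k , k≢ ,
      (λ { refl → disjoint (Link-∈ l) (Link-∈ (i₂-covers⁻ k∈)) }) , k∈
    other (inj₂ l) with other-than (inj₂ (inj₁ l)) i₂ (i₂-covers⁺ l)
    ... | k , k≢ , k∈ = k ,
      (λ { refl → disjoint (Link-∈ (i₁-covers⁻ k∈)) (Link-∈ l) }) , k≢ , k∈

    -- One of the exactly two circuits through the edge is `C₁` or `C₂`.
    other-unique : ∀ {u v} → RingEdge u v → ∀ {k k′} → Other u v k → Other u v k′ → k ≡ k′
    other-unique (inj₁ l) (k≢ , _ , k∈) (k′≢ , _ , k′∈) =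
      ExactlyTwo-third (covered-twice (inj₁ l)) (i₁-covers⁺ l) k∈ k′∈ (k≢ ∘ sym) (k′≢ ∘ sym)
    other-unique (inj₂ l) (_ , k≢ , k∈) (_ , k′≢ , k′∈) =
      ExactlyTwo-third (covered-twice (inj₂ (inj₁ l))) (i₂-covers⁺ l) k∈ k′∈ (k≢ ∘ sym) (k′≢ ∘ sym)

    Other-sym : ∀ {u v k} → Other u v k → Other v u k
    Other-sym {k = k} (k≢₁ , k≢₂ , k∈) = k≢₁ , k≢₂ , Covers-sym {k} k∈

    left right : Fin n → Index
    left  u = proj₁ (other (Local.pred-ring (local u)))
    right u = proj₁ (other (Local.succ-ring (local u)))

    module At (u : Fin n) where
      open Local (local u)

      a b : Index
      a = left u
      b = right u

      a-other : Other u pred a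
      a-other = proj₂ (other pred-ring)

      b-other : Other u succ b
      b-other = proj₂ (other succ-ring)

      rung-other : ∀ {k} → Covers k u (twin u) → k ≢ i₁ × k ≢ i₂
      rung-other k∈ = (λ { refl → off₁ (i₁-covers⁻ k∈) }) , (λ { refl → off₂ (i₂-covers⁻ k∈) })
        where
        off₁ : ¬ Link ws₁ u (twin u)
        off₁ l = twin-∉₁ (Link⇒∈ {ws₁} l) (Link-∈ l)
        off₂ : ¬ Link ws₂ u (twin u)
        off₂ l = disjoint (twin₂ (Link⇒∈ {ws₂} l)) (Link-∈ l)

      neighbours⊆ : ∀ {k v} → Covers k u v → v ∈ pred ∷ succ ∷ twin u ∷ []
      neighbours⊆ {k} v∈ = only (G.N⁻ (proj₂ (proj₁ (D-circuit k)) u v∈))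

      degree : ∀ {k v} → Covers k u v → ∣ N (D k) u ∣ ≡ 2
      degree {k} v∈ = proj₁ (proj₂ (D-circuit k)) (Graph.N⊆V (D k) (Graph.sym (D k) v∈))

      not-all : ∀ {k} → Covers k u pred → Covers k u succ → ¬ Covers k u (twin u)
      not-all {k} p∈ s∈ t∈ = contradiction
        (≤-trans (Unique⇒length≤∣∣ {p = N (D k) u}
            ((pred≢succ ∷ pred≢twin ∷ []) ∷ (succ≢twin ∷ []) ∷ [] ∷ [])
            (λ { (here refl) → p∈ ; (there (here refl)) → s∈ ; (there (there (here refl))) → t∈ }))
          (≤-reflexive (degree {k} p∈)))
        λ { (s≤s (s≤s ())) }

      not-alone : ∀ {k v} → Covers k u v → ¬ (∀ {w} → Covers k u w → w ∈ v ∷ [])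
      not-alone {k} v∈ alone = contradiction
        (≤-trans (≤-reflexive (sym (degree {k} v∈))) (∣∣≤length {p = N (D k) u} alone)) λ { (s≤s ()) }

      pred-turns : ∀ {k} → Covers k u pred → ¬ Covers k u succ → Covers k u (twin u)
      pred-turns {k} p∈ s∉ with twin u Subset.∈? N (D k) u
      ... | yes t∈ = t∈
      ... | no t∉  = contradiction (λ {w} w∈ → alone (neighbours⊆ {k} w∈) w∈) (not-alone {k} p∈)
        where
        alone : ∀ {w} → w ∈ pred ∷ succ ∷ twin u ∷ [] → Covers k u w → w ∈ pred ∷ []
        alone (here refl) _                  = here refl
        alone (there (here refl)) s∈         = contradiction s∈ s∉
        alone (there (there (here refl))) t∈ = contradiction t∈ t∉

      succ-turns : ∀ {k} → Covers k u succ → ¬ Covers k u pred → Covers k u (twin u)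
      succ-turns {k} s∈ p∉ with twin u Subset.∈? N (D k) u
      ... | yes t∈ = t∈
      ... | no t∉  = contradiction (λ {w} w∈ → alone (neighbours⊆ {k} w∈) w∈) (not-alone {k} s∈)
        where
        alone : ∀ {w} → w ∈ pred ∷ succ ∷ twin u ∷ [] → Covers k u w → w ∈ succ ∷ []
        alone (here refl) p∈                 = contradiction p∈ p∉
        alone (there (here refl)) _          = here refl
        alone (there (there (here refl))) t∈ = contradiction t∈ t∉

      rung-turns : ∀ {k} → Covers k u (twin u) → Covers k u pred ⊎ Covers k u succ
      rung-turns {k} t∈ with pred Subset.∈? N (D k) u | succ Subset.∈? N (D k) u
      ... | yes p∈ | _      = inj₁ p∈
      ... | no _   | yes s∈ = inj₂ s∈
      ... | no p∉  | no s∉  = contradiction (λ {w} w∈ → alone (neighbours⊆ {k} w∈) w∈) (not-alone {k} t∈)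
        where
        alone : ∀ {w} → w ∈ pred ∷ succ ∷ twin u ∷ [] → Covers k u w → w ∈ twin u ∷ []
        alone (here refl) p∈                = contradiction p∈ p∉
        alone (there (here refl)) s∈        = contradiction s∈ s∉
        alone (there (there (here refl))) _ = here refl

      -- A circuit through the rung at `u` continues along one of the two circuit edges, so it is
      -- the other circuit of that edge. If both edges had the same other circuit, it would contain
      -- all three edges at `u`.
      a≢b : a ≢ b
      a≢b a≡b = go (rung-turns {i} Pi)
        where
        open ExactlyTwo (covered-twice {u} {twin u} (inj₂ (inj₂ refl)))
        a-all : i ≡ a → ⊥
        a-all i≡a = not-all {a} (proj₂ (proj₂ a-other))
          (subst (λ k → Covers k u succ) (sym a≡b) (proj₂ (proj₂ b-other)))
          (subst (λ k → Covers k u (twin u)) i≡a Pi)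
        go : Covers i u pred ⊎ Covers i u succ → ⊥
        go (inj₁ p∈) = a-all (other-unique pred-ring
          (proj₁ (rung-other {i} Pi) , proj₂ (rung-other {i} Pi) , p∈) a-other)
        go (inj₂ s∈) = a-all (trans (other-unique succ-ring
          (proj₁ (rung-other {i} Pi) , proj₂ (rung-other {i} Pi) , s∈) b-other) (sym a≡b))

      -- The circuit `a` misses the succeeding edge, whose other circuit is `b`; having degree two
      -- at `u`, it takes the rung.
      a-rung : Covers a u (twin u)
      a-rung = pred-turns {a} (proj₂ (proj₂ a-other)) λ s∈ →
        a≢b (other-unique succ-ring (proj₁ a-other , proj₁ (proj₂ a-other) , s∈) b-other)

      b-rung : Covers b u (twin u)
      b-rung = succ-turns {b} (proj₂ (proj₂ b-other)) λ p∈ →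
        a≢b (other-unique pred-ring a-other (proj₁ b-other , proj₁ (proj₂ b-other) , p∈))

    -- The labels at either end of a rung name the two circuits of the cover that pass through the
    -- rung.
    cdc-matched : ∀ u → Match (left u) (right u) (left (twin u)) (right (twin u))
    cdc-matched u = At.a≢b u , ExactlyTwo-pairs (covered-twice {u} {twin u} (inj₂ (inj₂ refl)))
      (At.a-rung u) (At.b-rung u) (At.a≢b u)
      (back {left (twin u)} (At.a-rung (twin u))) (back {right (twin u)} (At.b-rung (twin u))) (At.a≢b (twin u))
      where
      back : ∀ {k} → Covers k (twin u) (twin (twin u)) → Covers k u (twin u)
      back {k} k∈ = Covers-sym {k} (subst (Covers k (twin u)) (twin-involutive u) k∈)

    cdc-glue : ∀ {u v} → (u , v) ∈ links ws₁ ⊎ (u , v) ∈ links ws₂ → right u ≡ left v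
    cdc-glue {u} {v} l = other-unique (Local.succ-ring (local u)) (At.b-other u)
      (subst₂ (λ x w → Other x w (left v)) (sym (Local.before (local v) l)) (Local.after (local u) l)
        (Other-sym {v} {Local.pred (local v)} {left v} (At.a-other v)))

    not-cdc : ⊥
    not-cdc = unlabelled Fin._≟_ left right (cdc-glue ∘ inj₁) (cdc-glue ∘ inj₂) cdc-matched

  no-cdc : ¬ (Σ[ S ∈ List (Graph n) ] CDC G S × C₁ ∈ᴸ S × C₂ ∈ᴸ S)
  no-cdc (S , cdc , C₁∈ , C₂∈) = not-cdc {S} cdc C₁∈ C₂∈

  -- The three conjectures

  module _ (11≤n : 11 ≤ n) where

    counterexampleA : CounterexampleA G
    counterexampleA =
      cyclically-5-connected , (C₁ , C₂ , cycle-permutation-with) ,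
      (cubic , cyclically-4-connected , girth , uncolourable) , not-Petersen 11≤n

    counterexampleB : CounterexampleB G
    counterexampleB =
      cyclically-5-connected , cubic ,
      (C₁ ∷ C₂ ∷ [] ,
       (C₁⊆G , C₁.cycle-circuit) ∷ (C₂⊆G , C₂.cycle-circuit) ∷ [] ,
       (C₁C₂-disjoint ∷ []) ∷ [] ∷ [] ,
       λ (S , cdc , ⊆S) → no-cdc (S , cdc , ⊆S {C₁} (here (refl , λ _ → refl)) , ⊆S {C₂} (there (here (refl , λ _ → refl))))) ,
      not-Petersen 11≤n

    counterexampleC : CounterexampleC G
    counterexampleC =
      (C₁ , C₂ , cycle-permutation-with , cyclically-5-connected , no-cdc) , not-Petersen 11≤n

-- The graphs of order 10 + 24 n

labelCount : ℕ → ℕ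
labelCount zero    = 5
labelCount (suc n) = 12 + labelCount n

encode : ∀ n → Label n → Fin (labelCount n)
encode zero    k        = k
encode (suc n) (inj₁ k) = k ↑ˡ labelCount n
encode (suc n) (inj₂ z) = 12 ↑ʳ encode n z

decode : ∀ n → Fin (labelCount n) → Label n
decode zero    k = k
decode (suc n) k = Sum.map₂ (decode n) (Fin.splitAt 12 k)

decode-encode : ∀ n z → decode n (encode n z) ≡ z
decode-encode zero    k        = refl
decode-encode (suc n) (inj₁ k) rewrite Fin.splitAt-↑ˡ 12 k (labelCount n) = refl
decode-encode (suc n) (inj₂ z) rewrite Fin.splitAt-↑ʳ 12 (labelCount n) (encode n z) = cong inj₂ (decode-encode n z)

encode-decode : ∀ n k → encode n (decode n k) ≡ k
encode-decode zero    k = refl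
encode-decode (suc n) k with Fin.splitAt 12 k in eq
... | inj₁ j = Fin.splitAt⁻¹-↑ˡ eq
... | inj₂ j = trans (cong (12 ↑ʳ_) (encode-decode n j)) (Fin.splitAt⁻¹-↑ʳ eq)

labelCount-double : ∀ n → labelCount n + labelCount n ≡ 10 + 24 * n
labelCount-double zero    = refl
labelCount-double (suc n) = trans (rearrange (labelCount n)) (trans (cong (24 +_) (labelCount-double n)) (shift n))
  where
  rearrange : ∀ s → (12 + s) + (12 + s) ≡ 24 + (s + s)
  rearrange = solve-∀
  shift : ∀ n → 24 + (10 + 24 * n) ≡ 10 + 24 * suc n
  shift = solve-∀

module _ (k : ℕ) where
  open Weave (weave k)
  open Grow (weave k) using (old; new; long₁; long₂)

  m : ℕ
  m = labelCount (suc k)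

  Vertex : Set
  Vertex = Label (suc k) ⊎ Label (suc k)

  opaque
    vertex : Vertex → Fin (m + m)
    vertex = Fin.join m m ∘ Sum.map (encode (suc k)) (encode (suc k))

    unvertex : Fin (m + m) → Vertex
    unvertex = Sum.map (decode (suc k)) (decode (suc k)) ∘ Fin.splitAt m

    unvertex-vertex : ∀ v → unvertex (vertex v) ≡ v
    unvertex-vertex (inj₁ x) rewrite Fin.splitAt-↑ˡ m (encode (suc k) x) m = cong inj₁ (decode-encode (suc k) x)
    unvertex-vertex (inj₂ x) rewrite Fin.splitAt-↑ʳ m m (encode (suc k) x) = cong inj₂ (decode-encode (suc k) x)

    vertex-unvertex : ∀ u → vertex (unvertex u) ≡ u
    vertex-unvertex u with Fin.splitAt m u in eq
    ... | inj₁ j = trans (cong (_↑ˡ m) (encode-decode (suc k) j)) (Fin.splitAt⁻¹-↑ˡ eq)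
    ... | inj₂ j = trans (cong (m ↑ʳ_) (encode-decode (suc k) j)) (Fin.splitAt⁻¹-↑ʳ eq)

  vertex-injective : ∀ {v w} → vertex v ≡ vertex w → v ≡ w
  vertex-injective {v} {w} eq =
    trans (sym (unvertex-vertex v)) (trans (cong unvertex eq) (unvertex-vertex w))

  left right : Label (suc k) → Fin (m + m)
  left  = vertex ∘ inj₁
  right = vertex ∘ inj₂

  twin : Fin (m + m) → Fin (m + m)
  twin = vertex ∘ Sum.swap ∘ unvertex

  twin-left : ∀ x → twin (left x) ≡ right x
  twin-left x = cong (vertex ∘ Sum.swap) (unvertex-vertex (inj₁ x))

  twin-right : ∀ x → twin (right x) ≡ left x
  twin-right x = cong (vertex ∘ Sum.swap) (unvertex-vertex (inj₂ x))

  -- The cut is made so that `0F 1F 10 11` open the first word and `0F a 1F` the second. With the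
  -- rungs 0 and 1 these give one pentagon; with the rungs 10 and 11, and `10 c 11` on the second
  -- word, they give the other.
  front₁ back₁ front₂ back₂ : List (Label (suc k))
  front₁ = old a ∷ new 7F ∷ old d ∷ new 6F ∷ new 8F ∷ new 2F ∷ []
  back₁  = new 0F ∷ new 1F ∷ new (# 10) ∷ new (# 11) ∷ new 9F ∷ new 3F ∷ new 5F ∷ old b ∷ new 4F ∷
           old c ∷ map old R₁
  front₂ = old b ∷ []
  back₂  = new 0F ∷ old a ∷ new 1F ∷ new 2F ∷ new 3F ∷ new 4F ∷ new 5F ∷ new 6F ∷ new 7F ∷ new 8F ∷
           new 9F ∷ new (# 10) ∷ old c ∷ new (# 11) ∷ map old R₂

  turned₁ turned₂ : List (Label (suc k))
  turned₁ = back₁ ++ front₁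
  turned₂ = back₂ ++ front₂

  skeleton : Skeleton (m + m)
  skeleton = record
    { twin = twin
    ; z₀ = left (new 0F) ; z₁ = left (new 1F) ; z₂ = left (new (# 10)) ; z₃ = left (new (# 11))
    ; y = right (old a) ; y′ = right (old c) ; x₂ = right (new 2F)
    ; xs₁ = map left (List.drop 4 turned₁)
    ; xs₂ = map right (List.drop 4 turned₂)
    }
  open Skeleton skeleton hiding (twin)

  ws₂≡ : ws₂ ≡ map right turned₂
  ws₂≡ = cong₂ (λ u v → u ∷ y ∷ v ∷ x₂ ∷ xs₂) (twin-left (new 0F)) (twin-left (new 1F))

  links₁ : ∀ {x z} → (x , z) ∈ links turned₁ → (left x , left z) ∈ links ws₁
  links₁ {x} {z} xz = subst ((left x , left z) ∈_) (sym (links-map left turned₁))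
    (∈-map⁺ (λ (u , v) → left u , left v) xz)

  links₂ : ∀ {x z} → (x , z) ∈ links turned₂ → (right x , right z) ∈ links ws₂
  links₂ {x} {z} xz = subst (λ ws → (right x , right z) ∈ links ws) (sym ws₂≡)
    (subst ((right x , right z) ∈_) (sym (links-map right turned₂))
      (∈-map⁺ (λ (u , v) → right u , right v) xz))

  ∈ws₁ : ∀ x → left x ∈ ws₁
  ∈ws₁ x = ∈-map⁺ left (∈-resp-↭ (++-comm front₁ back₁) (long₁-complete (weave k) x))

  ∈ws₂ : ∀ x → right x ∈ ws₂
  ∈ws₂ x = subst (right x ∈_) (sym ws₂≡)
    (∈-map⁺ right (∈-resp-↭ (++-comm front₂ back₂) (long₂-complete (weave k) x)))

  ws₁⁻ : ∀ {u} → u ∈ ws₁ → ∃[ x ] u ≡ left x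
  ws₁⁻ u∈ with ∈-map⁻ left {xs = turned₁} u∈
  ... | x , _ , eq = x , eq

  ws₂⁻ : ∀ {u} → u ∈ ws₂ → ∃[ x ] u ≡ right x
  ws₂⁻ {u} u∈ with ∈-map⁻ right {xs = turned₂} (subst (u ∈_) ws₂≡ u∈)
  ... | x , _ , eq = x , eq

  rings : List Vertex
  rings = inj₁ (new 0F) ∷ inj₁ (new 1F) ∷ inj₂ (new 1F) ∷ inj₂ (old a) ∷ inj₂ (new 0F) ∷
          inj₁ (new (# 10)) ∷ inj₁ (new (# 11)) ∷ inj₂ (new (# 11)) ∷ inj₂ (old c) ∷ inj₂ (new (# 10)) ∷ []

  rings-distinct : Unique rings
  rings-distinct with unique₁
  ... | (_ ∷ _ ∷ a≢c ∷ _) ∷ _ = Unique-⊎ rings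
    (Unique-⊎ (lefts rings) (from-yes (DecUnique.unique? Fin._≟_ (lefts (lefts rings)))) [])
    (Unique-⊎ (rights rings) (from-yes (DecUnique.unique? Fin._≟_ (lefts (rights rings)))) ((a≢c ∷ []) ∷ [] ∷ []))

  rings≡ : ring ++ ring′ ≡ map vertex rings
  rings≡ rewrite twin-left (new 0F) | twin-left (new 1F) | twin-left (new (# 10)) | twin-left (new (# 11)) = refl

  turned-simple : Simple turned₁ turned₂
  turned-simple f t₁ t₂ = Grow.long-simple (weave k) (weave-simple k) f
    (≤-trans (≤-reflexive (turns-rotate f front₁ back₁)) t₁)
    (≤-trans (≤-reflexive (turns-rotate f front₂ back₂)) t₂)

  turned-unlabelled : Unlabelled turned₁ turned₂
  turned-unlabelled _≟ᴸ_ ℓ = weave-unlabelled k _≟ᴸ_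
    (Grow.Shrink.shrink (weave k) (_≟ˡ_ {k}) _≟ᴸ_ (Labelling-rotate back₁ front₁ back₂ front₂ ℓ))

  prism : Prism (m + m)
  prism = record
    { skeleton        = skeleton
    ; unique₁         = Unique.map⁺ (inj₁-injective ∘ vertex-injective)
        (Unique-rotate front₁ back₁ (long₁-unique (weave k)))
    ; unique₂         = subst Unique (sym ws₂≡) (Unique.map⁺ (inj₂-injective ∘ vertex-injective)
        (Unique-rotate front₂ back₂ (long₂-unique (weave k))))
    ; disjoint        = λ u∈₁ u∈₂ → disjoint′ (ws₁⁻ u∈₁) (ws₂⁻ u∈₂)
    ; cover           = λ u → subst (λ u → u ∈ ws₁ ⊎ u ∈ ws₂) (vertex-unvertex u) (cover′ (unvertex u))
    ; twin-involutive = λ u → subst (λ u → twin (twin u) ≡ u) (vertex-unvertex u) (involutive (unvertex u))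
    ; twin₁           = λ u∈ → twin₁′ (ws₁⁻ u∈)
    ; twin₂           = λ u∈ → twin₂′ (ws₂⁻ u∈)
    ; long₁           = s≤s (s≤s (s≤s (s≤s (s≤s (s≤s z≤n)))))
    ; long₂           = s≤s (s≤s (s≤s (s≤s (s≤s z≤n))))
    ; rings-unique    = subst Unique (sym rings≡) (Unique.map⁺ vertex-injective rings-distinct)
    ; link-y′         = subst (λ u → (u , y′) ∈ links ws₂) (sym (twin-left (new (# 10)))) (links₂ 10-c)
    ; y′-link         = subst (λ u → (y′ , u) ∈ links ws₂) (sym (twin-left (new (# 11)))) (links₂ c-11)
    ; simple          = simple
    ; unlabelled      = unlabelled
    }
    where
    disjoint′ : ∀ {u} → ∃[ x ] u ≡ left x → ∃[ z ] u ≡ right z → ⊥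
    disjoint′ (x , refl) (z , eq) with () ← vertex-injective {inj₁ x} {inj₂ z} eq

    cover′ : ∀ v → vertex v ∈ ws₁ ⊎ vertex v ∈ ws₂
    cover′ (inj₁ x) = inj₁ (∈ws₁ x)
    cover′ (inj₂ x) = inj₂ (∈ws₂ x)

    involutive : ∀ v → twin (twin (vertex v)) ≡ vertex v
    involutive (inj₁ x) = trans (cong twin (twin-left x)) (twin-right x)
    involutive (inj₂ x) = trans (cong twin (twin-right x)) (twin-left x)

    twin₁′ : ∀ {u} → ∃[ x ] u ≡ left x → twin u ∈ ws₂
    twin₁′ (x , refl) = subst (_∈ ws₂) (sym (twin-left x)) (∈ws₂ x)

    twin₂′ : ∀ {u} → ∃[ x ] u ≡ right x → twin u ∈ ws₁
    twin₂′ (x , refl) = subst (_∈ ws₁) (sym (twin-right x)) (∈ws₁ x)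

    10-c : (new (# 10) , old c) ∈ links turned₂
    10-c = there (there (there (there (there (there (there (there (there (there (there (here refl)))))))))))

    c-11 : (old c , new (# 11)) ∈ links turned₂
    c-11 = there (there (there (there (there (there (there (there (there (there (there (there (here refl))))))))))))

    simple : ∀ f → (∀ u → f (twin u) ≡ f u) → turns f ws₁ ≤ 2 → turns f ws₂ ≤ 2 →
             ∃[ c ] (∀ u v → u ∈ ws₁ → v ∈ ws₁ → f u ≡ c → f v ≡ c → u ≡ v)
    simple f inv t₁ t₂ with turned-simple (f ∘ left)
      (≤-trans (≤-reflexive (sym (turns-map f left turned₁))) t₁)
      (≤-trans (≤-reflexive (trans (turns-cong (λ x → trans (sym (inv (left x))) (cong f (twin-left x))) turned₂)
        (trans (sym (turns-map f right turned₂)) (cong (turns f) (sym ws₂≡))))) t₂)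
    ... | inj₁ one = true  , λ u v u∈ v∈ → lift one (ws₁⁻ u∈) (ws₁⁻ v∈)
      where
      lift : ∀ {c} → AtMostOne (f ∘ left) c → ∀ {u v} → ∃[ x ] u ≡ left x → ∃[ x ] v ≡ left x →
             f u ≡ c → f v ≡ c → u ≡ v
      lift one (x , refl) (z , refl) fu fv = cong left (one x z fu fv)
    ... | inj₂ one = false , λ u v u∈ v∈ → lift one (ws₁⁻ u∈) (ws₁⁻ v∈)
      where
      lift : ∀ {c} → AtMostOne (f ∘ left) c → ∀ {u v} → ∃[ x ] u ≡ left x → ∃[ x ] v ≡ left x →
             f u ≡ c → f v ≡ c → u ≡ v
      lift one (x , refl) (z , refl) fu fv = cong left (one x z fu fv)

    unlabelled : ∀ {L : Set} → DecidableEquality L → (l r : Fin (m + m) → L) →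
                 (∀ {u v} → (u , v) ∈ links ws₁ → r u ≡ l v) →
                 (∀ {u v} → (u , v) ∈ links ws₂ → r u ≡ l v) →
                 ¬ (∀ u → Match (l u) (r u) (l (twin u)) (r (twin u)))
    unlabelled _≟_ l r glue₁ glue₂ matched = turned-unlabelled _≟_ record
      { left₁   = l ∘ left
      ; right₁  = r ∘ left
      ; left₂   = l ∘ right
      ; right₂  = r ∘ right
      ; glue₁   = All.tabulate λ xz → glue₁ (links₁ xz)
      ; glue₂   = All.tabulate λ xz → glue₂ (links₂ xz)
      ; matched = λ x → Match-≡ refl refl (cong l (sym (twin-left x))) (cong r (sym (twin-left x))) (matched (left x))
      }

corollary2p26 : ∀ (n : ℕ) → 1 ≤ n →
    ∃[ N ] Σ[ G ∈ Graph N ]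
    order G ≡ 10 + 24 * n ×
    CounterexampleA G × CounterexampleB G × CounterexampleC G
-- `prism k` is built from the long words over `weave k`, hence from one insertion more than
-- `weave k` itself: `suc k` insertions in all.
corollary2p26 (suc k) _ =
  m k + m k , G , trans order-G (labelCount-double (suc k)) ,
  counterexampleA 11≤ , counterexampleB 11≤ , counterexampleC 11≤
  where
  open PrismGraph (prism k)
  11≤ : 11 ≤ m k + m k
  11≤ = s≤s (s≤s (s≤s (s≤s (s≤s (s≤s (s≤s (s≤s (s≤s (s≤s (s≤s z≤n))))))))))
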